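{- Let $B$ be a non-empty bouquet (one having at least one edge). Then ${}^{\partial}\varepsilon_{B}(z)=2^{e(B)}z^{b}$ for some integer $b\ge 0$ if and only if $B=B_{t_1}\vee\cdots\vee B_{t_k}$ (some ribbon-join) for some $k\ge 1$ and some $B_{t_i}\in\mathcal{B}$, $1\le i\le k$, where $\mathcal{B}=\{B_{\overline{1}},B_1,B_3,B_5,\ldots\}$. Furthermore, in this case, if the number of the factors $B_{t_i}$ equal to $B_{\overline{1}}$ is $k_2$, then $b=e(B)-k+k_2$.
   Context: Ribbon graphs are finite, possibly non-orientable, considered up to equivalence. For a ribbon graph $G$, let $v(G),e(G),f(G)$ be its numbers of vertices, edges and boundary components. For connected $G$ the Euler genus $\varepsilon(G)$ is defined by $2-\varepsilon(G)=v(G)-e(G)+f(G)$. For $A\subseteq E(G)$ the partial dual $G^{A}$ is obtained as follows: take the spanning ribbon subgraph $(V(G),A)$, glue a disc to $G$ along each boundary component of this subgraph (these discs are the vertex-discs of $G^A$), and remove the interiors of all vertex-discs of $G$; the edge-ribbons are kept as the edges of $G^A$. The partial-dual Euler genus polynomial of $G$ is ${}^{\partial}\varepsilon_{G}(z)=\sum_{A\subseteq E(G)}z^{\varepsilon(G^{A})}$. A bouquet is a ribbon graph with exactly one vertex. A loop $e$ at the vertex-disc $v$ is twisted if $e\cup v$ is homeomorphic to a Möbius band, and untwisted otherwise. A bouquet is represented by a signed rotation: the cyclic ordering of its half-edges around the vertex, where the two half-edges of an untwisted loop get the same sign $+$ and the two half-edges of a twisted loop get different signs (one $+$, one $-$);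 the sign $+$ is omitted. $B_{\overline{1}}$ is the bouquet with signed rotation $(1,-1)$ (one twisted loop). For $t\geq 1$, $B_t$ is the bouquet with signed rotation $(1,2,\ldots,t,1,2,\ldots,t)$. A ribbon-join $P\vee Q$ of two disjoint ribbon graphs $P,Q$ is obtained by choosing an arc on the boundary of a vertex-disc of $P$ lying between two consecutive ribbon ends, choosing likewise an arc on the boundary of a vertex-disc of $Q$, and pasting the two vertex-discs together along these arcs into one vertex-disc. For bouquets this means cutting the two cyclic signed rotations open into words and concatenating the words into one cyclic word. The ribbon-join is in general not unique; $B=B_{t_1}\vee\cdots\vee B_{t_k}$ means that $B$ can be obtained by some iterated ribbon-join of these bouquets. -}

module Defs where

open import Data.Bool using (Bool; true; false; not; if_then_else_)
import Data.Bool.Properties as Bool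
open import Data.Fin using (Fin; zero; suc; fromℕ; inject₁; splitAt; join)
import Data.Fin.Properties as Fin
open import Data.Fin.Subset using (Subset; inside; outside)
open import Data.Fin.Relation.Unary.Top using (view; ‵fromℕ; ‵inject₁; view-fromℕ; view-inject₁)
open import Data.Integer using (ℤ; +_)
import Data.Integer as ℤ
open import Data.List using (List; []; _∷_; [_]; _++_; map; length; allFin; cartesianProduct; deduplicate)
open import Data.Nat.ListAction using (sum)
open import Data.List.Membership.Propositional using (_∈_)
open import Data.List.Membership.Propositional.Properties using (∈-cartesianProduct⁺; ∈-allFin)
open import Data.List.Relation.Unary.Any using (here; there)
open import Data.Nat using (ℕ; zero; suc; _+_; _*_)
open import Data.Product using (_×_; _,_; proj₁; proj₂)
open import Data.Product.Properties using (≡-dec)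
open import Data.Product.Function.NonDependent.Propositional using (_×-↔_)
open import Data.Sign using (Sign)
open import Data.Sum using (_⊎_; inj₁; inj₂)
open import Data.Sum.Properties using (inj₁-injective; inj₂-injective)
open import Data.Vec using (_∷_; []; lookup)
open import Function using (_∘_; _↔_; Inverse)
open import Function.Construct.Composition using (_↔-∘_)
open import Function.Construct.Identity using (↔-id)
open import Relation.Binary.Construct.Closure.ReflexiveTransitive using (Star; ε; _◅_; _◅◅_)
open import Relation.Binary.Core using (Rel)
open import Relation.Binary.Definitions using (Decidable; DecidableEquality)
open import Relation.Binary.PropositionalEquality hiding ([_])
open import Relation.Nullary using (yes; no; does; contradiction)
open import Relation.Nullary.Decidable using (map′; _⊎-dec_; _×-dec_)

-- An edge-ribbon is a rectangle with two opposite "ends", glued to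
-- vertex-discs, and two opposite free "sides".  A flag is a corner of
-- such a rectangle: (edge , end , side).

Flag : ℕ → Set
Flag m = Fin m × Bool × Bool

along across : ∀ {m} → Flag m → Flag m
along  (i , s , t) = i , not s , t
across (i , s , t) = i , s , not t

-- The part of the vertex boundaries not covered by ribbon ends is a
-- disjoint union of arcs joining flags in pairs; `corner` maps a flag to
-- the other endpoint of its arc.  Every fixed-point-free involution
-- arises, and it determines the ribbon graph.  (Every vertex meets at
-- least one ribbon: isolated vertices are not represented.  Ribbon-joins
-- of graphs with this property have it, and so do their partial duals.)

record RibbonGraph : Set where
  field
    e                 : ℕ
    corner            : Flag e → Flag e
    corner-involutive : ∀ x → corner (corner x) ≡ x
    corner-fixfree    : ∀ x → corner x ≢ x

open RibbonGraph public

FlagOf : RibbonGraph → Set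
FlagOf G = Flag (e G)

infix 4 _≅_

record _≅_ (G H : RibbonGraph) : Set where
  field
    flags         : FlagOf G ↔ FlagOf H
  open Inverse flags using (to)
  field
    corner-commutes : ∀ x → to (corner G x) ≡ corner H (to x)
    along-commutes  : ∀ x → to (along x) ≡ along (to x)
    across-commutes : ∀ x → to (across x) ≡ across (to x)

infix 4 _≟ᶠ_

_≟ᶠ_ : ∀ {m} → DecidableEquality (Flag m)
_≟ᶠ_ = ≡-dec Fin._≟_ (≡-dec Bool._≟_ Bool._≟_)

allBool : List Bool
allBool = false ∷ true ∷ []

allFlags : ∀ m → List (Flag m)
allFlags m = cartesianProduct (allFin m) (cartesianProduct allBool allBool)

∈-allBool : ∀ b → b ∈ allBool
∈-allBool false = here refl
∈-allBool true  = there (here refl)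

∈-allFlags : ∀ {m} (x : Flag m) → x ∈ allFlags m
∈-allFlags (i , s , t) =
  ∈-cartesianProduct⁺ (∈-allFin i) (∈-cartesianProduct⁺ (∈-allBool s) (∈-allBool t))

Step : ∀ {m} → (f g : Flag m → Flag m) → Rel (Flag m) _
Step f g x y = y ≡ f x ⊎ y ≡ g x

-- For involutions f and g this is an equivalence relation whose classes
-- are the orbits of the group they generate.

SameOrbit : ∀ {m} → (f g : Flag m → Flag m) → Rel (Flag m) _
SameOrbit f g = Star (Step f g)

-- SameOrbit is decided by the Floyd–Warshall recursion: Via zs x y says
-- that y is reachable from x with intermediate flags taken from zs.

module _ {m} (f g : Flag m → Flag m) where

  Via : List (Flag m) → Rel (Flag m) _
  Via []       x y = x ≡ y ⊎ Step f g x y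
  Via (z ∷ zs) x y = Via zs x y ⊎ (Via zs x z × Via zs z y)

  via? : ∀ zs → Decidable (Via zs)
  via? []       x y = x ≟ᶠ y ⊎-dec (y ≟ᶠ f x ⊎-dec y ≟ᶠ g x)
  via? (z ∷ zs) x y = via? zs x y ⊎-dec (via? zs x z ×-dec via? zs z y)

  weaken : ∀ zs {x y} → Via [] x y → Via zs x y
  weaken []       p = p
  weaken (z ∷ zs) p = inj₁ (weaken zs p)

  via-trans : ∀ zs {x w y} → w ∈ zs → Via zs x w → Via zs w y → Via zs x y
  via-trans (z ∷ zs) (here refl) p q = inj₂ (into p , outof q)
    where
    into : ∀ {x} → Via (z ∷ zs) x z → Via zs x z
    into (inj₁ r)       = r
    into (inj₂ (r , _)) = r
    outof : ∀ {y} → Via (z ∷ zs) z y → Via zs z y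
    outof (inj₁ r)       = r
    outof (inj₂ (_ , r)) = r
  via-trans (z ∷ zs) (there k) (inj₁ p)       (inj₁ q)       = inj₁ (via-trans zs k p q)
  via-trans (z ∷ zs) (there k) (inj₁ p)       (inj₂ (q , r)) = inj₂ (via-trans zs k p q , r)
  via-trans (z ∷ zs) (there k) (inj₂ (p , q)) (inj₁ r)       = inj₂ (p , via-trans zs k q r)
  via-trans (z ∷ zs) (there k) (inj₂ (p , _)) (inj₂ (_ , r)) = inj₂ (p , r)

  sound : ∀ zs {x y} → Via zs x y → SameOrbit f g x y
  sound []       (inj₁ refl)    = ε
  sound []       (inj₂ s)       = s ◅ ε
  sound (z ∷ zs) (inj₁ p)       = sound zs p
  sound (z ∷ zs) (inj₂ (p , q)) = sound zs p ◅◅ sound zs q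

  complete : ∀ {x y} → SameOrbit f g x y → Via (allFlags m) x y
  complete ε        = weaken (allFlags m) (inj₁ refl)
  complete (s ◅ ss) =
    via-trans (allFlags m) (∈-allFlags _) (weaken (allFlags m) (inj₂ s)) (complete ss)

  sameOrbit? : Decidable (SameOrbit f g)
  sameOrbit? x y = map′ (sound (allFlags m)) complete (via? (allFlags m) x y)

  #orbits : ℕ
  #orbits = length (deduplicate sameOrbit? (allFlags m))

-- The boundary of a vertex-disc alternates between corner arcs and
-- ribbon ends, a boundary component of the ribbon graph between corner
-- arcs and ribbon sides.

v f : RibbonGraph → ℕ
v G = #orbits (corner G) across
f G = #orbits (corner G) along

IsBouquet : RibbonGraph → Set
IsBouquet G = v G ≡ 1

-- Meaningful for connected G.

eulerGenus : RibbonGraph → ℤ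
eulerGenus G = + 2 ℤ.- (+ v G ℤ.- + e G ℤ.+ + f G)

-- A boundary component of the spanning ribbon subgraph (V(G) , A) runs
-- through corner arcs, sides of ribbons in A and ends of ribbons not in
-- A.  These are to be the vertex boundaries of the partial dual, so its
-- ribbons in A are those of G with ends and sides exchanged.  `turn A`
-- is this change of coordinates on flags.

turn : ∀ {m} → Subset m → Flag m → Flag m
turn A (i , s , t) = if lookup A i then (i , t , s) else (i , s , t)

turn-involutive : ∀ {m} (A : Subset m) x → turn A (turn A x) ≡ x
turn-involutive A (i , s , t) with lookup A i in eq
... | true  rewrite eq = refl
... | false rewrite eq = refl

_^ᵖ_ : (G : RibbonGraph) → Subset (e G) → RibbonGraph
G ^ᵖ A = record
  { e                 = e G
  ; corner            = turn A ∘ corner G ∘ turn A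
  ; corner-involutive = λ x → trans
      (cong (turn A ∘ corner G) (turn-involutive A (corner G (turn A x))))
      (trans (cong (turn A) (corner-involutive G (turn A x))) (turn-involutive A x))
  ; corner-fixfree    = λ x p → corner-fixfree G (turn A x)
      (trans (sym (turn-involutive A (corner G (turn A x)))) (cong (turn A) p))
  }

-- Laurent polynomials in z, as coefficient functions.  (Exponents are
-- integers because eulerGenus is integer-valued by definition.)

Poly : Set
Poly = ℤ → ℕ

z^_ : ℤ → Poly
(z^ i) j = if does (i ℤ.≟ j) then 1 else 0

_·_ : ℕ → Poly → Poly
(c · p) j = c * p j

infixr 7 _·_
infix  8 z^_

sumPoly : List Poly → Poly
sumPoly ps j = sum (map (λ p → p j) ps)

allSubsets : ∀ m → List (Subset m)
allSubsets zero    = [ [] ]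
allSubsets (suc m) = map (outside ∷_) (allSubsets m) ++ map (inside ∷_) (allSubsets m)

∂ε : RibbonGraph → Poly
∂ε G = sumPoly (map (λ A → z^ eulerGenus (G ^ᵖ A)) (allSubsets (e G)))

HalfEdge : ℕ → Set
HalfEdge m = Bool × Fin m

-- `word` lists the half-edges in cyclic order around the vertex.

record SignedRotation (m : ℕ) : Set where
  field
    word : Fin (2 * m) ↔ HalfEdge m
    sign : HalfEdge m → Sign

next prev : ∀ {n} → Fin n → Fin n
next {suc n} i with view i
... | ‵fromℕ     = zero
... | ‵inject₁ j = suc j
prev {suc n} zero    = fromℕ n
prev {suc n} (suc i) = inject₁ i

next-prev : ∀ {n} (i : Fin n) → next (prev i) ≡ i
next-prev {suc n} zero    rewrite view-fromℕ n   = refl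
next-prev {suc n} (suc i) rewrite view-inject₁ i = refl

prev-next : ∀ {n} (i : Fin n) → prev (next i) ≡ i
prev-next {suc n} i with view i
... | ‵fromℕ     = refl
... | ‵inject₁ j = refl

module _ {m} (R : SignedRotation m) where

  open SignedRotation R
  open Inverse word using (to; from; strictlyInverseˡ; strictlyInverseʳ)

  -- The side first met at a half-edge when going around the vertex.
  -- On an untwisted ribbon (equal signs) the two ends are traversed
  -- with opposite sides first, which makes ribbon and disc an annulus.

  firstSide : HalfEdge m → Bool
  firstSide h with sign h
  ... | Sign.+ = proj₁ h
  ... | Sign.- = not (proj₁ h)

  entry exit : HalfEdge m → Flag m
  entry h = proj₂ h , proj₁ h , firstSide h
  exit  h = across (entry h)

  succʰ predʰ : HalfEdge m → HalfEdge m
  succʰ h = to (next (from h))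
  predʰ h = to (prev (from h))

  cornerʳ : Flag m → Flag m
  cornerʳ (i , s , t) with t Bool.≟ firstSide (s , i)
  ... | yes _ = exit (predʰ (s , i))
  ... | no  _ = entry (succʰ (s , i))

  succ-pred : ∀ h → succʰ (predʰ h) ≡ h
  succ-pred h rewrite strictlyInverseʳ (prev (from h)) | next-prev (from h) = strictlyInverseˡ h

  pred-succ : ∀ h → predʰ (succʰ h) ≡ h
  pred-succ h rewrite strictlyInverseʳ (next (from h)) | prev-next (from h) = strictlyInverseˡ h

  corner-entry : ∀ h → cornerʳ (entry h) ≡ exit (predʰ h)
  corner-entry h with firstSide h Bool.≟ firstSide h
  ... | yes _ = refl
  ... | no  p = contradiction refl p

  corner-exit : ∀ h → cornerʳ (exit h) ≡ entry (succʰ h)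
  corner-exit h with not (firstSide h) Bool.≟ firstSide h
  ... | yes p = contradiction (sym p) (Bool.not-¬ refl)
  ... | no  _ = refl

  exit-flag : ∀ {i s t} → t ≢ firstSide (s , i) → exit (s , i) ≡ (i , s , t)
  exit-flag {i} {s} p = cong (λ b → i , s , b) (sym (Bool.¬-not p))

  halfEdge : Flag m → HalfEdge m
  halfEdge (i , s , _) = s , i

  entry≢exit : ∀ {h h′} → entry h ≢ exit h′
  entry≢exit {h} {h′} p with cong halfEdge p
  ... | refl = Bool.not-¬ refl (cong (λ x → proj₂ (proj₂ x)) p)

  cornerʳ-involutive : ∀ x → cornerʳ (cornerʳ x) ≡ x
  cornerʳ-involutive (i , s , t) with t Bool.≟ firstSide (s , i)
  ... | yes refl = trans (corner-exit (predʰ (s , i))) (cong entry (succ-pred (s , i)))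
  ... | no  p    = trans (corner-entry (succʰ (s , i)))
                     (trans (cong exit (pred-succ (s , i))) (exit-flag p))

  cornerʳ-fixfree : ∀ x → cornerʳ x ≢ x
  cornerʳ-fixfree (i , s , t) with t Bool.≟ firstSide (s , i)
  ... | yes refl = λ p → entry≢exit (sym p)
  ... | no  q    = λ p → entry≢exit (trans p (sym (exit-flag q)))

  bouquet : RibbonGraph
  bouquet = record
    { e                 = m
    ; corner            = cornerʳ
    ; corner-involutive = cornerʳ-involutive
    ; corner-fixfree    = cornerʳ-fixfree
    }

-- The cyclic word (1 , … , t , 1 , … , t).

doubled : ∀ t → Fin (2 * t) ↔ HalfEdge t
doubled t = (Fin.2↔Bool ×-↔ ↔-id (Fin t)) ↔-∘ Fin.*↔× {2} {t}

B[_] : ℕ → RibbonGraph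
B[ t ] = bouquet {t} (record { word = doubled t ; sign = λ _ → Sign.+ })

B₁̄ : RibbonGraph
B₁̄ = bouquet {1} (record
  { word = doubled 1
  ; sign = λ { (false , _) → Sign.+ ; (true , _) → Sign.- } })

-- The arc {a , corner P a} is pasted to the arc {b , corner Q b} with a
-- meeting b; replacing b by corner Q b gives the other way of pasting.

module _ (P Q : RibbonGraph) (a : FlagOf P) (b : FlagOf Q) where

  pasted : FlagOf P ⊎ FlagOf Q → FlagOf P ⊎ FlagOf Q
  pasted (inj₁ x) with x ≟ᶠ a | x ≟ᶠ corner P a
  ... | yes _ | _     = inj₂ b
  ... | no  _ | yes _ = inj₂ (corner Q b)
  ... | no  _ | no  _ = inj₁ (corner P x)
  pasted (inj₂ y) with y ≟ᶠ b | y ≟ᶠ corner Q b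
  ... | yes _ | _     = inj₁ a
  ... | no  _ | yes _ = inj₁ (corner P a)
  ... | no  _ | no  _ = inj₂ (corner Q y)

  splitFlag : Flag (e P + e Q) → FlagOf P ⊎ FlagOf Q
  splitFlag (i , st) with splitAt (e P) i
  ... | inj₁ j = inj₁ (j , st)
  ... | inj₂ k = inj₂ (k , st)

  joinFlag : FlagOf P ⊎ FlagOf Q → Flag (e P + e Q)
  joinFlag (inj₁ (j , st)) = join (e P) (e Q) (inj₁ j) , st
  joinFlag (inj₂ (k , st)) = join (e P) (e Q) (inj₂ k) , st

  split-join : ∀ z → splitFlag (joinFlag z) ≡ z
  split-join (inj₁ (j , st)) rewrite Fin.splitAt-join (e P) (e Q) (inj₁ j) = refl
  split-join (inj₂ (k , st)) rewrite Fin.splitAt-join (e P) (e Q) (inj₂ k) = refl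

  join-split : ∀ x → joinFlag (splitFlag x) ≡ x
  join-split (i , st) with splitAt (e P) i in eq
  ... | inj₁ j = cong (_, st) (trans (cong (join (e P) (e Q)) (sym eq)) (Fin.join-splitAt (e P) (e Q) i))
  ... | inj₂ k = cong (_, st) (trans (cong (join (e P) (e Q)) (sym eq)) (Fin.join-splitAt (e P) (e Q) i))

  pasted-a : pasted (inj₁ a) ≡ inj₂ b
  pasted-a with a ≟ᶠ a
  ... | yes _ = refl
  ... | no  p = contradiction refl p

  pasted-a′ : pasted (inj₁ (corner P a)) ≡ inj₂ (corner Q b)
  pasted-a′ with corner P a ≟ᶠ a | corner P a ≟ᶠ corner P a
  ... | yes p | _     = contradiction p (corner-fixfree P a)
  ... | no  _ | yes _ = refl
  ... | no  _ | no  p = contradiction refl p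

  pasted-b : pasted (inj₂ b) ≡ inj₁ a
  pasted-b with b ≟ᶠ b
  ... | yes _ = refl
  ... | no  p = contradiction refl p

  pasted-b′ : pasted (inj₂ (corner Q b)) ≡ inj₁ (corner P a)
  pasted-b′ with corner Q b ≟ᶠ b | corner Q b ≟ᶠ corner Q b
  ... | yes p | _     = contradiction p (corner-fixfree Q b)
  ... | no  _ | yes _ = refl
  ... | no  _ | no  p = contradiction refl p

  flip-corner : ∀ (G : RibbonGraph) {x y} → corner G x ≡ y → x ≡ corner G y
  flip-corner G {x} p = trans (sym (corner-involutive G x)) (cong (corner G) p)

  pasted-P : ∀ x → x ≢ a → x ≢ corner P a → pasted (inj₁ (corner P x)) ≡ inj₁ x
  pasted-P x p q with corner P x ≟ᶠ a | corner P x ≟ᶠ corner P a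
  ... | yes r | _     = contradiction (flip-corner P r) q
  ... | no  _ | yes r = contradiction (trans (flip-corner P r) (corner-involutive P a)) p
  ... | no  _ | no  _ = cong inj₁ (corner-involutive P x)

  pasted-Q : ∀ y → y ≢ b → y ≢ corner Q b → pasted (inj₂ (corner Q y)) ≡ inj₂ y
  pasted-Q y p q with corner Q y ≟ᶠ b | corner Q y ≟ᶠ corner Q b
  ... | yes r | _     = contradiction (flip-corner Q r) q
  ... | no  _ | yes r = contradiction (trans (flip-corner Q r) (corner-involutive Q b)) p
  ... | no  _ | no  _ = cong inj₂ (corner-involutive Q y)

  pasted-involutive : ∀ z → pasted (pasted z) ≡ z
  pasted-involutive (inj₁ x) with x ≟ᶠ a | x ≟ᶠ corner P a
  ... | yes refl | _        = pasted-b
  ... | no  _    | yes refl = pasted-b′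
  ... | no  p    | no  q    = pasted-P x p q
  pasted-involutive (inj₂ y) with y ≟ᶠ b | y ≟ᶠ corner Q b
  ... | yes refl | _        = pasted-a
  ... | no  _    | yes refl = pasted-a′
  ... | no  p    | no  q    = pasted-Q y p q

  pasted-fixfree : ∀ z → pasted z ≢ z
  pasted-fixfree (inj₁ x) with x ≟ᶠ a | x ≟ᶠ corner P a
  ... | yes _ | _     = λ ()
  ... | no  _ | yes _ = λ ()
  ... | no  _ | no  _ = λ p → corner-fixfree P x (inj₁-injective p)
  pasted-fixfree (inj₂ y) with y ≟ᶠ b | y ≟ᶠ corner Q b
  ... | yes _ | _     = λ ()
  ... | no  _ | yes _ = λ ()
  ... | no  _ | no  _ = λ p → corner-fixfree Q y (inj₂-injective p)

  ribbonJoin : RibbonGraph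
  ribbonJoin = record
    { e                 = e P + e Q
    ; corner            = joinFlag ∘ pasted ∘ splitFlag
    ; corner-involutive = λ x → trans
        (cong (joinFlag ∘ pasted) (split-join (pasted (splitFlag x))))
        (trans (cong joinFlag (pasted-involutive (splitFlag x))) (join-split x))
    ; corner-fixfree    = λ x p → pasted-fixfree (splitFlag x)
        (trans (sym (split-join (pasted (splitFlag x)))) (cong splitFlag p))
    }

data 𝓑 : Set where
  twisted : 𝓑
  odd     : (s : ℕ) → 𝓑

⟦_⟧ : 𝓑 → RibbonGraph
⟦ twisted ⟧ = B₁̄
⟦ odd s   ⟧ = B[ suc (2 * s) ]

-- B ≅⋁ Fs: up to equivalence, B is obtained from the factors Fs by
-- iterated ribbon-joins, with any bracketing and any choice of arcs.
-- Fs is then necessarily non-empty.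

infix 4 _≅⋁_

data _≅⋁_ : RibbonGraph → List 𝓑 → Set where
  factor : ∀ {B} F → B ≅ ⟦ F ⟧ → B ≅⋁ [ F ]
  joined : ∀ {B P Q Fs Gs} → P ≅⋁ Fs → Q ≅⋁ Gs →
           ∀ a b → B ≅ ribbonJoin P Q a b → B ≅⋁ Fs ++ Gs

#twisted : List 𝓑 → ℕ
#twisted []             = 0
#twisted (twisted ∷ Fs) = suc (#twisted Fs)
#twisted (odd _   ∷ Fs) = #twisted Fs

{-# OPTIONS --safe #-}

-- Let n(A) be the number of boundary circles of the spanning subgraph (V(B) , A). Since
-- v(Bᴬ) = n(A) and f(Bᴬ) = n(Aᶜ), the polynomial is a monomial iff n(A) + n(Aᶜ) is constant.
-- The four corners of a ribbon can be paired along its ends, along its sides or diagonally;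
-- of the three numbers of circles obtained in this way, one exceeds the two others, which
-- are equal, by one. For the pairings at two ribbons, with a set A of other ribbons and with
-- its complement, this law and constancy force crossing ribbons to be untwisted; for three
-- ribbons they make crossing transitive. Hence, if not all ribbons cross each other, an
-- interval of the word of B is closed under taking the other end of a ribbon, and B is a
-- ribbon-join of smaller bouquets that satisfy the constancy condition again. If all ribbons
-- cross, then B is a single twisted loop or has the word 1 … t 1 … t, for which n(A) is 1 or 2
-- according to the parity of A, so that t is odd. Conversely, the law applied to the two arcs
-- of a ribbon-join shows that n is additive under ribbon-joins up to a shift by one.

module Submission where

open import Defs
import Algebra
open import Data.Bool using (Bool; true; false; not; _∧_; _xor_; if_then_else_)
import Data.Bool.Properties as Bool
open import Data.Empty using (⊥; ⊥-elim)
open import Data.Fin using (Fin; zero; suc; _↑ˡ_; _↑ʳ_; fromℕ<; splitAt; join; toℕ; fromℕ; inject₁; combine)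
open import Data.Fin.Induction using (<-weakInduction)
import Data.Fin.Properties as Fin
open import Data.Fin.Relation.Unary.Top using (view; ‵fromℕ; ‵inject₁)
open import Data.Fin.Subset using (Subset; inside; outside)
open import Data.Integer using (ℤ; +_; _+_; _-_)
import Data.Integer as ℤ
import Data.Integer.Properties as ℤ
open import Algebra.Properties.Group (Algebra.AbelianGroup.group ℤ.+-0-abelianGroup) using (∙-cancelʳ)
import Data.Integer.Tactic.RingSolver as ℤ
open import Data.List using (List; []; _∷_; length; deduplicate)
import Data.List as List
import Data.List.Properties as List
open import Data.List.Membership.Propositional using (_∈_)
open import Data.List.Membership.Propositional.Properties using (∈-lookup; ∈-map⁺; ∈-++⁺ˡ; ∈-++⁺ʳ)
open import Data.List.Relation.Unary.All as All using (All; []; _∷_)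
open import Data.List.Relation.Unary.All.Properties using (¬All⇒Any¬)
open import Data.List.Relation.Unary.AllPairs using (AllPairs; []; _∷_)
open import Data.List.Relation.Unary.Any as Any using (Any; here; there)
import Data.List.Relation.Unary.Any.Properties as Any
import Data.List.Relation.Unary.Unique.DecSetoid.Properties as Unique
open import Data.Nat using (ℕ; zero; suc; _^_; _≤_; _<_; z≤n; s≤s)
import Data.Nat as ℕ
import Data.Nat.Properties as ℕ
import Data.Nat.Tactic.RingSolver as ℕ
open import Data.Product using (_×_; _,_; proj₁; proj₂; ∃-syntax; Σ-syntax)
import Data.Sign as Sign
open import Data.Sum as Sum using (_⊎_; inj₁; inj₂; [_,_]′)
import Data.Sum.Properties as Sum
open import Data.Vec using ([]; _∷_; lookup; tabulate)
open import Data.Vec.Properties using (lookup∘tabulate)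
open import Function using (_∘_; id; _⇔_; Inverse; mk⇔; mk↔ₛ′)
open import Function.Bundles using (mk⤖)
open import Function.Consequences.Propositional using (strictlySurjective⇒surjective)
open import Function.Construct.Symmetry using (↔-sym)
open import Function.Properties.Bijection using (⤖⇒↔)
open import Level using (0ℓ)
open import Data.Product.Properties using (≡-dec)
open import Relation.Binary using (DecSetoid; tri<; tri≈; tri>)
open import Relation.Binary.Construct.Closure.ReflexiveTransitive using (Star; ε; _◅_; _◅◅_; kleisliStar; reverse; gmap; fold)
open import Relation.Binary.Core using (Rel)
open import Relation.Binary.Definitions using (DecidableEquality)
open import Relation.Binary.PropositionalEquality hiding ([_])
open import Relation.Nullary using (¬_; Dec; yes; no; does; contradiction)
open import Relation.Nullary.Decidable using (dec-true; dec-false; _⊎-dec_)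

-- Counting orbits

record Classes {X : Set} (R : Rel X 0ℓ) (n : ℕ) : Set where
  field
    class     : X → Fin n
    rep       : Fin n → X
    class-rep : ∀ k → class (rep k) ≡ k
    respects  : ∀ {x y} → R x y → class x ≡ class y
    reflects  : ∀ {x y} → class x ≡ class y → R x y

open Classes

Classes-≤ : ∀ {X : Set} {R : Rel X 0ℓ} {m n} → Classes R m → Classes R n → m ≤ n
Classes-≤ p q = Fin.injective⇒≤ {f = class q ∘ rep p} λ {i} {j} eq →
  trans (sym (class-rep p i)) (trans (respects p (reflects q eq)) (class-rep p j))

Classes-unique : ∀ {X : Set} {R : Rel X 0ℓ} {m n} → Classes R m → Classes R n → m ≡ n
Classes-unique p q = ℕ.≤-antisym (Classes-≤ p q) (Classes-≤ q p)

Classes-transport : ∀ {X Y : Set} {R : Rel X 0ℓ} {S : Rel Y 0ℓ} {n} (φ : X → Y) (ψ : Y → X) →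
  (∀ x → R (ψ (φ x)) x) → (∀ {y y′} → S y y′ → R (ψ y) (ψ y′)) → (∀ {y y′} → R (ψ y) (ψ y′) → S y y′) →
  Classes R n → Classes S n
Classes-transport φ ψ ψφ to from c = record
  { class     = class c ∘ ψ
  ; rep       = φ ∘ rep c
  ; class-rep = λ k → trans (respects c (ψφ (rep c k))) (class-rep c k)
  ; respects  = respects c ∘ to
  ; reflects  = from ∘ reflects c
  }

Classes-cong : ∀ {X : Set} {R S : Rel X 0ℓ} {n} →
  (∀ {x y} → S x y → R x y) → (∀ {x y} → R x y → S x y) → Classes R n → Classes S n
Classes-cong to from c = record
  { class = class c ; rep = rep c ; class-rep = class-rep c ; respects = respects c ∘ to ; reflects = from ∘ reflects c }

Involutive : {X : Set} → (X → X) → Set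
Involutive f = ∀ x → f (f x) ≡ x

Fixfree : {X : Set} → (X → X) → Set
Fixfree f = ∀ x → f x ≢ x

Involutive-injective : ∀ {X : Set} {f : X → X} → Involutive f → ∀ {x y} → f x ≡ f y → x ≡ y
Involutive-injective {f = f} inv {x} {y} eq = trans (sym (inv x)) (trans (cong f eq) (inv y))

Orbit : {X : Set} → (f g : X → X) → Rel X 0ℓ
Orbit f g = Star (λ x y → y ≡ f x ⊎ y ≡ g x)

module _ {X : Set} {f g : X → X} where

  stepˡ : ∀ x → Orbit f g x (f x)
  stepˡ x = inj₁ refl ◅ ε

  stepʳ : ∀ x → Orbit f g x (g x)
  stepʳ x = inj₂ refl ◅ ε

  ≡⇒Orbit : ∀ {x y} → x ≡ y → Orbit f g x y
  ≡⇒Orbit refl = ε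

  Orbit-sym : Involutive f → Involutive g → ∀ {x y} → Orbit f g x y → Orbit f g y x
  Orbit-sym invf invg = reverse λ
    { (inj₁ refl) → inj₁ (sym (invf _)) ; (inj₂ refl) → inj₂ (sym (invg _)) }

  Orbit-map : ∀ {Y : Set} {f′ g′ : Y → Y} (φ : X → Y) →
    (∀ x → Orbit f′ g′ (φ x) (φ (f x))) → (∀ x → Orbit f′ g′ (φ x) (φ (g x))) →
    ∀ {x y} → Orbit f g x y → Orbit f′ g′ (φ x) (φ y)
  Orbit-map φ p q = kleisliStar φ λ { (inj₁ refl) → p _ ; (inj₂ refl) → q _ }

  Orbit-invariant : ∀ {Z : Set} (φ : X → Z) → (∀ x → φ (f x) ≡ φ x) → (∀ x → φ (g x) ≡ φ x) →
    ∀ {x y} → Orbit f g x y → φ x ≡ φ y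
  Orbit-invariant φ p q = fold (λ x y → φ x ≡ φ y)
    (λ { (inj₁ refl) → trans (sym (p _)) ; (inj₂ refl) → trans (sym (q _)) }) refl

Orbit-cong : ∀ {X : Set} {f f′ g g′ : X → X} → f ≗ f′ → g ≗ g′ → ∀ {x y} → Orbit f g x y → Orbit f′ g′ x y
Orbit-cong p q = gmap id λ { (inj₁ refl) → inj₁ (p _) ; (inj₂ refl) → inj₂ (q _) }

Orbit-swap : ∀ {X : Set} {f g : X → X} {x y} → Orbit f g x y → Orbit g f x y
Orbit-swap = gmap id λ { (inj₁ p) → inj₂ p ; (inj₂ p) → inj₁ p }

AllPairs-lookup : ∀ {X : Set} {R : Rel X 0ℓ} → (∀ {x y} → R x y → R y x) → ∀ {xs} → AllPairs (λ x y → ¬ R x y) xs →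
  ∀ i j → R (List.lookup xs i) (List.lookup xs j) → i ≡ j
AllPairs-lookup R-sym (_ ∷ _)  zero    zero    _ = refl
AllPairs-lookup R-sym (p ∷ _)  zero    (suc j) r = contradiction r (All.lookup p (∈-lookup j))
AllPairs-lookup R-sym (p ∷ _)  (suc i) zero    r = contradiction (R-sym r) (All.lookup p (∈-lookup i))
AllPairs-lookup R-sym (_ ∷ ps) (suc i) (suc j) r = cong suc (AllPairs-lookup R-sym ps i j r)

module _ {m} {f g : Flag m → Flag m} (f-inv : Involutive f) (g-inv : Involutive g) where

  orbitDecSetoid : DecSetoid 0ℓ 0ℓ
  orbitDecSetoid = record
    { Carrier          = Flag m
    ; _≈_              = SameOrbit f g
    ; isDecEquivalence = record
      { isEquivalence = record { refl = ε ; sym = Orbit-sym f-inv g-inv ; trans = _◅◅_ }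
      ; _≟_           = sameOrbit? f g
      }
    }

  #orbits-classes : Classes (Orbit f g) (#orbits f g)
  #orbits-classes = record
    { class     = λ x → Any.index (found x)
    ; rep       = List.lookup reps
    ; class-rep = λ k → sym (distinct k _ (Any.lookup-index (found (List.lookup reps k))))
    ; respects  = λ {x} {y} r → distinct _ _
        (symᵒ (Any.lookup-index (found x)) ◅◅ r ◅◅ Any.lookup-index (found y))
    ; reflects  = λ {x} {y} eq → Any.lookup-index (found x) ◅◅
        subst (λ k → Orbit f g (List.lookup reps k) y) (sym eq) (symᵒ (Any.lookup-index (found y)))
    }
    where
    symᵒ : ∀ {x y} → Orbit f g x y → Orbit f g y x
    symᵒ = Orbit-sym f-inv g-inv
    reps : List (Flag m)
    reps = deduplicate (sameOrbit? f g) (allFlags m)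
    found : ∀ x → Any (Orbit f g x) reps
    found x = Any.deduplicate⁺ (sameOrbit? f g) (λ r p → p ◅◅ symᵒ r)
                (Any.map ≡⇒Orbit (∈-allFlags x))
    distinct : ∀ i j → Orbit f g (List.lookup reps i) (List.lookup reps j) → i ≡ j
    distinct = AllPairs-lookup symᵒ (Unique.deduplicate-! orbitDecSetoid (allFlags m))

-- Re-pairing the four points a , b , c a , c b of an involution c so that a meets b and
-- c a meets c b.

module Switch {X : Set} (_≟_ : DecidableEquality X) (c : X → X) (a b : X) where

  switch : X → X
  switch z with z ≟ a
  ... | yes _ = b
  ... | no  _ with z ≟ b
  ...   | yes _ = a
  ...   | no  _ with z ≟ c a
  ...     | yes _ = c b
  ...     | no  _ with z ≟ c b
  ...       | yes _ = c a
  ...       | no  _ = c z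

  data Place : X → Set where
    atA   : Place a
    atB   : Place b
    atCA  : Place (c a)
    atCB  : Place (c b)
    other : ∀ {z} → z ≢ a → z ≢ b → z ≢ c a → z ≢ c b → Place z

  place : ∀ z → Place z
  place z with z ≟ a
  ... | yes refl = atA
  ... | no  p with z ≟ b
  ...   | yes refl = atB
  ...   | no  q with z ≟ c a
  ...     | yes refl = atCA
  ...     | no  r with z ≟ c b
  ...       | yes refl = atCB
  ...       | no  s    = other p q r s

  switch-a : switch a ≡ b
  switch-a with a ≟ a
  ... | yes _ = refl
  ... | no  p = contradiction refl p

  switch-other : ∀ {z} → z ≢ a → z ≢ b → z ≢ c a → z ≢ c b → switch z ≡ c z
  switch-other {z} p q r s with z ≟ a
  ... | yes t = contradiction t p
  ... | no  _ with z ≟ b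
  ...   | yes t = contradiction t q
  ...   | no  _ with z ≟ c a
  ...     | yes t = contradiction t r
  ...     | no  _ with z ≟ c b
  ...       | yes t = contradiction t s
  ...       | no  _ = refl

  module _ (c-inv : Involutive c) (c-fix : Fixfree c) (a≢b : a ≢ b) (ca≢b : c a ≢ b) where

    cb≢a : c b ≢ a
    cb≢a p = ca≢b (trans (cong c (sym p)) (c-inv b))

    ca≢cb : c a ≢ c b
    ca≢cb = a≢b ∘ Involutive-injective c-inv

    switch-b : switch b ≡ a
    switch-b with b ≟ a
    ... | yes p = contradiction (sym p) a≢b
    ... | no  _ with b ≟ b
    ...   | yes _ = refl
    ...   | no  p = contradiction refl p

    switch-ca : switch (c a) ≡ c b
    switch-ca with c a ≟ a
    ... | yes p = contradiction p (c-fix a)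
    ... | no  _ with c a ≟ b
    ...   | yes p = contradiction p ca≢b
    ...   | no  _ with c a ≟ c a
    ...     | yes _ = refl
    ...     | no  p = contradiction refl p

    switch-cb : switch (c b) ≡ c a
    switch-cb with c b ≟ a
    ... | yes p = contradiction p cb≢a
    ... | no  _ with c b ≟ b
    ...   | yes p = contradiction p (c-fix b)
    ...   | no  _ with c b ≟ c a
    ...     | yes p = contradiction (sym p) ca≢cb
    ...     | no  _ with c b ≟ c b
    ...       | yes _ = refl
    ...       | no  p = contradiction refl p

    c-flip : ∀ {x y} → c x ≡ y → x ≡ c y
    c-flip {x} p = trans (sym (c-inv x)) (cong c p)

    switch-involutive : Involutive switch
    switch-involutive z with place z
    ... | atA  = trans (cong switch switch-a) switch-b
    ... | atB  = trans (cong switch switch-b) switch-a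
    ... | atCA = trans (cong switch switch-ca) switch-cb
    ... | atCB = trans (cong switch switch-cb) switch-ca
    ... | other p q r s = trans (cong switch (switch-other p q r s))
            (trans (switch-other (r ∘ c-flip) (s ∘ c-flip)
              (p ∘ Involutive-injective c-inv) (q ∘ Involutive-injective c-inv)) (c-inv z))

    switch-fixfree : Fixfree switch
    switch-fixfree z eq with place z
    ... | atA  = a≢b (trans (sym eq) switch-a)
    ... | atB  = a≢b (trans (sym switch-b) eq)
    ... | atCA = ca≢cb (trans (sym eq) switch-ca)
    ... | atCB = ca≢cb (trans (sym switch-cb) eq)
    ... | other p q r s = c-fix z (trans (sym (switch-other p q r s)) eq)

    module _ (m : X → X) (m-inv : Involutive m) (ma≡b : m a ≡ b) where

      mb≡a : m b ≡ a
      mb≡a = trans (cong m (sym ma≡b)) (m-inv a)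

      m-away-a : ∀ {z} → z ≢ b → m z ≢ a
      m-away-a {z} q r = q (trans (sym (m-inv z)) (trans (cong m r) ma≡b))

      m-away-b : ∀ {z} → z ≢ a → m z ≢ b
      m-away-b {z} p r = p (trans (sym (m-inv z)) (trans (cong m r) mb≡a))

      a~b : Orbit c m a b
      a~b = subst (Orbit c m a) ma≡b (stepʳ a)

      b~a : Orbit c m b a
      b~a = subst (Orbit c m b) mb≡a (stepʳ b)

      a~ca : Orbit c m a (c a)
      a~ca = stepˡ a

      b~cb : Orbit c m b (c b)
      b~cb = stepˡ b

      ca~a : Orbit c m (c a) a
      ca~a = subst (Orbit c m (c a)) (c-inv a) (stepˡ (c a))

      cb~b : Orbit c m (c b) b
      cb~b = subst (Orbit c m (c b)) (c-inv b) (stepˡ (c b))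

      switch-refines : ∀ {x y} → Orbit switch m x y → Orbit c m x y
      switch-refines = Orbit-map id switch-step stepʳ
        where
        switch-step : ∀ z → Orbit c m z (switch z)
        switch-step z with place z
        ... | atA  = subst (Orbit c m a) (sym switch-a) a~b
        ... | atB  = subst (Orbit c m b) (sym switch-b) b~a
        ... | atCA = subst (Orbit c m (c a)) (sym switch-ca) (ca~a ◅◅ a~b ◅◅ b~cb)
        ... | atCB = subst (Orbit c m (c b)) (sym switch-cb) (cb~b ◅◅ b~a ◅◅ a~ca)
        ... | other p q r s = subst (Orbit c m z) (sym (switch-other p q r s)) (stepˡ z)

      -- A c-m-path becomes a switch-m-path once a and b are pushed off the loop they now form.

      bypass : X → X
      bypass z with z ≟ a
      ... | yes _ = c a
      ... | no  _ with z ≟ b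
      ...   | yes _ = c b
      ...   | no  _ = z

      bypass-a : bypass a ≡ c a
      bypass-a with a ≟ a
      ... | yes _ = refl
      ... | no  p = contradiction refl p

      bypass-b : bypass b ≡ c b
      bypass-b with b ≟ a
      ... | yes p = contradiction (sym p) a≢b
      ... | no  _ with b ≟ b
      ...   | yes _ = refl
      ...   | no  p = contradiction refl p

      bypass-out : ∀ {z} → z ≢ a → z ≢ b → bypass z ≡ z
      bypass-out {z} p q with z ≟ a
      ... | yes r = contradiction r p
      ... | no  _ with z ≟ b
      ...   | yes r = contradiction r q
      ...   | no  _ = refl

      bypass-avoids : ∀ z → bypass z ≢ a × bypass z ≢ b
      bypass-avoids z with z ≟ a
      ... | yes _ = c-fix a , ca≢b
      ... | no  p with z ≟ b
      ...   | yes _ = cb≢a , c-fix b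
      ...   | no  q = p , q

      bypass-orbit : ∀ z → Orbit c m (bypass z) z
      bypass-orbit z with z ≟ a
      ... | yes refl = ca~a
      ... | no  p with z ≟ b
      ...   | yes refl = cb~b
      ...   | no  q = ε

      bypass-path : ∀ {x y} → Orbit c m x y → Orbit switch m (bypass x) (bypass y)
      bypass-path = Orbit-map bypass c-step m-step
        where
        from-to : ∀ {x x′ y y′} → bypass x ≡ x′ → bypass y ≡ y′ → Orbit switch m x′ y′ →
                  Orbit switch m (bypass x) (bypass y)
        from-to p q = subst₂ (Orbit switch m) (sym p) (sym q)
        ca-out : bypass (c a) ≡ c a
        ca-out = bypass-out (c-fix a) ca≢b
        cb-out : bypass (c b) ≡ c b
        cb-out = bypass-out cb≢a (c-fix b)
        c-step : ∀ z → Orbit switch m (bypass z) (bypass (c z))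
        c-step z with place z
        ... | atA  = from-to bypass-a ca-out ε
        ... | atB  = from-to bypass-b cb-out ε
        ... | atCA = from-to ca-out (trans (cong bypass (c-inv a)) bypass-a) ε
        ... | atCB = from-to cb-out (trans (cong bypass (c-inv b)) bypass-b) ε
        ... | other p q r s = from-to (bypass-out p q) (bypass-out (r ∘ c-flip) (s ∘ c-flip))
                (subst (Orbit switch m z) (switch-other p q r s) (stepˡ z))
        away : ∀ {z} → z ≢ a → z ≢ b → Orbit switch m (bypass z) (bypass (m z))
        away {z} p q = from-to (bypass-out p q) (bypass-out (m-away-a q) (m-away-b p)) (stepʳ z)
        m-step : ∀ z → Orbit switch m (bypass z) (bypass (m z))
        m-step z with place z
        ... | atA  = from-to bypass-a (trans (cong bypass ma≡b) bypass-b)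
                (subst (Orbit switch m (c a)) switch-ca (stepˡ (c a)))
        ... | atB  = from-to bypass-b (trans (cong bypass mb≡a) bypass-a)
                (subst (Orbit switch m (c b)) switch-cb (stepˡ (c b)))
        ... | atCA = away (c-fix a) ca≢b
        ... | atCB = away cb≢a (c-fix b)
        ... | other p q _ _ = away p q

      switch-outside : ∀ {x y} → x ≢ a → x ≢ b → y ≢ a → y ≢ b → Orbit c m x y → Orbit switch m x y
      switch-outside p q r s path =
        subst₂ (Orbit switch m) (bypass-out p q) (bypass-out r s) (bypass-path path)

      switch-classes : ∀ {n} → Classes (Orbit c m) n → Classes (Orbit switch m) (suc n)
      switch-classes {n} C = record
        { class     = class′
        ; rep       = rep′
        ; class-rep = class′-rep′
        ; respects  = Orbit-invariant class′ switch-step m-step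
        ; reflects  = λ {x} {y} → reflects′ x y
        }
        where
        class′ : X → Fin (suc n)
        class′ z with z ≟ a
        ... | yes _ = zero
        ... | no  _ with z ≟ b
        ...   | yes _ = zero
        ...   | no  _ = suc (class C z)
        rep′ : Fin (suc n) → X
        rep′ zero    = a
        rep′ (suc k) = bypass (rep C k)
        class′-a : class′ a ≡ zero
        class′-a with a ≟ a
        ... | yes _ = refl
        ... | no  p = contradiction refl p
        class′-b : class′ b ≡ zero
        class′-b with b ≟ a
        ... | yes _ = refl
        ... | no  _ with b ≟ b
        ...   | yes _ = refl
        ...   | no  p = contradiction refl p
        class′-out : ∀ {z} → z ≢ a → z ≢ b → class′ z ≡ suc (class C z)
        class′-out {z} p q with z ≟ a
        ... | yes r = contradiction r p
        ... | no  _ with z ≟ b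
        ...   | yes r = contradiction r q
        ...   | no  _ = refl
        class′-rep′ : ∀ k → class′ (rep′ k) ≡ k
        class′-rep′ zero    = class′-a
        class′-rep′ (suc k) = let p , q = bypass-avoids (rep C k) in
          trans (class′-out p q)
            (cong suc (trans (respects C (bypass-orbit (rep C k))) (class-rep C k)))
        out-step : ∀ {x y} → x ≢ a → x ≢ b → y ≢ a → y ≢ b → Orbit c m x y → class′ y ≡ class′ x
        out-step p q r s path =
          trans (class′-out r s) (trans (cong suc (sym (respects C path))) (sym (class′-out p q)))
        switch-step : ∀ z → class′ (switch z) ≡ class′ z
        switch-step z with place z
        ... | atA  = trans (cong class′ switch-a) (trans class′-b (sym class′-a))
        ... | atB  = trans (cong class′ switch-b) (trans class′-a (sym class′-b))
        ... | atCA = trans (cong class′ switch-ca) (out-step (c-fix a) ca≢b cb≢a (c-fix b) (ca~a ◅◅ a~b ◅◅ b~cb))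
        ... | atCB = trans (cong class′ switch-cb) (out-step cb≢a (c-fix b) (c-fix a) ca≢b (cb~b ◅◅ b~a ◅◅ a~ca))
        ... | other p q r s = trans (cong class′ (switch-other p q r s))
                (out-step p q (r ∘ c-flip) (s ∘ c-flip) (stepˡ z))
        m-step : ∀ z → class′ (m z) ≡ class′ z
        m-step z with z ≟ a
        ... | yes refl = trans (cong class′ ma≡b) class′-b
        ... | no  p with z ≟ b
        ...   | yes refl = trans (cong class′ mb≡a) class′-a
        ...   | no  q = trans (class′-out (m-away-a q) (m-away-b p))
                          (cong suc (sym (respects C (stepʳ z))))
        a~ᵐb : Orbit switch m a b
        a~ᵐb = subst (Orbit switch m a) ma≡b (stepʳ a)
        b~ᵐa : Orbit switch m b a
        b~ᵐa = subst (Orbit switch m b) mb≡a (stepʳ b)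
        reflects′ : ∀ x y → class′ x ≡ class′ y → Orbit switch m x y
        reflects′ x y eq with x ≟ a | y ≟ a
        ... | yes refl | yes refl = ε
        reflects′ x y eq | yes refl | no _ with y ≟ b
        ... | yes refl = a~ᵐb
        reflects′ x y () | yes refl | no _ | no _
        reflects′ x y eq | no _ | yes refl with x ≟ b
        ... | yes refl = b~ᵐa
        reflects′ x y () | no _ | yes refl | no _
        reflects′ x y eq | no p | no r with x ≟ b | y ≟ b
        ... | yes refl | yes refl = ε
        ... | no q | no s = switch-outside p q r s (reflects C (Fin.suc-injective eq))
        reflects′ x y () | no p | no r | yes _ | no _
        reflects′ x y () | no p | no r | no _ | yes _

-- The three pairings of four points

-- The ways of pairing the four corners of a ribbon: along its two ends (ribbon not
-- in A), along its two sides (ribbon in A), or diagonally.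

data Pairing : Set where
  ends sides diags : Pairing

act : Pairing → Bool × Bool → Bool × Bool
act ends  (s , t) = s , not t
act sides (s , t) = not s , t
act diags (s , t) = not s , not t

infix 4 _≟ᵖ_

_≟ᵖ_ : DecidableEquality Pairing
ends  ≟ᵖ ends  = yes refl
ends  ≟ᵖ sides = no λ ()
ends  ≟ᵖ diags = no λ ()
sides ≟ᵖ ends  = no λ ()
sides ≟ᵖ sides = yes refl
sides ≟ᵖ diags = no λ ()
diags ≟ᵖ ends  = no λ ()
diags ≟ᵖ sides = no λ ()
diags ≟ᵖ diags = yes refl

act-involutive : ∀ p → Involutive (act p)
act-involutive ends  (s , t) = cong (s ,_) (Bool.not-involutive t)
act-involutive sides (s , t) = cong (_, t) (Bool.not-involutive s)
act-involutive diags (s , t) = cong₂ _,_ (Bool.not-involutive s) (Bool.not-involutive t)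

act-fixfree : ∀ p → Fixfree (act p)
act-fixfree ends  (s , t) eq = Bool.not-¬ refl (sym (cong proj₂ eq))
act-fixfree sides (s , t) eq = Bool.not-¬ refl (sym (cong proj₁ eq))
act-fixfree diags (s , t) eq = Bool.not-¬ refl (sym (cong proj₁ eq))

act-comm : ∀ p q z → act p (act q z) ≡ act q (act p z)
act-comm ends  ends  _ = refl
act-comm ends  sides _ = refl
act-comm ends  diags _ = refl
act-comm sides ends  _ = refl
act-comm sides sides _ = refl
act-comm sides diags _ = refl
act-comm diags ends  _ = refl
act-comm diags sides _ = refl
act-comm diags diags _ = refl

act-cases : ∀ {p q} → p ≢ q → ∀ z z′ → z′ ≡ z ⊎ z′ ≡ act p z ⊎ z′ ≡ act q z ⊎ z′ ≡ act p (act q z)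
act-cases {ends}  {ends}  p≢q _ _ = contradiction refl p≢q
act-cases {sides} {sides} p≢q _ _ = contradiction refl p≢q
act-cases {diags} {diags} p≢q _ _ = contradiction refl p≢q
act-cases {ends} {sides} _ (s , t) (s′ , t′) with s′ Bool.≟ s | t′ Bool.≟ t
... | yes refl | yes refl = inj₁ refl
... | yes refl | no q     = inj₂ (inj₁ (cong (s ,_) (Bool.¬-not q)))
... | no p     | yes refl = inj₂ (inj₂ (inj₁ (cong (_, t) (Bool.¬-not p))))
... | no p     | no q     = inj₂ (inj₂ (inj₂ (cong₂ _,_ (Bool.¬-not p) (Bool.¬-not q))))
act-cases {ends} {diags} _ (s , t) (s′ , t′) with s′ Bool.≟ s | t′ Bool.≟ t
... | yes refl | yes refl = inj₁ refl
... | yes refl | no q     = inj₂ (inj₁ (cong (s ,_) (Bool.¬-not q)))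
... | no p     | yes refl = inj₂ (inj₂ (inj₂ (cong₂ _,_ (Bool.¬-not p) (sym (Bool.not-involutive t)))))
... | no p     | no q     = inj₂ (inj₂ (inj₁ (cong₂ _,_ (Bool.¬-not p) (Bool.¬-not q))))
act-cases {sides} {diags} _ (s , t) (s′ , t′) with s′ Bool.≟ s | t′ Bool.≟ t
... | yes refl | yes refl = inj₁ refl
... | yes refl | no q     = inj₂ (inj₂ (inj₂ (cong₂ _,_ (sym (Bool.not-involutive s)) (Bool.¬-not q))))
... | no p     | yes refl = inj₂ (inj₁ (cong (_, t) (Bool.¬-not p)))
... | no p     | no q     = inj₂ (inj₂ (inj₁ (cong₂ _,_ (Bool.¬-not p) (Bool.¬-not q))))
act-cases {sides} {ends} p≢q z z′ with act-cases {ends} {sides} (p≢q ∘ sym) z z′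
... | inj₁ e = inj₁ e
... | inj₂ (inj₁ e) = inj₂ (inj₂ (inj₁ e))
... | inj₂ (inj₂ (inj₁ e)) = inj₂ (inj₁ e)
... | inj₂ (inj₂ (inj₂ e)) = inj₂ (inj₂ (inj₂ e))
act-cases {diags} {ends} p≢q z z′ with act-cases {ends} {diags} (p≢q ∘ sym) z z′
... | inj₁ e = inj₁ e
... | inj₂ (inj₁ e) = inj₂ (inj₂ (inj₁ e))
... | inj₂ (inj₂ (inj₁ e)) = inj₂ (inj₁ e)
... | inj₂ (inj₂ (inj₂ e)) = inj₂ (inj₂ (inj₂ e))
act-cases {diags} {sides} p≢q z z′ with act-cases {sides} {diags} (p≢q ∘ sym) z z′
... | inj₁ e = inj₁ e
... | inj₂ (inj₁ e) = inj₂ (inj₂ (inj₁ e))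
... | inj₂ (inj₂ (inj₁ e)) = inj₂ (inj₁ e)
... | inj₂ (inj₂ (inj₂ e)) = inj₂ (inj₂ (inj₂ e))

act-injectiveˡ : ∀ {p q} z → act p z ≡ act q z → p ≡ q
act-injectiveˡ {ends}  {ends}  z eq = refl
act-injectiveˡ {sides} {sides} z eq = refl
act-injectiveˡ {diags} {diags} z eq = refl
act-injectiveˡ {ends}  {sides} z eq = contradiction (cong proj₁ eq) (Bool.not-¬ refl)
act-injectiveˡ {ends}  {diags} z eq = contradiction (cong proj₁ eq) (Bool.not-¬ refl)
act-injectiveˡ {sides} {ends}  z eq = contradiction (sym (cong proj₁ eq)) (Bool.not-¬ refl)
act-injectiveˡ {sides} {diags} z eq = contradiction (cong proj₂ eq) (Bool.not-¬ refl)
act-injectiveˡ {diags} {ends}  z eq = contradiction (sym (cong proj₁ eq)) (Bool.not-¬ refl)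
act-injectiveˡ {diags} {sides} z eq = contradiction (sym (cong proj₂ eq)) (Bool.not-¬ refl)

≢⇒act : ∀ z z′ → z′ ≢ z → ∃[ p ] z′ ≡ act p z
≢⇒act z z′ z′≢z with act-cases {ends} {sides} (λ ()) z z′
... | inj₁ eq = contradiction eq z′≢z
... | inj₂ (inj₁ eq) = ends , eq
... | inj₂ (inj₂ (inj₁ eq)) = sides , eq
... | inj₂ (inj₂ (inj₂ eq)) = diags , eq

another : ∀ (p : Pairing) → ∃[ q ] q ≢ p
another ends  = sides , λ ()
another sides = ends , λ ()
another diags = ends , λ ()

fixfree-involution : ∀ ρ → Involutive ρ → Fixfree ρ → ∃[ p ] ∀ z → ρ z ≡ act p z
fixfree-involution ρ inv fix with ≢⇒act (false , false) (ρ (false , false)) (fix _)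
... | p , eq = p , λ z → by-case z (act-cases {q} {p} q≢p o z)
  where
  o : Bool × Bool
  o = false , false
  q : Pairing
  q = proj₁ (another p)
  ρpo : ρ (act p o) ≡ o
  ρpo = trans (cong ρ (sym eq)) (inv (false , false))
  q≢p : q ≢ p
  q≢p = proj₂ (another p)
  ρqo : ρ (act q o) ≡ act p (act q o)
  ρqo with act-cases {q} {p} q≢p o (ρ (act q o))
  ... | inj₁ e = contradiction (Involutive-injective {f = ρ} inv (trans e (sym ρpo)))
                   (λ e → q≢p (act-injectiveˡ {q} {p} o e))
  ... | inj₂ (inj₁ e) = contradiction e (fix _)
  ... | inj₂ (inj₂ (inj₁ e)) = contradiction (Involutive-injective {f = ρ} inv (trans e (sym eq)))
                   (act-fixfree q o)
  ... | inj₂ (inj₂ (inj₂ e)) = trans e (act-comm q p o)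
  by-case : ∀ z → z ≡ o ⊎ z ≡ act q o ⊎ z ≡ act p o ⊎ z ≡ act q (act p o) → ρ z ≡ act p z
  by-case _ (inj₁ refl) = eq
  by-case _ (inj₂ (inj₁ refl)) = ρqo
  by-case _ (inj₂ (inj₂ (inj₁ refl))) = trans ρpo (sym (act-involutive p o))
  by-case _ (inj₂ (inj₂ (inj₂ refl))) = begin
    ρ (act q (act p o))  ≡⟨ cong ρ (act-comm q p o) ⟩
    ρ (act p (act q o))  ≡⟨ cong ρ (sym ρqo) ⟩
    ρ (ρ (act q o))      ≡⟨ inv _ ⟩
    act q o              ≡⟨ act-involutive p _ ⟨
    act p (act p (act q o)) ≡⟨ cong (act p) (act-comm p q o) ⟩
    act p (act q (act p o)) ∎
    where open ≡-Reasoning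

-- Four points κ z are paired in the three possible ways, everything else stays.
-- Switching all other pairs off leaves c pairing the four points among themselves,
-- and the count is largest for the pairing that agrees with this one.

module Quad {X : Set} (_≟_ : DecidableEquality X) (xs : List X) (∈-xs : ∀ x → x ∈ xs)
  (c : X → X) (c-inv : Involutive c) (c-fix : Fixfree c)
  (κ : Bool × Bool → X) (κ-injective : ∀ {z z′} → κ z ≡ κ z′ → z ≡ z′)
  (m : Pairing → X → X) (m-inv : ∀ p → Involutive (m p)) (m-fix : ∀ p → Fixfree (m p))
  (m-κ : ∀ p z → m p (κ z) ≡ κ (act p z))
  (m-outer : ∀ p q y → (∀ z → y ≢ κ z) → m p y ≡ m q y)
  where

  open Switch _≟_

  Outer : X → Set
  Outer y = ∀ z → y ≢ κ z

  inner? : ∀ y → (∃[ z ] y ≡ κ z) ⊎ Outer y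
  inner? y with y ≟ κ (false , false) | y ≟ κ (false , true) | y ≟ κ (true , false) | y ≟ κ (true , true)
  ... | yes e | _ | _ | _ = inj₁ (_ , e)
  ... | no _ | yes e | _ | _ = inj₁ (_ , e)
  ... | no _ | no _ | yes e | _ = inj₁ (_ , e)
  ... | no _ | no _ | no _ | yes e = inj₁ (_ , e)
  ... | no p | no q | no r | no s = inj₂ λ
    { (false , false) → p ; (false , true) → q ; (true , false) → r ; (true , true) → s }

  record Reduced (ys : List X) : Set where
    field
      c*      : X → X
      c*-inv  : Involutive c*
      c*-fix  : Fixfree c*
      loops   : ∀ {y} → y ∈ ys → Outer y → ∀ p → c* y ≡ m p y
      δ       : ℕ
      classes : ∀ p {n} → Classes (Orbit c (m p)) n → Classes (Orbit c* (m p)) (δ ℕ.+ n)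
      forth   : ∀ p {z z′} → Orbit c (m p) (κ z) (κ z′) → Orbit c* (m p) (κ z) (κ z′)
      back    : ∀ p {z z′} → Orbit c* (m p) (κ z) (κ z′) → Orbit c (m p) (κ z) (κ z′)

  m-Outer : ∀ p {y} → Outer y → Outer (m p y)
  m-Outer p {y} out z eq = out (act p z) (trans (sym (m-inv p y)) (trans (cong (m p) eq) (m-κ p z)))

  abstract
    reduce : ∀ ys → Reduced ys
    reduce [] = record
      { c* = c ; c*-inv = c-inv ; c*-fix = c-fix ; loops = λ () ; δ = 0
      ; classes = λ _ → id ; forth = λ _ → id ; back = λ _ → id }
    reduce (y ∷ ys) with reduce ys | inner? y
    ... | R | inj₁ (z , eq) = record
      { Reduced R
      ; loops = λ { (here refl) out → contradiction eq (out z) ; (there k) → Reduced.loops R k } }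
    ... | R | inj₂ out with Reduced.c* R y ≟ m ends y
    ...   | yes eq = record
      { Reduced R
      ; loops = λ { (here refl) _ p → trans eq (m-outer ends p y out) ; (there k) → Reduced.loops R k } }
    ...   | no c*y≢b = record
      { c*      = switch c* y b
      ; c*-inv  = switch-involutive c* y b c*-inv c*-fix y≢b c*y≢b
      ; c*-fix  = switch-fixfree c* y b c*-inv c*-fix y≢b c*y≢b
      ; loops   = λ { (here refl) _ p → trans (switch-a c* y b) (m-outer ends p y out)
                    ; (there k) out′ p → loops′ k out′ p }
      ; δ       = suc δ
      ; classes = λ p C → switch-classes c* y b c*-inv c*-fix y≢b c*y≢b (m p) (m-inv p) (m-outer p ends y out)
                            (classes p C)
      ; forth   = λ p path → switch-outside c* y b c*-inv c*-fix y≢b c*y≢b (m p) (m-inv p) (m-outer p ends y out)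
                    (out _ ∘ sym) (b-out _ ∘ sym) (out _ ∘ sym) (b-out _ ∘ sym) (forth p path)
      ; back    = λ p path → back p (switch-refines c* y b c*-inv c*-fix y≢b c*y≢b (m p) (m-inv p)
                    (m-outer p ends y out) path)
      }
      where
      open Reduced R
      b : X
      b = m ends y
      b-out : Outer b
      b-out = m-Outer ends out
      y≢b : y ≢ b
      y≢b eq = m-fix ends y (sym eq)
      loops′ : ∀ {y′} → y′ ∈ ys → Outer y′ → ∀ p → switch c* y b y′ ≡ m p y′
      loops′ {y′} k out′ p = by-cases (y′ ≟ y) (y′ ≟ b)
        where
        by-cases : Dec (y′ ≡ y) → Dec (y′ ≡ b) → switch c* y b y′ ≡ m p y′
        by-cases (yes refl) _ = trans (switch-a c* y b) (m-outer ends p y out)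
        by-cases (no _) (yes refl) = trans (switch-b c* y b c*-inv c*-fix y≢b c*y≢b)
              (trans (sym (m-inv p y)) (cong (m p) (m-outer p ends y out)))
        by-cases (no y′≢y) (no y′≢b) = trans (switch-other c* y b y′≢y y′≢b
              (λ e → y′≢b (trans (sym (m-inv ends y′)) (cong (m ends)
                (trans (sym (loops k out′ ends)) (trans (cong c* e) (c*-inv y))))))
              (λ e → y′≢y (trans (sym (m-inv ends y′)) (trans (cong (m ends)
                (trans (sym (loops k out′ ends)) (trans (cong c* e) (c*-inv b)))) (m-inv ends y)))))
              (loops k out′ p)

  module _ {n : Pairing → ℕ} (C : ∀ p → Classes (Orbit c (m p)) (n p)) where

    open Reduced (reduce xs)

    c*-inner : ∀ z → ∃[ z′ ] c* (κ z) ≡ κ z′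
    c*-inner z with inner? (c* (κ z))
    ... | inj₁ r = r
    ... | inj₂ out = contradiction
            (trans (sym (m-inv ends _)) (trans (cong (m ends) (trans (sym (loops (∈-xs _) out ends)) (c*-inv (κ z)))) (m-κ ends z)))
            (out (act ends z))

    ρ : Bool × Bool → Bool × Bool
    ρ z = proj₁ (c*-inner z)

    c*-κ : ∀ z → c* (κ z) ≡ κ (ρ z)
    c*-κ z = proj₂ (c*-inner z)

    ρ-pairing : ∃[ π ] ∀ z → ρ z ≡ act π z
    ρ-pairing = fixfree-involution ρ
      (λ z → κ-injective (trans (sym (c*-κ (ρ z))) (trans (cong c* (sym (c*-κ z))) (c*-inv (κ z)))))
      (λ z eq → c*-fix (κ z) (trans (c*-κ z) (cong κ eq)))

    π : Pairing
    π = proj₁ ρ-pairing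

    c*-π : ∀ z → c* (κ z) ≡ κ (act π z)
    c*-π z = trans (c*-κ z) (cong κ (proj₂ ρ-pairing z))

    c*≗mπ : c* ≗ m π
    c*≗mπ y with inner? y
    ... | inj₁ (z , refl) = trans (c*-π z) (sym (m-κ π z))
    ... | inj₂ out = loops (∈-xs y) out π

    module _ {p} (p≢π : p ≢ π) where

      o a b : Bool × Bool
      o = false , false
      a = act π o
      b = act p o

      κo≢κa : κ o ≢ κ a
      κo≢κa eq = act-fixfree π o (sym (κ-injective eq))

      mo≢κa : m p (κ o) ≢ κ a
      mo≢κa eq = p≢π (act-injectiveˡ o (κ-injective (trans (sym (m-κ p o)) eq)))

      sw : X → X
      sw = switch (m p) (κ o) (κ a)

      sw≗mπ : sw ≗ m π
      sw≗mπ y with inner? y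
      ... | inj₂ out = trans (switch-other (m p) (κ o) (κ a) (out _) (out _)
                (λ e → out _ (trans e (m-κ p o))) (λ e → out _ (trans e (m-κ p a)))) (m-outer p π y out)
      ... | inj₁ (z , refl) with act-cases p≢π o z
      ...   | inj₁ refl = trans (switch-a (m p) (κ o) (κ a)) (sym (m-κ π o))
      ...   | inj₂ (inj₁ refl) = begin
        sw (κ b)        ≡⟨ cong sw (m-κ p o) ⟨
        sw (m p (κ o))  ≡⟨ switch-ca (m p) (κ o) (κ a) (m-inv p) (m-fix p) κo≢κa mo≢κa ⟩
        m p (κ a)       ≡⟨ m-κ p a ⟩
        κ (act p a)     ≡⟨ cong κ (act-comm p π o) ⟩
        κ (act π b)     ≡⟨ m-κ π b ⟨
        m π (κ b)       ∎
        where open ≡-Reasoning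
      ...   | inj₂ (inj₂ (inj₁ refl)) = trans
              (switch-b (m p) (κ o) (κ a) (m-inv p) (m-fix p) κo≢κa mo≢κa)
              (trans (cong κ (sym (act-involutive π o))) (sym (m-κ π a)))
      ...   | inj₂ (inj₂ (inj₂ refl)) = begin
        sw (κ (act p a))       ≡⟨ cong sw (m-κ p a) ⟨
        sw (m p (κ a))         ≡⟨ switch-cb (m p) (κ o) (κ a) (m-inv p) (m-fix p) κo≢κa mo≢κa ⟩
        m p (κ o)              ≡⟨ m-κ p o ⟩
        κ (act p o)            ≡⟨ cong (κ ∘ act p) (act-involutive π o) ⟨
        κ (act p (act π a))    ≡⟨ cong κ (act-comm p π a) ⟩
        κ (act π (act p a))    ≡⟨ m-κ π _ ⟨
        m π (κ (act p a))      ∎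
        where open ≡-Reasoning

      high-count : n π ≡ suc (n p)
      high-count = ℕ.+-cancelˡ-≡ δ _ _ (trans
        (Classes-unique (classes π (C π))
          (Classes-cong (Orbit-swap ∘ Orbit-cong (λ _ → refl) (sym ∘ sw≗mπ)) (Orbit-cong (λ _ → refl) sw≗mπ ∘ Orbit-swap)
            (switch-classes (m p) (κ o) (κ a) (m-inv p) (m-fix p) κo≢κa mo≢κa c* c*-inv (c*-π o)
              (Classes-cong Orbit-swap Orbit-swap (classes p (C p))))))
        (sym (ℕ.+-suc δ (n p))))

      low-connected : ∀ z z′ → Orbit c (m p) (κ z) (κ z′)
      low-connected z z′ = back p (connect (act-cases p≢π z z′))
        where
        by-p : ∀ z → Orbit c* (m p) (κ z) (κ (act p z))
        by-p z = subst (Orbit c* (m p) (κ z)) (m-κ p z) (stepʳ (κ z))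
        by-π : ∀ z → Orbit c* (m p) (κ z) (κ (act π z))
        by-π z = subst (Orbit c* (m p) (κ z)) (c*-π z) (stepˡ (κ z))
        connect : z′ ≡ z ⊎ z′ ≡ act p z ⊎ z′ ≡ act π z ⊎ z′ ≡ act p (act π z) → Orbit c* (m p) (κ z) (κ z′)
        connect (inj₁ refl) = ε
        connect (inj₂ (inj₁ refl)) = by-p z
        connect (inj₂ (inj₂ (inj₁ refl))) = by-π z
        connect (inj₂ (inj₂ (inj₂ refl))) = by-π z ◅◅ by-p (act π z)

    high-separated : ∀ z z′ → Orbit c (m π) (κ z) (κ z′) → z′ ≡ z ⊎ z′ ≡ act π z
    high-separated z z′ path = finish (fold T step (λ {y} → inj₁ refl) (forth π path))
      where
      T : X → X → Set
      T x y = y ≡ x ⊎ y ≡ m π x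
      step : ∀ {x y w} → y ≡ c* x ⊎ y ≡ m π x → T y w → T x w
      step s (inj₁ refl) = inj₂ (either s)
        where
        either : ∀ {x y} → y ≡ c* x ⊎ y ≡ m π x → y ≡ m π x
        either (inj₁ refl) = c*≗mπ _
        either (inj₂ eq)   = eq
      step (inj₁ refl) (inj₂ refl) = inj₁ (trans (cong (m π) (c*≗mπ _)) (m-inv π _))
      step (inj₂ refl) (inj₂ refl) = inj₁ (m-inv π _)
      finish : T (κ z) (κ z′) → z′ ≡ z ⊎ z′ ≡ act π z
      finish (inj₁ eq) = inj₁ (κ-injective eq)
      finish (inj₂ eq) = inj₂ (κ-injective (trans eq (m-κ π z)))

-- Boundary circles and partial duals

infixl 30 _[_≔_]

_[_≔_] : ∀ {m} {A : Set} → (Fin m → A) → Fin m → A → Fin m → A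
(σ [ i ≔ p ]) j with j Fin.≟ i
... | yes _ = p
... | no  _ = σ j

module _ {m : ℕ} {A : Set} where

  ≔-same : ∀ (σ : Fin m → A) i p → (σ [ i ≔ p ]) i ≡ p
  ≔-same σ i p with i Fin.≟ i
  ... | yes _ = refl
  ... | no  q = contradiction refl q

  ≔-other : ∀ (σ : Fin m → A) {i j} p → j ≢ i → (σ [ i ≔ p ]) j ≡ σ j
  ≔-other σ {i} {j} p q with j Fin.≟ i
  ... | yes r = contradiction r q
  ... | no  _ = refl

  ≔-cong : ∀ {σ τ : Fin m → A} i p → (∀ j → j ≢ i → σ j ≡ τ j) → σ [ i ≔ p ] ≗ τ [ i ≔ p ]
  ≔-cong i p eq j with j Fin.≟ i
  ... | yes _ = refl
  ... | no  q = eq j q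

  ≔-self : ∀ {σ : Fin m → A} {i p} → σ i ≡ p → σ [ i ≔ p ] ≗ σ
  ≔-self {i = i} eq j with j Fin.≟ i
  ... | yes refl = sym eq
  ... | no  _    = refl

  ≔-comm : ∀ (σ : Fin m → A) {i j} p q → i ≢ j → σ [ i ≔ p ] [ j ≔ q ] ≗ σ [ j ≔ q ] [ i ≔ p ]
  ≔-comm σ {i} {j} p q i≢j k with k Fin.≟ j | k Fin.≟ i
  ... | yes refl | yes refl = contradiction refl i≢j
  ... | yes refl | no r     = sym (≔-same σ k q)
  ... | no r     | yes refl = ≔-same σ k p
  ... | no r     | no s     = trans (≔-other σ p s) (sym (≔-other σ q r))

pairing : ∀ {m} → (Fin m → Pairing) → Flag m → Flag m
pairing σ (i , z) = i , act (σ i) z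

pairing-involutive : ∀ {m} (σ : Fin m → Pairing) → Involutive (pairing σ)
pairing-involutive σ (i , z) = cong (i ,_) (act-involutive (σ i) z)

pairing-fixfree : ∀ {m} (σ : Fin m → Pairing) → Fixfree (pairing σ)
pairing-fixfree σ (i , z) eq with act (σ i) z | act-fixfree (σ i) z | eq
... | _ | fix | refl = fix refl

pairing-cong : ∀ {m} {σ τ : Fin m → Pairing} → σ ≗ τ → pairing σ ≗ pairing τ
pairing-cong eq (i , z) = cong (λ p → i , act p z) (eq i)

module _ (G : RibbonGraph) where

  Circle : (Fin (e G) → Pairing) → Rel (FlagOf G) 0ℓ
  Circle σ = Orbit (corner G) (pairing σ)

  abstract
    #circles : (Fin (e G) → Pairing) → ℕ
    #circles σ = #orbits (corner G) (pairing σ)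

    circles : ∀ σ → Classes (Circle σ) (#circles σ)
    circles σ = #orbits-classes (corner-involutive G) (pairing-involutive σ)

  Circle-sym : ∀ σ {x y} → Circle σ x y → Circle σ y x
  Circle-sym σ = Orbit-sym (corner-involutive G) (pairing-involutive σ)

  Circle-cong : ∀ {σ τ} → σ ≗ τ → ∀ {x y} → Circle σ x y → Circle τ x y
  Circle-cong eq = Orbit-cong (λ _ → refl) (pairing-cong eq)

  #circles-cong : ∀ {σ τ} → σ ≗ τ → #circles σ ≡ #circles τ
  #circles-cong {σ} {τ} eq = Classes-unique
    (Classes-cong (Circle-cong (sym ∘ eq)) (Circle-cong eq) (circles σ)) (circles τ)

  #circles≥1 : Fin (e G) → ∀ σ → 1 ≤ #circles σ
  #circles≥1 i σ with #circles σ | class (circles σ) (i , false , false)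
  ... | suc _ | _ = s≤s z≤n

  module _ (σ : Fin (e G) → Pairing) (i : Fin (e G)) where

    private
      at-ribbon-injective : ∀ {z z′ : Bool × Bool} → (i , z) ≡ (i , z′) → z ≡ z′
      at-ribbon-injective refl = refl

      at-ribbon : ∀ p z → pairing (σ [ i ≔ p ]) (i , z) ≡ (i , act p z)
      at-ribbon p z = cong (λ q → i , act q z) (≔-same σ i p)

      away : ∀ p q y → (∀ z → y ≢ (i , z)) → pairing (σ [ i ≔ p ]) y ≡ pairing (σ [ i ≔ q ]) y
      away p q (j , z) out = cong (λ r → j , act r z) (trans (≔-other σ p j≢i) (sym (≔-other σ q j≢i)))
        where
        j≢i : j ≢ i
        j≢i refl = out z refl

      module Q = Quad _≟ᶠ_ (allFlags (e G)) ∈-allFlags (corner G) (corner-involutive G) (corner-fixfree G)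
        (i ,_) at-ribbon-injective (λ p → pairing (σ [ i ≔ p ]))
        (λ p → pairing-involutive (σ [ i ≔ p ])) (λ p → pairing-fixfree (σ [ i ≔ p ])) at-ribbon away

    abstract
      highest : Pairing
      highest = Q.π (λ p → circles (σ [ i ≔ p ]))

      highest-count : ∀ {p} → p ≢ highest → #circles (σ [ i ≔ highest ]) ≡ suc (#circles (σ [ i ≔ p ]))
      highest-count = Q.high-count (λ p → circles (σ [ i ≔ p ]))

      separated⇒highest : ∀ {p z z′} → ¬ Circle (σ [ i ≔ p ]) (i , z) (i , z′) → p ≡ highest
      separated⇒highest {p} {z} {z′} sep with p ≟ᵖ highest
      ... | yes eq = eq
      ... | no  p≢ = contradiction (Q.low-connected (λ p → circles (σ [ i ≔ p ])) p≢ z z′) sep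

      highest-separated : ∀ {p} → p ≡ highest → ∀ {z z′} → z′ ≢ z → z′ ≢ act p z →
        ¬ Circle (σ [ i ≔ p ]) (i , z) (i , z′)
      highest-separated refl {z} {z′} q r path with Q.high-separated (λ p → circles (σ [ i ≔ p ])) z z′ path
      ... | inj₁ eq = q eq
      ... | inj₂ eq = r eq

data Peak : ℕ → ℕ → ℕ → Set where
  atEnds  : ∀ {k} → Peak (suc k) k k
  atSides : ∀ {k} → Peak k (suc k) k
  atDiags : ∀ {k} → Peak k k (suc k)

peak : ∀ G σ i → Peak (#circles G (σ [ i ≔ ends ])) (#circles G (σ [ i ≔ sides ])) (#circles G (σ [ i ≔ diags ]))
peak G σ i with highest G σ i | (λ {p} → highest-count G σ i {p})
... | ends  | count = at₁ (count {sides} (λ ())) (count {diags} (λ ()))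
  where
  at₁ : ∀ {a b c} → a ≡ suc b → a ≡ suc c → Peak a b c
  at₁ refl refl = atEnds
... | sides | count = at₂ (count {ends} (λ ())) (count {diags} (λ ()))
  where
  at₂ : ∀ {a b c} → b ≡ suc a → b ≡ suc c → Peak a b c
  at₂ refl refl = atSides
... | diags | count = at₃ (count {ends} (λ ())) (count {sides} (λ ()))
  where
  at₃ : ∀ {a b c} → c ≡ suc a → c ≡ suc b → Peak a b c
  at₃ refl refl = atDiags

ribbons : ∀ {m} → (Fin m → Bool) → Fin m → Pairing
ribbons β i = if β i then sides else ends

ribbons-cong : ∀ {m} {β γ : Fin m → Bool} → β ≗ γ → ribbons β ≗ ribbons γ
ribbons-cong eq i = cong (if_then sides else ends) (eq i)

Constant : RibbonGraph → ℕ → Set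
Constant G C = ∀ β → #circles G (ribbons β) ℕ.+ #circles G (ribbons (not ∘ β)) ≡ C

module _ (G : RibbonGraph) (A : Subset (e G)) where

  #turned : ∀ {g : FlagOf G → FlagOf G} {σ} → Involutive g → (∀ x → turn A (g (turn A x)) ≡ pairing σ x) →
    #orbits (corner (G ^ᵖ A)) g ≡ #circles G σ
  #turned {g} {σ} g-inv eq = Classes-unique (#orbits-classes (corner-involutive (G ^ᵖ A)) g-inv)
    (Classes-transport (turn A) (turn A) (λ x → ≡⇒Orbit (turn-involutive A x)) to from (circles G σ))
    where
    step : ∀ {x} → turn A (turn A x) ≡ x
    step = turn-involutive A _
    to : ∀ {y y′} → Orbit (corner (G ^ᵖ A)) g y y′ → Circle G σ (turn A y) (turn A y′)
    to = gmap (turn A) λ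
      { (inj₁ refl) → inj₁ step
      ; {x} (inj₂ refl) → inj₂ (trans (cong (turn A ∘ g) (sym step)) (eq (turn A x))) }
    from : ∀ {y y′} → Circle G σ (turn A y) (turn A y′) → Orbit (corner (G ^ᵖ A)) g y y′
    from {y} {y′} path = subst₂ (Orbit (corner (G ^ᵖ A)) g) step step (gmap (turn A) (λ
      { {x} (inj₁ refl) → inj₁ (cong (turn A ∘ corner G) (sym step))
      ; {x} (inj₂ refl) → inj₂ (trans (cong (turn A) (sym (eq x))) step) }) path)

  v-dual : v (G ^ᵖ A) ≡ #circles G (ribbons (lookup A))
  v-dual = #turned (λ { (i , s , t) → cong (λ b → i , s , b) (Bool.not-involutive t) }) ends↦
    where
    ends↦ : ∀ x → turn A (across (turn A x)) ≡ pairing (ribbons (lookup A)) x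
    ends↦ (i , s , t) with lookup A i in eq
    ... | true  rewrite eq = refl
    ... | false rewrite eq = refl

  f-dual : f (G ^ᵖ A) ≡ #circles G (ribbons (not ∘ lookup A))
  f-dual = #turned (λ { (i , s , t) → cong (λ b → i , b , t) (Bool.not-involutive s) }) sides↦
    where
    sides↦ : ∀ x → turn A (along (turn A x)) ≡ pairing (ribbons (not ∘ lookup A)) x
    sides↦ (i , s , t) with lookup A i in eq
    ... | true  rewrite eq = refl
    ... | false rewrite eq = refl

∈-allSubsets : ∀ {m} (A : Subset m) → A ∈ allSubsets m
∈-allSubsets []          = here refl
∈-allSubsets (false ∷ A) = ∈-++⁺ˡ (∈-map⁺ (outside ∷_) (∈-allSubsets A))
∈-allSubsets (true ∷ A)  = ∈-++⁺ʳ _ (∈-map⁺ (inside ∷_) (∈-allSubsets A))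

length-allSubsets : ∀ m → length (allSubsets m) ≡ 2 ^ m
length-allSubsets zero    = refl
length-allSubsets (suc m) = begin
  length (List.map (outside ∷_) (allSubsets m) List.++ List.map (inside ∷_) (allSubsets m))
    ≡⟨ List.length-++ (List.map (outside ∷_) (allSubsets m)) ⟩
  length (List.map (outside ∷_) (allSubsets m)) ℕ.+ length (List.map (inside ∷_) (allSubsets m))
    ≡⟨ cong₂ ℕ._+_ (List.length-map _ (allSubsets m)) (List.length-map _ (allSubsets m)) ⟩
  length (allSubsets m) ℕ.+ length (allSubsets m)
    ≡⟨ cong₂ ℕ._+_ (length-allSubsets m) (length-allSubsets m) ⟩
  2 ^ m ℕ.+ 2 ^ m
    ≡⟨ cong (2 ^ m ℕ.+_) (ℕ.+-identityʳ (2 ^ m)) ⟨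
  2 ^ suc m ∎
  where open ≡-Reasoning

z^-self : ∀ i → (z^ i) i ≡ 1
z^-self i with i ℤ.≟ i
... | yes _ = refl
... | no  p = contradiction refl p

module _ {X : Set} (g : X → ℤ) where

  powers : List X → Poly
  powers xs = sumPoly (List.map (λ x → z^ g x) xs)

  powers-constant : ∀ {b} xs → (∀ x → g x ≡ b) → powers xs ≗ length xs · z^ b
  powers-constant []       eq j = refl
  powers-constant (x ∷ xs) eq j = cong₂ ℕ._+_ (cong (λ i → (z^ i) j) (eq x)) (powers-constant xs eq j)

  powers-≤ : ∀ b xs → powers xs b ≤ length xs
  powers-≤ b []       = z≤n
  powers-≤ b (x ∷ xs) with g x ℤ.≟ b
  ... | yes _ = s≤s (powers-≤ b xs)
  ... | no  _ = ℕ.m≤n⇒m≤1+n (powers-≤ b xs)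

  powers-full : ∀ b xs → powers xs b ≡ length xs → ∀ {x} → x ∈ xs → g x ≡ b
  powers-full b (x ∷ xs) eq k with g x ℤ.≟ b
  powers-full b (x ∷ xs) eq (here refl) | yes p = p
  powers-full b (x ∷ xs) eq (there k)   | yes _ = powers-full b xs (ℕ.suc-injective eq) k
  powers-full b (x ∷ xs) eq k           | no  _ =
    contradiction (subst (_≤ length xs) eq (powers-≤ b xs)) ℕ.1+n≰n

module _ (G : RibbonGraph) (b : ℤ) where

  monomial⇒genus : ∂ε G ≗ 2 ^ e G · z^ b → ∀ A → eulerGenus (G ^ᵖ A) ≡ b
  monomial⇒genus eq A = powers-full (λ A → eulerGenus (G ^ᵖ A)) b (allSubsets (e G)) (begin
    ∂ε G b                     ≡⟨ eq b ⟩
    2 ^ e G ℕ.* (z^ b) b       ≡⟨ cong (2 ^ e G ℕ.*_) (z^-self b) ⟩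
    2 ^ e G ℕ.* 1              ≡⟨ ℕ.*-identityʳ _ ⟩
    2 ^ e G                    ≡⟨ length-allSubsets (e G) ⟨
    length (allSubsets (e G))  ∎) (∈-allSubsets A)
    where open ≡-Reasoning

  genus⇒monomial : (∀ A → eulerGenus (G ^ᵖ A) ≡ b) → ∂ε G ≗ 2 ^ e G · z^ b
  genus⇒monomial eq j = trans (powers-constant (λ A → eulerGenus (G ^ᵖ A)) (allSubsets (e G)) eq j)
    (cong (ℕ._* (z^ b) j) (length-allSubsets (e G)))

module _ (n k c b : ℕ) where

  private
    balance : ∀ i j l → + 2 - (i - j + l) + (i + l) ≡ + 2 + j
    balance = ℤ.solve-∀

    genus-balance : + 2 - (+ n - + k + + c) + + (n ℕ.+ c) ≡ + (2 ℕ.+ k)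
    genus-balance = balance (+ n) (+ k) (+ c)

  genus⇒count : + 2 - (+ n - + k + + c) ≡ + b → n ℕ.+ c ℕ.+ b ≡ 2 ℕ.+ k
  genus⇒count eq = ℤ.+-injective (trans (ℤ.+-comm (+ (n ℕ.+ c)) (+ b))
    (trans (cong (_+ + (n ℕ.+ c)) (sym eq)) genus-balance))

  count⇒genus : n ℕ.+ c ℕ.+ b ≡ 2 ℕ.+ k → + 2 - (+ n - + k + + c) ≡ + b
  count⇒genus eq = ∙-cancelʳ (+ (n ℕ.+ c)) _ _
    (trans genus-balance (trans (cong +_ (sym eq)) (ℤ.+-comm (+ (n ℕ.+ c)) (+ b))))

module _ (G : RibbonGraph) where

  genus-dual : ∀ A → eulerGenus (G ^ᵖ A) ≡
    + 2 - (+ #circles G (ribbons (lookup A)) - + e G + + #circles G (ribbons (not ∘ lookup A)))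
  genus-dual A = cong₂ (λ m n → + 2 - (+ m - + e G + + n)) (v-dual G A) (f-dual G A)

  monomial⇒constant : ∀ b → ∂ε G ≗ 2 ^ e G · z^ (+ b) → ∃[ C ] C ℕ.+ b ≡ 2 ℕ.+ e G × Constant G C
  monomial⇒constant b eq = 2 ℕ.+ e G ℕ.∸ b , ℕ.m∸n+n≡m b≤ , λ β → trans (sym (ℕ.m+n∸n≡m _ b)) (cong (ℕ._∸ b) (count β))
    where
    count : ∀ β → #circles G (ribbons β) ℕ.+ #circles G (ribbons (not ∘ β)) ℕ.+ b ≡ 2 ℕ.+ e G
    count β = trans
      (cong₂ (λ m n → m ℕ.+ n ℕ.+ b)
        (#circles-cong G (ribbons-cong (sym ∘ lookup∘tabulate β)))
        (#circles-cong G (ribbons-cong (cong not ∘ sym ∘ lookup∘tabulate β))))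
      (genus⇒count _ _ _ b (trans (sym (genus-dual (tabulate β))) (monomial⇒genus G (+ b) eq (tabulate β))))
    b≤ : b ≤ 2 ℕ.+ e G
    b≤ = subst (b ≤_) (count (λ _ → false)) (ℕ.m≤n+m b _)

  constant⇒monomial : ∀ {C} b → C ℕ.+ b ≡ 2 ℕ.+ e G → Constant G C → ∂ε G ≗ 2 ^ e G · z^ (+ b)
  constant⇒monomial b eq const = genus⇒monomial G (+ b) λ A →
    trans (genus-dual A) (count⇒genus _ _ _ b (trans (cong (ℕ._+ b) (const (lookup A))) eq))

-- Crossing ribbons

-- n is meant as the count as a function of the pairings at two or, in Cube below, three ribbons.

record Square (n : Pairing → Pairing → ℕ) : Set where
  field
    peak₁ : ∀ q → Peak (n ends q) (n sides q) (n diags q)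
    peak₂ : ∀ p → Peak (n p ends) (n p sides) (n p diags)

open Square

no-square₁ : ∀ {ee es ed se ss sd de ds dd} → Peak ee se de → Peak es ss ds → Peak ee es ed → Peak se ss sd →
  Peak de ds dd → se ≡ suc ee → es ≡ suc ee → ss ≡ suc ee → ⊥
no-square₁ atSides atDiags atSides atDiags () refl refl refl

no-square₂ : ∀ {ee es se ss de ds dd} → Peak ee se de → Peak es ss ds → Peak de ds dd →
  ee ≡ suc es → se ≡ ee → ss ≡ ee → ⊥
no-square₂ atDiags atSides () refl refl refl

peak-second : ∀ {a b c} → Peak a b c → a ≡ 1 → 1 ≤ b → b ≡ 1 ⊎ b ≡ 2
peak-second atEnds  refl ()
peak-second atSides refl _ = inj₂ refl
peak-second atDiags refl _ = inj₁ refl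

peak-forces : ∀ {a b c} → Peak a b c → a ≡ 1 → c ≡ 2 → b ≡ 1
peak-forces atDiags refl refl = refl

peak-forces₂ : ∀ {a b c} → Peak a b c → a ≡ 2 → c ≡ 1 → b ≡ 1
peak-forces₂ atEnds refl refl = refl

peak-forces₃ : ∀ {a b c} → Peak a b c → a ≡ 1 → c ≡ 1 → b ≡ 2
peak-forces₃ atSides refl refl = refl

-- The pairing π at the first ribbon splits the single circle, and the second ribbon joins
-- the two parts.

record Linked (n : Pairing → Pairing → ℕ) (π : Pairing) : Set where
  field
    single : n ends ends ≡ 1
    split  : n π ends ≡ 2
    sides₁ : n π sides ≡ 1
    diags₁ : n π diags ≡ 1

private
  level : ∀ {a b x y c} → a ℕ.+ x ≡ c → b ℕ.+ y ≡ c → a ≡ b → y ≡ x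
  level {a} p q refl = ℕ.+-cancelˡ-≡ a _ _ (trans q (sym p))

  rise : ∀ {a b x y c} → a ℕ.+ x ≡ c → b ℕ.+ y ≡ c → a ≡ suc b → y ≡ suc x
  rise {b = b} {x} {y} p q refl = ℕ.+-cancelˡ-≡ b _ _ (trans q (trans (sym p) (sym (ℕ.+-suc b x))))

-- n′ is meant as n with all other ribbons complemented.

linked-untwisted : ∀ {n n′ : Pairing → Pairing → ℕ} {π C} → Square n → Square n′ → (∀ p q → 1 ≤ n p q) →
  n sides sides ℕ.+ n′ ends ends ≡ C → n sides ends ℕ.+ n′ ends sides ≡ C →
  n ends sides ℕ.+ n′ sides ends ≡ C → n ends ends ℕ.+ n′ sides sides ≡ C →
  Linked n π → π ≡ sides × n ends sides ≡ 2
linked-untwisted {π = ends} S S′ pos c₁ c₂ c₃ c₄ L =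
  contradiction (trans (sym (Linked.single L)) (Linked.split L)) λ ()
linked-untwisted {n} {π = sides} S S′ pos c₁ c₂ c₃ c₄ L with peak-second (peak₂ S ends) (Linked.single L) (pos ends sides)
... | inj₂ es≡2 = refl , es≡2
... | inj₁ es≡1 = ⊥-elim (no-square₂ (peak₁ S′ ends) (peak₁ S′ sides) (peak₂ S′ diags)
        (rise c₂ c₁ (trans (Linked.split L) (cong suc (sym (Linked.sides₁ L)))))
        (level c₁ c₃ (trans (Linked.sides₁ L) (sym es≡1)))
        (level c₁ c₄ (trans (Linked.sides₁ L) (sym (Linked.single L)))))
linked-untwisted {n} {π = diags} S S′ pos c₁ c₂ c₃ c₄ L with peak-second (peak₂ S ends) (Linked.single L) (pos ends sides)
... | inj₂ es≡2 = ⊥-elim (no-square₂ (peak₂ S′ ends) (peak₂ S′ sides) (peak₁ S′ diags)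
        (rise c₃ c₁ (trans es≡2 (cong suc (sym ss≡1)))) (level c₁ c₂ (trans ss≡1 (sym se≡1)))
        (level c₁ c₄ (trans ss≡1 (sym (Linked.single L)))))
  where
  se≡1 : n sides ends ≡ 1
  se≡1 = peak-forces (peak₁ S ends) (Linked.single L) (Linked.split L)
  ss≡1 : n sides sides ≡ 1
  ss≡1 = peak-forces₂ (peak₁ S sides) es≡2 (Linked.sides₁ L)
... | inj₁ es≡1 = ⊥-elim (no-square₁ (peak₁ S′ ends) (peak₁ S′ sides) (peak₂ S′ ends) (peak₂ S′ sides) (peak₂ S′ diags)
        (rise c₁ c₃ (trans ss≡2 (cong suc (sym es≡1)))) (rise c₁ c₂ (trans ss≡2 (cong suc (sym se≡1))))
        (rise c₁ c₄ (trans ss≡2 (cong suc (sym (Linked.single L))))))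
  where
  se≡1 : n sides ends ≡ 1
  se≡1 = peak-forces (peak₁ S ends) (Linked.single L) (Linked.split L)
  ss≡2 : n sides sides ≡ 2
  ss≡2 = peak-forces₃ (peak₁ S sides) es≡1 (Linked.sides₁ L)

linked-swap : ∀ {n : Pairing → Pairing → ℕ} → Square n → Linked n sides → n ends sides ≡ 2 →
  Linked (λ p q → n q p) sides
linked-swap S L es≡2 = record
  { single = Linked.single L ; split = es≡2 ; sides₁ = Linked.sides₁ L
  ; diags₁ = peak-third (peak₁ S sides) es≡2 (Linked.sides₁ L) }
  where
  peak-third : ∀ {a b c} → Peak a b c → a ≡ 2 → b ≡ 1 → c ≡ 1
  peak-third atEnds refl refl = refl

record Cube (n : Pairing → Pairing → Pairing → ℕ) : Set where
  field
    face₁₂ : ∀ r → Square (λ p q → n p q r)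
    face₁₃ : ∀ q → Square (λ p r → n p q r)
    face₂₃ : ∀ p → Square (λ q r → n p q r)

open Cube

no-cube : ∀ {eee see dee ese sse dse ees ses des ess sss dss ded dsd ddd : ℕ} →
  Peak eee see dee → Peak ees ses des → Peak dee des ded →
  Peak ese sse dse → Peak ess sss dss → Peak dse dss dsd → Peak ded dsd ddd →
  eee ≡ suc ese → see ≡ suc eee → ees ≡ suc eee → sse ≡ eee → ess ≡ eee → ses ≡ eee → sss ≡ suc eee → ⊥
no-cube atSides atEnds atDiags atSides atSides atSides () refl refl refl refl refl refl refl

linked-transitive : ∀ {n n′ : Pairing → Pairing → Pairing → ℕ} {C} → Cube n → Cube n′ →
  n sides sides sides ℕ.+ n′ ends ends ends ≡ C → n ends sides sides ℕ.+ n′ sides ends ends ≡ C →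
  n sides ends sides ℕ.+ n′ ends sides ends ≡ C → n sides sides ends ℕ.+ n′ ends ends sides ≡ C →
  n ends ends sides ℕ.+ n′ sides sides ends ≡ C → n sides ends ends ℕ.+ n′ ends sides sides ≡ C →
  n ends sides ends ℕ.+ n′ sides ends sides ≡ C → n ends ends ends ℕ.+ n′ sides sides sides ≡ C →
  Linked (λ p q → n p q ends) sides → n ends sides ends ≡ 2 → n ends sides sides ≡ 1 → n ends ends sides ≡ 2 →
  Linked (λ p r → n p ends r) sides
linked-transitive {n} {n′} N N′ c₀ c₁ c₂ c₃ c₁₂ c₂₃ c₁₃ c₁₂₃ L ese ess ees = record
  { single = Linked.single L ; split = Linked.split L ; sides₁ = proj₁ ses×sed ; diags₁ = proj₂ ses×sed }
  where
  eed : n ends ends diags ≡ 1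
  eed = third (peak₂ (face₂₃ N ends) ends) (Linked.single L) ees
    where
    third : ∀ {a b c} → Peak a b c → a ≡ 1 → b ≡ 2 → c ≡ 1
    third atSides refl refl = refl
  alternatives : ∀ {a b c x z} → Peak a b c → a ≡ 2 → Peak x c z → x ≡ 1 → (b ≡ 1 × c ≡ 1) ⊎ b ≡ 3
  alternatives atEnds  refl _ _ = inj₁ (refl , refl)
  alternatives atSides refl _ _ = inj₂ refl
  alternatives atDiags refl () refl
  between : ∀ {a b c x z} → Peak a b c → a ≡ 1 → Peak x b z → x ≡ 3 → b ≡ 2
  between atEnds  refl () refl
  between atSides refl _  _    = refl
  between atDiags refl () refl
  ses×sed : n sides ends sides ≡ 1 × n sides ends diags ≡ 1
  ses×sed with alternatives (peak₂ (face₂₃ N sides) ends) (Linked.split L) (peak₁ (face₁₂ N diags) ends) eed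
  ... | inj₁ r = r
  ... | inj₂ ses≡3 = ⊥-elim (no-cube
          (peak₁ (face₁₂ N′ ends) ends) (peak₁ (face₁₂ N′ sides) ends) (peak₂ (face₁₃ N′ ends) diags)
          (peak₁ (face₁₂ N′ ends) sides) (peak₁ (face₁₂ N′ sides) sides) (peak₂ (face₁₃ N′ sides) diags)
          (peak₂ (face₁₂ N′ diags) diags)
          (rise c₂ c₀ (trans ses≡3 (cong suc (sym sss≡2))))
          (rise c₀ c₁ (trans sss≡2 (cong suc (sym ess))))
          (rise c₀ c₃ (trans sss≡2 (cong suc (sym (Linked.sides₁ L)))))
          (level c₀ c₁₂ (trans sss≡2 (sym ees))) (level c₀ c₂₃ (trans sss≡2 (sym (Linked.split L))))
          (level c₀ c₁₃ (trans sss≡2 (sym ese)))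
          (rise c₀ c₁₂₃ (trans sss≡2 (cong suc (sym (Linked.single L))))))
    where
    sss≡2 : n sides sides sides ≡ 2
    sss≡2 = between (peak₁ (face₁₂ N sides) sides) ess (peak₂ (face₁₂ N sides) sides) ses≡3

Peak-cong : ∀ {a b c a′ b′ c′} → a ≡ a′ → b ≡ b′ → c ≡ c′ → Peak a b c → Peak a′ b′ c′
Peak-cong refl refl refl P = P

Square-cong : ∀ {n n′} → (∀ p q → n p q ≡ n′ p q) → Square n → Square n′
Square-cong eq S = record
  { peak₁ = λ q → Peak-cong (eq ends q) (eq sides q) (eq diags q) (peak₁ S q)
  ; peak₂ = λ p → Peak-cong (eq p ends) (eq p sides) (eq p diags) (peak₂ S p) }

off on : ∀ {m} → Fin m → Pairing
off _ = ends
on  _ = sides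

module _ (G : RibbonGraph) where

  count₂ : (Fin (e G) → Pairing) → (i j : Fin (e G)) → Pairing → Pairing → ℕ
  count₂ σ i j p q = #circles G (σ [ i ≔ p ] [ j ≔ q ])

  count₃ : (Fin (e G) → Pairing) → (i j k : Fin (e G)) → Pairing → Pairing → Pairing → ℕ
  count₃ σ i j k p q r = #circles G (σ [ i ≔ p ] [ j ≔ q ] [ k ≔ r ])

  count₂-swap : ∀ σ {i j} → i ≢ j → ∀ p q → count₂ σ i j p q ≡ count₂ σ j i q p
  count₂-swap σ i≢j p q = #circles-cong G (≔-comm σ p q i≢j)

  square : ∀ σ {i j} → i ≢ j → Square (count₂ σ i j)
  square σ {i} {j} i≢j = record
    { peak₁ = λ q → Peak-cong (swap ends q) (swap sides q) (swap diags q) (peak G (σ [ j ≔ q ]) i)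
    ; peak₂ = λ p → peak G (σ [ i ≔ p ]) j }
    where
    swap : ∀ p q → count₂ σ j i q p ≡ count₂ σ i j p q
    swap p q = sym (count₂-swap σ i≢j p q)

  cube : ∀ σ {i j k} → i ≢ j → i ≢ k → j ≢ k → Cube (count₃ σ i j k)
  cube σ {i} {j} {k} i≢j i≢k j≢k = record
    { face₁₂ = λ r → Square-cong (λ p q → #circles-cong G (λ l → trans
        (≔-cong j q (λ l _ → ≔-comm σ r p (i≢k ∘ sym) l) l) (≔-comm (σ [ i ≔ p ]) r q (j≢k ∘ sym) l)))
        (square (σ [ k ≔ r ]) i≢j)
    ; face₁₃ = λ q → Square-cong (λ p r → #circles-cong G (≔-cong k r (λ l _ → ≔-comm σ q p (i≢j ∘ sym) l)))
        (square (σ [ j ≔ q ]) i≢k)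
    ; face₂₃ = λ p → square (σ [ i ≔ p ]) j≢k }

  Crossing : Rel (Fin (e G)) 0ℓ
  Crossing i j = Linked (count₂ off i j) sides

  Crossing? : ∀ i j → Dec (Crossing i j)
  Crossing? i j with count₂ off i j ends ends ℕ.≟ 1 | count₂ off i j sides ends ℕ.≟ 2
                   | count₂ off i j sides sides ℕ.≟ 1 | count₂ off i j sides diags ℕ.≟ 1
  ... | yes p | yes q | yes r | yes s = yes record { single = p ; split = q ; sides₁ = r ; diags₁ = s }
  ... | no p  | _     | _     | _     = no λ L → p (Linked.single L)
  ... | yes _ | no q  | _     | _     = no λ L → q (Linked.split L)
  ... | yes _ | yes _ | no r  | _     = no λ L → r (Linked.sides₁ L)
  ... | yes _ | yes _ | yes _ | no s  = no λ L → s (Linked.diags₁ L)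

  count₂-first : ∀ {i j} → i ≢ j → ∀ p → count₂ off i j p ends ≡ #circles G (off [ i ≔ p ])
  count₂-first i≢j p = #circles-cong G (≔-self (≔-other off p (i≢j ∘ sym)))

Complementary : ∀ {m} → (σ τ : Fin m → Pairing) → Set
Complementary σ τ = ∃[ β ] σ ≗ ribbons β × τ ≗ ribbons (not ∘ β)

complementary-off-on : ∀ {m} → Complementary {m} off on
complementary-off-on = (λ _ → false) , (λ _ → refl) , (λ _ → refl)

complementary-≔ : ∀ {m} {σ τ : Fin m → Pairing} i b → Complementary σ τ →
  Complementary (σ [ i ≔ if b then sides else ends ]) (τ [ i ≔ if not b then sides else ends ])
complementary-≔ {σ = σ} {τ} i b (β , p , q) = β [ i ≔ b ] , onˡ , onʳ
  where
  onˡ : σ [ i ≔ if b then sides else ends ] ≗ ribbons (β [ i ≔ b ])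
  onˡ j with j Fin.≟ i
  ... | yes _ = refl
  ... | no  _ = p j
  onʳ : τ [ i ≔ if not b then sides else ends ] ≗ ribbons (not ∘ (β [ i ≔ b ]))
  onʳ j with j Fin.≟ i
  ... | yes _ = refl
  ... | no  _ = q j

module _ {G : RibbonGraph} {C} (const : Constant G C) where

  complementary-count : ∀ {σ τ} → Complementary σ τ → #circles G σ ℕ.+ #circles G τ ≡ C
  complementary-count (β , p , q) = trans (cong₂ ℕ._+_ (#circles-cong G p) (#circles-cong G q)) (const β)

  module _ {i j : Fin (e G)} (i≢j : i ≢ j) where

    constant₂ : ∀ b b′ → count₂ G off i j (if b then sides else ends) (if b′ then sides else ends) ℕ.+
      count₂ G on i j (if not b then sides else ends) (if not b′ then sides else ends) ≡ C
    constant₂ b b′ = complementary-count (complementary-≔ j b′ (complementary-≔ i b complementary-off-on))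

    linked⇒untwisted : ∀ {π} → Linked (count₂ G off i j) π → π ≡ sides × count₂ G off i j ends sides ≡ 2
    linked⇒untwisted = linked-untwisted (square G off i≢j) (square G on i≢j) (λ p q → #circles≥1 G i _)
      (constant₂ true true) (constant₂ true false) (constant₂ false true) (constant₂ false false)

    linked⇒crossing : ∀ {π} → Linked (count₂ G off i j) π → Crossing G i j
    linked⇒crossing L with linked⇒untwisted L
    ... | refl , _ = L

    crossing-sym : Crossing G i j → Crossing G j i
    crossing-sym L = record
      { single = trans (swap ends ends) (Linked.single L′) ; split = trans (swap sides ends) (Linked.split L′)
      ; sides₁ = trans (swap sides sides) (Linked.sides₁ L′) ; diags₁ = trans (swap sides diags) (Linked.diags₁ L′) }
      where
      L′ : Linked (λ p q → count₂ G off i j q p) sides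
      L′ = linked-swap (square G off i≢j) L (proj₂ (linked⇒untwisted L))
      swap : ∀ p q → count₂ G off j i p q ≡ count₂ G off i j q p
      swap p q = sym (count₂-swap G off i≢j q p)

    crossing⇒untwisted : Crossing G i j → #circles G (off [ i ≔ sides ]) ≡ 2
    crossing⇒untwisted L = trans (sym (count₂-first G i≢j sides)) (Linked.split L)

  crossing-transitive : ∀ {i j k} → i ≢ j → j ≢ k → i ≢ k → Crossing G i j → Crossing G j k → Crossing G i k
  crossing-transitive {i} {j} {k} i≢j j≢k i≢k L M = record
    { single = trans (drop ends ends) (Linked.single K) ; split = trans (drop sides ends) (Linked.split K)
    ; sides₁ = trans (drop sides sides) (Linked.sides₁ K) ; diags₁ = trans (drop sides diags) (Linked.diags₁ K) }
    where
    constant₃ : ∀ b b′ b″ → count₃ G off i j k (if b then sides else ends) (if b′ then sides else ends) (if b″ then sides else ends)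
      ℕ.+ count₃ G on i j k (if not b then sides else ends) (if not b′ then sides else ends) (if not b″ then sides else ends) ≡ C
    constant₃ b b′ b″ = complementary-count
      (complementary-≔ k b″ (complementary-≔ j b′ (complementary-≔ i b complementary-off-on)))
    drop : ∀ p r → count₂ G off i k p r ≡ count₃ G off i j k p ends r
    drop p r = #circles-cong G (≔-cong k r (λ l _ → sym (≔-self (≔-other off p (i≢j ∘ sym)) l)))
    keep₁₂ : ∀ p q → count₃ G off i j k p q ends ≡ count₂ G off i j p q
    keep₁₂ p q = #circles-cong G (≔-self (trans (≔-other (off [ i ≔ p ]) q (j≢k ∘ sym)) (≔-other off p (i≢k ∘ sym))))
    keep₂₃ : ∀ q r → count₃ G off i j k ends q r ≡ count₂ G off j k q r
    keep₂₃ q r = #circles-cong G (≔-cong k r (λ l _ → ≔-cong j q (λ l _ → ≔-self refl l) l))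
    L₃ : Linked (λ p q → count₃ G off i j k p q ends) sides
    L₃ = record
      { single = trans (keep₁₂ ends ends) (Linked.single L) ; split = trans (keep₁₂ sides ends) (Linked.split L)
      ; sides₁ = trans (keep₁₂ sides sides) (Linked.sides₁ L) ; diags₁ = trans (keep₁₂ sides diags) (Linked.diags₁ L) }
    K : Linked (λ p r → count₃ G off i j k p ends r) sides
    K = linked-transitive (cube G off i≢j i≢k j≢k) (cube G on i≢j i≢k j≢k)
      (constant₃ true true true) (constant₃ false true true) (constant₃ true false true) (constant₃ true true false)
      (constant₃ false false true) (constant₃ true false false) (constant₃ false true false) (constant₃ false false false)
      L₃ (trans (keep₁₂ ends sides) (proj₂ (linked⇒untwisted i≢j L)))
      (trans (keep₂₃ sides sides) (Linked.sides₁ M)) (trans (keep₂₃ ends sides) (proj₂ (linked⇒untwisted j≢k M)))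

-- Ribbon-joins and their factors

module _ {G H : RibbonGraph} (φ : G ≅ H) where

  open _≅_ φ
  open Inverse flags using (to; from; strictlyInverseˡ; strictlyInverseʳ)

  ≅-sym : H ≅ G
  ≅-sym = record
    { flags           = ↔-sym flags
    ; corner-commutes = back {corner G} {corner H} corner-commutes
    ; along-commutes  = back {along} {along} along-commutes
    ; across-commutes = back {across} {across} across-commutes
    }
    where
    back : ∀ {g : FlagOf G → FlagOf G} {h : FlagOf H → FlagOf H} → (∀ x → to (g x) ≡ h (to x)) → ∀ y → from (h y) ≡ g (from y)
    back {g} {h} comm y = trans (cong (from ∘ h) (sym (strictlyInverseˡ y)))
      (trans (cong from (sym (comm (from y)))) (strictlyInverseʳ (g (from y))))

  edge : Fin (e G) → Fin (e H)
  edge i = proj₁ (to (i , false , false))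

  edge-to : ∀ i z → proj₁ (to (i , z)) ≡ edge i
  edge-to i (false , false) = refl
  edge-to i (true  , false) = cong proj₁ (along-commutes (i , false , false))
  edge-to i (false , true)  = cong proj₁ (across-commutes (i , false , false))
  edge-to i (true  , true)  = trans (cong proj₁ (across-commutes (i , true , false))) (edge-to i (true , false))

  pairing-commutes : ∀ σ x → to (pairing (σ ∘ edge) x) ≡ pairing σ (to x)
  pairing-commutes σ x@(i , z) with σ (edge i) in eq
  ... | ends  = trans (across-commutes x) (cong (λ p → proj₁ (to x) , act p (proj₂ (to x))) (sym (trans (cong σ (edge-to i z)) eq)))
  ... | sides = trans (along-commutes x) (cong (λ p → proj₁ (to x) , act p (proj₂ (to x))) (sym (trans (cong σ (edge-to i z)) eq)))
  ... | diags = trans (along-commutes (across x)) (trans (cong along (across-commutes x))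
                  (cong (λ p → proj₁ (to x) , act p (proj₂ (to x))) (sym (trans (cong σ (edge-to i z)) eq))))

  #circles-≅ : ∀ σ → #circles G (σ ∘ edge) ≡ #circles H σ
  #circles-≅ σ = Classes-unique
    (Classes-transport to from (λ x → ≡⇒Orbit (strictlyInverseʳ x)) from-path to-path (circles G (σ ∘ edge)))
    (circles H σ)
    where
    to-path′ : ∀ {x x′} → Circle G (σ ∘ edge) x x′ → Circle H σ (to x) (to x′)
    to-path′ = gmap to λ { (inj₁ refl) → inj₁ (corner-commutes _) ; (inj₂ refl) → inj₂ (pairing-commutes σ _) }
    to-path : ∀ {y y′} → Circle G (σ ∘ edge) (from y) (from y′) → Circle H σ y y′
    to-path {y} {y′} path = subst₂ (Circle H σ) (strictlyInverseˡ y) (strictlyInverseˡ y′) (to-path′ path)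
    from-path : ∀ {y y′} → Circle H σ y y′ → Circle G (σ ∘ edge) (from y) (from y′)
    from-path = gmap from λ
      { {y} (inj₁ refl) → inj₁ (_≅_.corner-commutes ≅-sym y)
      ; {y} (inj₂ refl) → inj₂ (trans (cong (from ∘ pairing σ) (sym (strictlyInverseˡ y)))
          (trans (cong from (sym (pairing-commutes σ (from y)))) (strictlyInverseʳ _))) }

  constant-≅ : ∀ {C} → Constant G C → Constant H C
  constant-≅ const β = trans (sym (cong₂ ℕ._+_ (#circles-≅ (ribbons β)) (#circles-≅ (ribbons (not ∘ β)))))
    (const (β ∘ edge))

Classes-⊎ : ∀ {X Y : Set} {f g : X → X} {f′ g′ : Y → Y} {m n} → Classes (Orbit f g) m → Classes (Orbit f′ g′) n →
  Classes (Orbit (Sum.map f f′) (Sum.map g g′)) (m ℕ.+ n)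
Classes-⊎ {f = f} {g} {f′} {g′} {m} {n} C D = record
  { class     = join m n ∘ Sum.map (class C) (class D)
  ; rep       = Sum.map (rep C) (rep D) ∘ splitAt m
  ; class-rep = λ k → trans (cong (join m n) (inverse (splitAt m k))) (Fin.join-splitAt m n k)
  ; respects  = λ r → cong (join m n) (Orbit-invariant (Sum.map (class C) (class D))
      (λ { (inj₁ x) → cong inj₁ (sym (respects C (stepˡ x))) ; (inj₂ y) → cong inj₂ (sym (respects D (stepˡ y))) })
      (λ { (inj₁ x) → cong inj₁ (sym (respects C (stepʳ x))) ; (inj₂ y) → cong inj₂ (sym (respects D (stepʳ y))) }) r)
  ; reflects  = λ {x} {y} eq → reflects′ x y
      (trans (sym (Fin.splitAt-join m n _)) (trans (cong (splitAt m) eq) (Fin.splitAt-join m n _)))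
  }
  where
  inverse : ∀ z → Sum.map (class C) (class D) (Sum.map (rep C) (rep D) z) ≡ z
  inverse (inj₁ k) = cong inj₁ (class-rep C k)
  inverse (inj₂ k) = cong inj₂ (class-rep D k)
  reflects′ : ∀ x y → Sum.map (class C) (class D) x ≡ Sum.map (class C) (class D) y →
    Orbit (Sum.map f f′) (Sum.map g g′) x y
  reflects′ (inj₁ x) (inj₁ y) eq = gmap inj₁ (Sum.map (cong inj₁) (cong inj₁)) (reflects C (Sum.inj₁-injective eq))
  reflects′ (inj₂ x) (inj₂ y) eq = gmap inj₂ (Sum.map (cong inj₂) (cong inj₂)) (reflects D (Sum.inj₂-injective eq))
  reflects′ (inj₁ x) (inj₂ y) ()
  reflects′ (inj₂ x) (inj₁ y) ()

module _ (P Q : RibbonGraph) where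

  private
    X : Set
    X = FlagOf P ⊎ FlagOf Q

    _≟ˣ_ : DecidableEquality X
    _≟ˣ_ = Sum.≡-dec _≟ᶠ_ _≟ᶠ_

    points : List X
    points = List.map inj₁ (allFlags (e P)) List.++ List.map inj₂ (allFlags (e Q))

    ∈-points : ∀ x → x ∈ points
    ∈-points (inj₁ x) = ∈-++⁺ˡ (∈-map⁺ inj₁ (∈-allFlags x))
    ∈-points (inj₂ y) = ∈-++⁺ʳ _ (∈-map⁺ inj₂ (∈-allFlags y))

  _⊔_ : (Fin (e P) → Pairing) → (Fin (e Q) → Pairing) → Fin (e P ℕ.+ e Q) → Pairing
  (σ ⊔ τ) k = [ σ , τ ]′ (splitAt (e P) k)

  ⊔-join : ∀ σ τ z → (σ ⊔ τ) (join (e P) (e Q) z) ≡ [ σ , τ ]′ z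
  ⊔-join σ τ z = cong [ σ , τ ]′ (Fin.splitAt-join (e P) (e Q) z)

  pasted-outerˡ : ∀ a b x → x ≢ a → x ≢ corner P a → pasted P Q a b (inj₁ x) ≡ inj₁ (corner P x)
  pasted-outerˡ a b x p q with x ≟ᶠ a | x ≟ᶠ corner P a
  ... | yes r | _     = contradiction r p
  ... | no  _ | yes r = contradiction r q
  ... | no  _ | no  _ = refl

  pasted-outerʳ : ∀ a b y → y ≢ b → y ≢ corner Q b → pasted P Q a b (inj₂ y) ≡ inj₂ (corner Q y)
  pasted-outerʳ a b y p q with y ≟ᶠ b | y ≟ᶠ corner Q b
  ... | yes r | _     = contradiction r p
  ... | no  _ | yes r = contradiction r q
  ... | no  _ | no  _ = refl

  module _ (σ : Fin (e P) → Pairing) (τ : Fin (e Q) → Pairing) where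

    pairing⊎ : X → X
    pairing⊎ = Sum.map (pairing σ) (pairing τ)

    pairing⊎-involutive : Involutive pairing⊎
    pairing⊎-involutive (inj₁ x) = cong inj₁ (pairing-involutive σ x)
    pairing⊎-involutive (inj₂ y) = cong inj₂ (pairing-involutive τ y)

    pairing⊎-fixfree : Fixfree pairing⊎
    pairing⊎-fixfree (inj₁ x) eq = pairing-fixfree σ x (Sum.inj₁-injective eq)
    pairing⊎-fixfree (inj₂ y) eq = pairing-fixfree τ y (Sum.inj₂-injective eq)

    module _ (a : FlagOf P) (b : FlagOf Q) where

      pairing-joinFlag : ∀ z → pairing (σ ⊔ τ) (joinFlag P Q a b z) ≡ joinFlag P Q a b (pairing⊎ z)
      pairing-joinFlag (inj₁ (j , z)) = cong (λ p → join (e P) (e Q) (inj₁ j) , act p z) (⊔-join σ τ (inj₁ j))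
      pairing-joinFlag (inj₂ (k , z)) = cong (λ p → join (e P) (e Q) (inj₂ k) , act p z) (⊔-join σ τ (inj₂ k))

      joined-classes : Classes (Orbit (pasted P Q a b) pairing⊎) (#circles (ribbonJoin P Q a b) (σ ⊔ τ))
      joined-classes = Classes-transport (splitFlag P Q a b) (joinFlag P Q a b) (λ x → ≡⇒Orbit (join-split P Q a b x))
        forth (λ {y} {y′} path → subst₂ (Orbit (pasted P Q a b) pairing⊎) (split-join P Q a b y) (split-join P Q a b y′) (back path))
        (circles (ribbonJoin P Q a b) (σ ⊔ τ))
        where
        forth : ∀ {y y′} → Orbit (pasted P Q a b) pairing⊎ y y′ →
          Circle (ribbonJoin P Q a b) (σ ⊔ τ) (joinFlag P Q a b y) (joinFlag P Q a b y′)
        forth = gmap (joinFlag P Q a b) λ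
          { {y} (inj₁ refl) → inj₁ (cong (joinFlag P Q a b ∘ pasted P Q a b) (sym (split-join P Q a b y)))
          ; {y} (inj₂ refl) → inj₂ (sym (pairing-joinFlag y)) }
        back : ∀ {x x′} → Circle (ribbonJoin P Q a b) (σ ⊔ τ) x x′ →
          Orbit (pasted P Q a b) pairing⊎ (splitFlag P Q a b x) (splitFlag P Q a b x′)
        back = gmap (splitFlag P Q a b) λ
          { (inj₁ refl) → inj₁ (split-join P Q a b _)
          ; {x} (inj₂ refl) → inj₂ (trans (cong (splitFlag P Q a b ∘ pairing (σ ⊔ τ)) (sym (join-split P Q a b x)))
              (trans (cong (splitFlag P Q a b) (pairing-joinFlag (splitFlag P Q a b x)))
                (split-join P Q a b (pairing⊎ (splitFlag P Q a b x))))) }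

    module _ (a : FlagOf P) (b : FlagOf Q) where

      arc : Bool × Bool → X
      arc (false , false) = inj₁ a
      arc (false , true)  = inj₁ (corner P a)
      arc (true  , false) = inj₂ b
      arc (true  , true)  = inj₂ (corner Q b)

      arc-injective : ∀ {z z′} → arc z ≡ arc z′ → z ≡ z′
      arc-injective {false , false} {false , false} eq = refl
      arc-injective {false , false} {false , true}  eq = contradiction (sym (Sum.inj₁-injective eq)) (corner-fixfree P a)
      arc-injective {false , true}  {false , false} eq = contradiction (Sum.inj₁-injective eq) (corner-fixfree P a)
      arc-injective {false , true}  {false , true}  eq = refl
      arc-injective {true  , false} {true  , false} eq = refl
      arc-injective {true  , false} {true  , true}  eq = contradiction (sym (Sum.inj₂-injective eq)) (corner-fixfree Q b)
      arc-injective {true  , true}  {true  , false} eq = contradiction (Sum.inj₂-injective eq) (corner-fixfree Q b)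
      arc-injective {true  , true}  {true  , true}  eq = refl
      arc-injective {false , false} {true  , false} ()
      arc-injective {false , false} {true  , true } ()
      arc-injective {false , true } {true  , false} ()
      arc-injective {false , true } {true  , true } ()
      arc-injective {true  , false} {false , false} ()
      arc-injective {true  , false} {false , true } ()
      arc-injective {true  , true } {false , false} ()
      arc-injective {true  , true } {false , true } ()

      -- The two arcs of a ribbon-join, kept apart or pasted in the two possible ways, are
      -- treated like the four corners of a ribbon.

      cornerBy : Pairing → X → X
      cornerBy ends  = Sum.map (corner P) (corner Q)
      cornerBy sides = pasted P Q a b
      cornerBy diags = pasted P Q a (corner Q b)

      cornerBy-involutive : ∀ p → Involutive (cornerBy p)
      cornerBy-involutive ends (inj₁ x) = cong inj₁ (corner-involutive P x)
      cornerBy-involutive ends (inj₂ y) = cong inj₂ (corner-involutive Q y)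
      cornerBy-involutive sides = pasted-involutive P Q a b
      cornerBy-involutive diags = pasted-involutive P Q a (corner Q b)

      cornerBy-fixfree : ∀ p → Fixfree (cornerBy p)
      cornerBy-fixfree ends (inj₁ x) eq = corner-fixfree P x (Sum.inj₁-injective eq)
      cornerBy-fixfree ends (inj₂ y) eq = corner-fixfree Q y (Sum.inj₂-injective eq)
      cornerBy-fixfree sides = pasted-fixfree P Q a b
      cornerBy-fixfree diags = pasted-fixfree P Q a (corner Q b)

      cornerBy-arc : ∀ p z → cornerBy p (arc z) ≡ arc (act p z)
      cornerBy-arc ends (false , false) = refl
      cornerBy-arc ends (false , true)  = cong inj₁ (corner-involutive P a)
      cornerBy-arc ends (true  , false) = refl
      cornerBy-arc ends (true  , true)  = cong inj₂ (corner-involutive Q b)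
      cornerBy-arc sides (false , false) = pasted-a P Q a b
      cornerBy-arc sides (false , true)  = pasted-a′ P Q a b
      cornerBy-arc sides (true  , false) = pasted-b P Q a b
      cornerBy-arc sides (true  , true)  = pasted-b′ P Q a b
      cornerBy-arc diags (false , false) = pasted-a P Q a (corner Q b)
      cornerBy-arc diags (false , true)  = trans (pasted-a′ P Q a (corner Q b)) (cong inj₂ (corner-involutive Q b))
      cornerBy-arc diags (true  , false) = trans (cong (pasted P Q a (corner Q b) ∘ inj₂) (sym (corner-involutive Q b)))
                                             (pasted-b′ P Q a (corner Q b))
      cornerBy-arc diags (true  , true)  = pasted-b P Q a (corner Q b)

      cornerBy-outer : ∀ p y → (∀ z → y ≢ arc z) → cornerBy p y ≡ cornerBy ends y
      cornerBy-outer ends  y        out = refl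
      cornerBy-outer sides (inj₁ x) out = pasted-outerˡ a b x (out (false , false) ∘ cong inj₁) (out (false , true) ∘ cong inj₁)
      cornerBy-outer sides (inj₂ y) out = pasted-outerʳ a b y (out (true , false) ∘ cong inj₂) (out (true , true) ∘ cong inj₂)
      cornerBy-outer diags (inj₁ x) out = pasted-outerˡ a (corner Q b) x (out (false , false) ∘ cong inj₁) (out (false , true) ∘ cong inj₁)
      cornerBy-outer diags (inj₂ y) out = pasted-outerʳ a (corner Q b) y (out (true , true) ∘ cong inj₂)
        (λ eq → out (true , false) (cong inj₂ (trans eq (corner-involutive Q b))))

      countBy : Pairing → ℕ
      countBy ends  = #circles P σ ℕ.+ #circles Q τ
      countBy sides = #circles (ribbonJoin P Q a b) (σ ⊔ τ)
      countBy diags = #circles (ribbonJoin P Q a (corner Q b)) (σ ⊔ τ)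

      classesBy : ∀ p → Classes (Orbit pairing⊎ (cornerBy p)) (countBy p)
      classesBy ends  = Classes-cong Orbit-swap Orbit-swap (Classes-⊎ (circles P σ) (circles Q τ))
      classesBy sides = Classes-cong Orbit-swap Orbit-swap (joined-classes a b)
      classesBy diags = Classes-cong Orbit-swap Orbit-swap (joined-classes a (corner Q b))

      private module Arcs = Quad _≟ˣ_ points ∈-points pairing⊎ pairing⊎-involutive pairing⊎-fixfree arc arc-injective
                           cornerBy cornerBy-involutive cornerBy-fixfree cornerBy-arc
                           (λ p q y out → trans (cornerBy-outer p y out) (sym (cornerBy-outer q y out)))

      abstract
        #circles-join : suc (#circles (ribbonJoin P Q a b) (σ ⊔ τ)) ≡ #circles P σ ℕ.+ #circles Q τ
        #circles-join with ends ≟ᵖ Arcs.π classesBy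
        ... | no p = contradiction (Orbit-invariant [ (λ _ → true) , (λ _ → false) ]′
                (λ { (inj₁ _) → refl ; (inj₂ _) → refl }) (λ { (inj₁ _) → refl ; (inj₂ _) → refl })
                (Arcs.low-connected classesBy p (false , false) (true , false))) λ ()
        ... | yes eq = trans (sym (Arcs.high-count classesBy {sides} (λ r → contradiction (trans eq (sym r)) λ ()))) (cong countBy (sym eq))

  module _ (a : FlagOf P) (b : FlagOf Q) where

    private
      P∨Q : RibbonGraph
      P∨Q = ribbonJoin P Q a b

    _⊔ᵇ_ : (Fin (e P) → Bool) → (Fin (e Q) → Bool) → Fin (e P ℕ.+ e Q) → Bool
    (β ⊔ᵇ γ) k = [ β , γ ]′ (splitAt (e P) k)

    ribbons-⊔ : ∀ β γ → ribbons (β ⊔ᵇ γ) ≗ ribbons β ⊔ ribbons γ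
    ribbons-⊔ β γ k with splitAt (e P) k
    ... | inj₁ _ = refl
    ... | inj₂ _ = refl

    not-⊔ : ∀ β γ → not ∘ (β ⊔ᵇ γ) ≗ (not ∘ β) ⊔ᵇ (not ∘ γ)
    not-⊔ β γ k with splitAt (e P) k
    ... | inj₁ _ = refl
    ... | inj₂ _ = refl

    ⊔-restrict : ∀ β → β ≗ (β ∘ (_↑ˡ e Q)) ⊔ᵇ (β ∘ (e P ↑ʳ_))
    ⊔-restrict β k = trans (cong β (sym (Fin.join-splitAt (e P) (e Q) k))) (by-side (splitAt (e P) k))
      where
      by-side : ∀ z → β (join (e P) (e Q) z) ≡ [ β ∘ (_↑ˡ e Q) , β ∘ (e P ↑ʳ_) ]′ z
      by-side (inj₁ _) = refl
      by-side (inj₂ _) = refl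

    sum-join : ∀ β γ →
      2 ℕ.+ (#circles P∨Q (ribbons (β ⊔ᵇ γ)) ℕ.+ #circles P∨Q (ribbons (not ∘ (β ⊔ᵇ γ)))) ≡
      (#circles P (ribbons β) ℕ.+ #circles P (ribbons (not ∘ β))) ℕ.+
      (#circles Q (ribbons γ) ℕ.+ #circles Q (ribbons (not ∘ γ)))
    sum-join β γ = begin
      2 ℕ.+ (#circles P∨Q (ribbons (β ⊔ᵇ γ)) ℕ.+ #circles P∨Q (ribbons (not ∘ (β ⊔ᵇ γ))))
        ≡⟨ cong (2 ℕ.+_) (cong₂ ℕ._+_ (#circles-cong P∨Q (ribbons-⊔ β γ))
             (#circles-cong P∨Q (λ k → trans (ribbons-cong (not-⊔ β γ) k) (ribbons-⊔ (not ∘ β) (not ∘ γ) k)))) ⟩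
      2 ℕ.+ (#circles P∨Q (ribbons β ⊔ ribbons γ) ℕ.+ #circles P∨Q (ribbons (not ∘ β) ⊔ ribbons (not ∘ γ)))
        ≡⟨ cong suc (ℕ.+-suc _ _) ⟨
      suc (#circles P∨Q (ribbons β ⊔ ribbons γ)) ℕ.+ suc (#circles P∨Q (ribbons (not ∘ β) ⊔ ribbons (not ∘ γ)))
        ≡⟨ cong₂ ℕ._+_ (#circles-join (ribbons β) (ribbons γ) a b) (#circles-join (ribbons (not ∘ β)) (ribbons (not ∘ γ)) a b) ⟩
      (#circles P (ribbons β) ℕ.+ #circles Q (ribbons γ)) ℕ.+
      (#circles P (ribbons (not ∘ β)) ℕ.+ #circles Q (ribbons (not ∘ γ)))
        ≡⟨ exchange (#circles P (ribbons β)) (#circles Q (ribbons γ)) _ _ ⟩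
      (#circles P (ribbons β) ℕ.+ #circles P (ribbons (not ∘ β))) ℕ.+
      (#circles Q (ribbons γ) ℕ.+ #circles Q (ribbons (not ∘ γ))) ∎
      where
      open ≡-Reasoning
      exchange : ∀ i j k l → (i ℕ.+ j) ℕ.+ (k ℕ.+ l) ≡ (i ℕ.+ k) ℕ.+ (j ℕ.+ l)
      exchange = ℕ.solve-∀

    constant-join : ∀ {C D} → Constant P C → Constant Q D → ∀ β →
      2 ℕ.+ (#circles P∨Q (ribbons β) ℕ.+ #circles P∨Q (ribbons (not ∘ β))) ≡ C ℕ.+ D
    constant-join cP cQ β = trans
      (cong (2 ℕ.+_) (cong₂ ℕ._+_ (#circles-cong P∨Q (ribbons-cong (⊔-restrict β)))
        (#circles-cong P∨Q (ribbons-cong (cong not ∘ ⊔-restrict β)))))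
      (trans (sum-join (β ∘ (_↑ˡ e Q)) (β ∘ (e P ↑ʳ_))) (cong₂ ℕ._+_ (cP _) (cQ _)))

    constant-joinˡ : ∀ {C} → Constant P∨Q C → ∃[ D ] Constant P D
    constant-joinˡ const = _ , λ β → trans
      (sym (ℕ.m+n∸n≡m (#circles P (ribbons β) ℕ.+ #circles P (ribbons (not ∘ β))) (#circles Q off ℕ.+ #circles Q on)))
      (cong (ℕ._∸ (#circles Q off ℕ.+ #circles Q on))
        (trans (sym (sum-join β (λ _ → false))) (cong (2 ℕ.+_) (const _))))

    constant-joinʳ : ∀ {C} → Constant P∨Q C → ∃[ D ] Constant Q D
    constant-joinʳ const = _ , λ γ → trans
      (sym (ℕ.m+n∸m≡n (#circles P off ℕ.+ #circles P on) (#circles Q (ribbons γ) ℕ.+ #circles Q (ribbons (not ∘ γ)))))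
      (cong (ℕ._∸ (#circles P off ℕ.+ #circles P on))
        (trans (sym (sum-join (λ _ → false) γ)) (cong (2 ℕ.+_) (const _))))

next-< : ∀ {m} (i : Fin m) → suc (toℕ i) < m → toℕ (next i) ≡ suc (toℕ i)
next-< {suc n} i i<n with view i
... | ‵fromℕ     = contradiction (subst (λ k → suc k < suc n) (Fin.toℕ-fromℕ n) i<n) (ℕ.<-irrefl refl)
... | ‵inject₁ j = cong suc (sym (Fin.toℕ-inject₁ j))

next-last : ∀ {m} (i : Fin m) → suc (toℕ i) ≡ m → toℕ (next i) ≡ 0
next-last {suc n} i i≡n with view i
... | ‵fromℕ     = refl
... | ‵inject₁ j = contradiction (trans (sym (Fin.toℕ-inject₁ j)) (ℕ.suc-injective i≡n)) (ℕ.<⇒≢ (Fin.toℕ<n j))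

rotation : ∀ t → SignedRotation t
rotation t = record { word = doubled t ; sign = λ _ → Sign.+ }

module _ (n : ℕ) where

  private
    t : ℕ
    t = suc n

    R : SignedRotation t
    R = rotation t

    open Inverse (doubled t) using (to; from; strictlyInverseˡ)

    toℕ-from : ∀ s i → toℕ (from (s , i)) ≡ (if s then t else 0) ℕ.+ toℕ i
    toℕ-from false i = trans (Fin.toℕ-combine {2} zero i) (cong (ℕ._+ toℕ i) (ℕ.*-zeroʳ t))
    toℕ-from true  i = trans (Fin.toℕ-combine {2} (suc zero) i) (cong (ℕ._+ toℕ i) (ℕ.*-identityʳ t))

    next-from : ∀ h h′ → toℕ (next (from h)) ≡ toℕ (from h′) → succʰ R h ≡ h′
    next-from h h′ eq = trans (cong to (Fin.toℕ-injective eq)) (strictlyInverseˡ h′)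

  succ-inject₁ : ∀ s (j : Fin n) → succʰ R (s , inject₁ j) ≡ (s , suc j)
  succ-inject₁ s j = next-from (s , inject₁ j) (s , suc j) (trans (next-< (from (s , inject₁ j)) bound) (trans (cong suc eq) (sym step)))
    where
    base : ℕ
    base = if s then t else 0
    eq : toℕ (from (s , inject₁ j)) ≡ base ℕ.+ toℕ j
    eq = trans (toℕ-from s _) (cong (base ℕ.+_) (Fin.toℕ-inject₁ j))
    step : toℕ (from (s , suc j)) ≡ suc (base ℕ.+ toℕ j)
    step = trans (toℕ-from s _) (ℕ.+-suc base (toℕ j))
    bound : suc (toℕ (from (s , inject₁ j))) < 2 ℕ.* t
    bound = subst (_< 2 ℕ.* t) (trans step (cong suc (sym eq))) (Fin.toℕ<n (from (s , suc j)))

  succ-fromℕ : ∀ s → succʰ R (s , fromℕ n) ≡ (not s , zero)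
  succ-fromℕ false = next-from (false , fromℕ n) (true , zero) (trans (next-< (from (false , fromℕ n)) bound) (trans eq (sym step)))
    where
    eq : suc (toℕ (from (false , fromℕ n))) ≡ t ℕ.+ 0
    eq = trans (cong suc (trans (toℕ-from false (fromℕ n)) (Fin.toℕ-fromℕ n))) (sym (ℕ.+-identityʳ t))
    step : toℕ (from (true , zero)) ≡ t ℕ.+ 0
    step = toℕ-from true zero
    bound : suc (toℕ (from (false , fromℕ n))) < 2 ℕ.* t
    bound = subst (_< 2 ℕ.* t) (trans step (sym eq)) (Fin.toℕ<n (from (true , zero)))
  succ-fromℕ true = next-from (true , fromℕ n) (false , zero) (trans (next-last (from (true , fromℕ n)) eq) (sym (toℕ-from false zero)))
    where
    eq : suc (toℕ (from (true , fromℕ n))) ≡ 2 ℕ.* t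
    eq = trans (cong suc (trans (toℕ-from true (fromℕ n)) (cong (t ℕ.+_) (Fin.toℕ-fromℕ n))))
      (trans (sym (ℕ.+-suc t n)) (cong (t ℕ.+_) (sym (ℕ.+-identityʳ t))))

  corner-inject₁ : ∀ s (j : Fin n) → corner B[ t ] (inject₁ j , s , not s) ≡ (suc j , s , s)
  corner-inject₁ s j = trans (corner-exit R (s , inject₁ j)) (cong (entry R) (succ-inject₁ s j))

  corner-fromℕ : ∀ s → corner B[ t ] (fromℕ n , s , not s) ≡ (zero , not s , not s)
  corner-fromℕ s = trans (corner-exit R (s , fromℕ n)) (cong (entry R) (succ-fromℕ s))

before : ∀ {m} → (Fin m → Bool) → Fin m → Bool
before β zero    = false
before β (suc j) = β zero xor before (β ∘ suc) j

total : ∀ {m} → (Fin m → Bool) → Bool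
total {zero}  β = false
total {suc m} β = β zero xor total (β ∘ suc)

before-suc : ∀ {m} (β : Fin (suc m) → Bool) j → before β (suc j) ≡ before β (inject₁ j) xor β (inject₁ j)
before-suc β zero    = Bool.xor-comm (β zero) false
before-suc β (suc j) = trans (cong (β zero xor_) (before-suc (β ∘ suc) j)) (sym (Bool.xor-assoc (β zero) _ _))

total-fromℕ : ∀ {m} (β : Fin (suc m) → Bool) → total β ≡ before β (fromℕ m) xor β (fromℕ m)
total-fromℕ {zero}  β = Bool.xor-identityʳ (β zero)
total-fromℕ {suc m} β = trans (cong (β zero xor_) (total-fromℕ (β ∘ suc))) (sym (Bool.xor-assoc (β zero) _ _))

-- Along a boundary circle of the subgraph β of B[ t ], going around the word once swaps
-- the two copies of it, and every ribbon of β passed swaps them again.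

module _ (n : ℕ) (β : Fin (suc n) → Bool) where

  private
    t : ℕ
    t = suc n

    _~_ : Rel (Flag t) 0ℓ
    _~_ = Circle B[ t ] (ribbons β)

    symᶜ : ∀ {x y} → x ~ y → y ~ x
    symᶜ = Circle-sym B[ t ] (ribbons β)

    infixr 5 _▸_
    _▸_ : ∀ {x y z} → x ~ y → y ≡ z → x ~ z
    path ▸ refl = path

    start : Bool → Flag t
    start s = zero , s , s

    label : Flag t → Bool
    label (i , s , u) = (s xor before β i) xor ((s xor u) ∧ β i)

    pass : ∀ i s → (i , s , s) ~ (i , s xor β i , not (s xor β i))
    pass i s = stepʳ (i , s , s) ▸ cong (i ,_) (out (β i) s)
      where
      out : ∀ b s → act (if b then sides else ends) (s , s) ≡ (s xor b , not (s xor b))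
      out false false = refl
      out false true  = refl
      out true  false = refl
      out true  true  = refl

    advance : ∀ j s → (inject₁ j , s , s) ~ (suc j , s xor β (inject₁ j) , s xor β (inject₁ j))
    advance j s = pass (inject₁ j) s ◅◅ stepˡ _ ▸ corner-inject₁ n _ j

    wrap : ∀ s → (fromℕ n , s , s) ~ start (not (s xor β (fromℕ n)))
    wrap s = pass (fromℕ n) s ◅◅ stepˡ _ ▸ corner-fromℕ n _

    reach : ∀ i s → start s ~ (i , s xor before β i , s xor before β i)
    reach i s = <-weakInduction (λ i → start s ~ (i , s xor before β i , s xor before β i))
      (ε ▸ cong (λ u → zero , u , u) (sym (Bool.xor-identityʳ s)))
      (λ j path → path ◅◅ advance j (s xor before β (inject₁ j)) ▸ cong (λ u → suc j , u , u)
        (trans (Bool.xor-assoc s (before β (inject₁ j)) (β (inject₁ j))) (cong (s xor_) (sym (before-suc β j)))))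
      i

    xor-twice : ∀ s b → (s xor b) xor b ≡ s
    xor-twice s b = trans (Bool.xor-assoc s b b) (trans (cong (s xor_) (Bool.xor-same b)) (Bool.xor-identityʳ s))

    home : ∀ y → y ~ start (label y)
    home (i , s , u) = by-side (u Bool.≟ s)
      where
      at-entry : ∀ i s → (i , s , s) ~ start (s xor before β i)
      at-entry i s = symᶜ (reach i (s xor before β i) ▸ cong (λ w → i , w , w) (xor-twice s (before β i)))
      by-side : Dec (u ≡ s) → (i , s , u) ~ start (label (i , s , u))
      by-side (yes refl) = at-entry i s ▸ cong start (sym (trans
        (cong ((s xor before β i) xor_) (cong (_∧ β i) (Bool.xor-same s))) (Bool.xor-identityʳ _)))
      by-side (no u≢s) = subst (λ w → (i , s , w) ~ start (label (i , s , w))) (sym (Bool.¬-not u≢s))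
        (symᶜ (pass i (s xor β i) ▸ cong (λ w → i , w , not w) (xor-twice s (β i)))
          ◅◅ at-entry i (s xor β i) ▸ cong start (rearrange s (β i) (before β i)))
        where
        rearrange : ∀ s b a → (s xor b) xor a ≡ (s xor a) xor ((s xor not s) ∧ b)
        rearrange false false false = refl
        rearrange false false true  = refl
        rearrange false true  false = refl
        rearrange false true  true  = refl
        rearrange true  false false = refl
        rearrange true  false true  = refl
        rearrange true  true  false = refl
        rearrange true  true  true  = refl

    around : ∀ s → start s ~ start (not (s xor total β))
    around s = reach (fromℕ n) s ◅◅ wrap (s xor before β (fromℕ n)) ▸ cong (start ∘ not)
      (trans (Bool.xor-assoc s (before β (fromℕ n)) (β (fromℕ n))) (cong (s xor_) (sym (total-fromℕ β))))

  #circles-even : total β ≡ false → #circles B[ t ] (ribbons β) ≡ 1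
  #circles-even even = Classes-unique (circles B[ t ] (ribbons β)) record
    { class     = λ _ → zero
    ; rep       = λ _ → start false
    ; class-rep = λ { zero → refl }
    ; respects  = λ _ → refl
    ; reflects  = λ {x} {y} _ → home x ◅◅ both (label x) (label y) ◅◅ symᶜ (home y)
    }
    where
    half : start false ~ start true
    half = subst (λ b → start false ~ start (not b)) even (around false)
    both : ∀ r s → start r ~ start s
    both false false = ε
    both false true  = half
    both true  false = symᶜ half
    both true  true  = ε

  #circles-odd : total β ≡ true → #circles B[ t ] (ribbons β) ≡ 2
  #circles-odd β-odd = Classes-unique (circles B[ t ] (ribbons β)) record
    { class     = Inverse.from Fin.2↔Bool ∘ label
    ; rep       = start ∘ Inverse.to Fin.2↔Bool
    ; class-rep = λ { zero → refl ; (suc zero) → refl }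
    ; respects  = λ r → cong (Inverse.from Fin.2↔Bool) (Orbit-invariant label corner-step pairing-step r)
    ; reflects  = λ {x} {y} eq → home x ◅◅ ≡⇒Orbit (cong start (2↔Bool-injective eq)) ◅◅ symᶜ (home y)
    }
    where
    2↔Bool-injective : ∀ {r s} → Inverse.from Fin.2↔Bool r ≡ Inverse.from Fin.2↔Bool s → r ≡ s
    2↔Bool-injective {r} {s} eq = trans (sym (Inverse.strictlyInverseˡ Fin.2↔Bool r))
      (trans (cong (Inverse.to Fin.2↔Bool) eq) (Inverse.strictlyInverseˡ Fin.2↔Bool s))
    pairing-step : ∀ x → label (pairing (ribbons β) x) ≡ label x
    pairing-step (i , s , u) with β i | before β i | s | u
    ... | false | a | false | false = refl
    ... | false | a | false | true  = refl
    ... | false | a | true  | false = refl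
    ... | false | a | true  | true  = refl
    ... | true  | false | false | false = refl
    ... | true  | true  | false | false = refl
    ... | true  | false | false | true  = refl
    ... | true  | true  | false | true  = refl
    ... | true  | false | true  | false = refl
    ... | true  | true  | true  | false = refl
    ... | true  | false | true  | true  = refl
    ... | true  | true  | true  | true  = refl
    label-exit : ∀ i s → label (i , s , not s) ≡ s xor (before β i xor β i)
    label-exit i s = trans (cong ((s xor before β i) xor_) (cong (_∧ β i) (flip-xor s))) (Bool.xor-assoc s (before β i) (β i))
      where
      flip-xor : ∀ s → s xor not s ≡ true
      flip-xor false = refl
      flip-xor true  = refl
    label-entry : ∀ i s → label (i , s , s) ≡ s xor before β i
    label-entry i s = trans (cong ((s xor before β i) xor_) (cong (_∧ β i) (Bool.xor-same s))) (Bool.xor-identityʳ _)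
    exit-step : ∀ i s → label (corner B[ t ] (i , s , not s)) ≡ label (i , s , not s)
    exit-step i s with view i
    ... | ‵inject₁ j = trans (cong label (corner-inject₁ n s j))
            (trans (label-entry (suc j) s) (trans (cong (s xor_) (before-suc β j)) (sym (label-exit (inject₁ j) s))))
    ... | ‵fromℕ = trans (cong label (corner-fromℕ n s)) (trans (label-entry zero (not s))
            (trans (trans (Bool.xor-identityʳ (not s)) (not-xor s)) (sym (label-exit (fromℕ n) s))))
      where
      not-xor : ∀ s → not s ≡ s xor (before β (fromℕ n) xor β (fromℕ n))
      not-xor s = trans (sym (xor-true s)) (cong (s xor_) (trans (sym β-odd) (total-fromℕ β)))
        where
        xor-true : ∀ s → s xor true ≡ not s
        xor-true false = refl
        xor-true true  = refl
    corner-step : ∀ x → label (corner B[ t ] x) ≡ label x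
    corner-step (i , s , u) = by-side (u Bool.≟ s)
      where
      open ≡-Reasoning
      p : HalfEdge t
      p = predʰ (rotation t) (s , i)
      at-exit : corner B[ t ] (i , s , s) ≡ exit (rotation t) p
      at-exit = corner-entry (rotation t) (s , i)
      by-side : Dec (u ≡ s) → label (corner B[ t ] (i , s , u)) ≡ label (i , s , u)
      by-side (no u≢s) = subst (λ w → label (corner B[ t ] (i , s , w)) ≡ label (i , s , w))
        (sym (Bool.¬-not u≢s)) (exit-step i s)
      by-side (yes refl) = begin
        label (corner B[ t ] (i , s , s))      ≡⟨ cong label at-exit ⟩
        label (exit (rotation t) p)            ≡⟨ exit-step (proj₂ p) (proj₁ p) ⟨
        label (corner B[ t ] (exit (rotation t) p))
          ≡⟨ cong (label ∘ corner B[ t ]) at-exit ⟨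
        label (corner B[ t ] (corner B[ t ] (i , s , s)))
          ≡⟨ cong label (corner-involutive B[ t ] (i , s , s)) ⟩
        label (i , s , s) ∎

parity : ℕ → Bool
parity zero    = false
parity (suc n) = not (parity n)

parity-odd : ∀ n → parity n ≡ true → ∃[ s ] n ≡ suc (2 ℕ.* s)
parity-odd (suc zero) _ = 0 , refl
parity-odd (suc (suc n)) eq with parity-odd n (trans (sym (Bool.not-involutive (parity n))) eq)
... | s , refl = suc s , cong (λ k → suc (suc k)) (sym (ℕ.+-suc s (s ℕ.+ 0)))

parity-suc-2* : ∀ s → parity (suc (2 ℕ.* s)) ≡ true
parity-suc-2* zero    = refl
parity-suc-2* (suc s) = trans (cong (λ k → not (not (parity k))) (ℕ.+-suc s (s ℕ.+ 0)))
  (trans (Bool.not-involutive (parity (suc (2 ℕ.* s)))) (parity-suc-2* s))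

total-not : ∀ {m} (β : Fin m → Bool) → total (not ∘ β) ≡ parity m xor total β
total-not {zero}  β = refl
total-not {suc m} β = trans (cong (not (β zero) xor_) (total-not (β ∘ suc))) (move (β zero) (parity m) (total (β ∘ suc)))
  where
  move : ∀ b p t → not b xor (p xor t) ≡ not p xor (b xor t)
  move false false t = refl
  move false true  false = refl
  move false true  true = refl
  move true  false false = refl
  move true  false true = refl
  move true  true  false = refl
  move true  true  true = refl

total-false : ∀ m → total {m} (λ _ → false) ≡ false
total-false zero    = refl
total-false (suc m) = total-false m

constant-odd : ∀ s → Constant B[ suc (2 ℕ.* s) ] 3
constant-odd s β = by-parity (total β) refl
  where
  complement : ∀ {b} → total β ≡ b → total (not ∘ β) ≡ not b
  complement eq = trans (total-not β) (cong₂ _xor_ (parity-suc-2* s) eq)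
  by-parity : ∀ b → total β ≡ b →
    #circles B[ suc (2 ℕ.* s) ] (ribbons β) ℕ.+ #circles B[ suc (2 ℕ.* s) ] (ribbons (not ∘ β)) ≡ 3
  by-parity false eq = cong₂ ℕ._+_ (#circles-even _ β eq) (#circles-odd _ (not ∘ β) (complement eq))
  by-parity true  eq = cong₂ ℕ._+_ (#circles-odd _ β eq) (#circles-even _ (not ∘ β) (complement eq))

constant⇒odd : ∀ n {C} → Constant B[ suc n ] C → parity (suc n) ≡ true
constant⇒odd n {C} const with parity (suc n) in eq
... | true  = refl
... | false = contradiction (trans (sym (count-none)) count-one) λ ()
  where
  β : Fin (suc n) → Bool
  β zero    = true
  β (suc _) = false
  β-odd : total β ≡ true
  β-odd = cong not (total-false n)
  none : Fin (suc n) → Bool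
  none _ = false
  count-one : C ≡ 4
  count-one = trans (sym (const β)) (cong₂ ℕ._+_ (#circles-odd n β β-odd)
    (#circles-odd n (not ∘ β) (trans (total-not β) (cong₂ _xor_ eq β-odd))))
  count-none : C ≡ 2
  count-none = trans (sym (const none)) (cong₂ ℕ._+_ (#circles-even n none (total-false n))
    (#circles-even n (not ∘ none) (trans (total-not none) (cong₂ _xor_ eq (total-false n)))))

edge-inverse : ∀ {G H} (φ : G ≅ H) i → edge (≅-sym φ) (edge φ i) ≡ i
edge-inverse φ i = trans (sym (edge-to (≅-sym φ) (edge φ i) (proj₂ (to (i , false , false)))))
  (cong proj₁ (strictlyInverseʳ (i , false , false)))
  where open Inverse (_≅_.flags φ)

edge-injective : ∀ {G H} (φ : G ≅ H) {i j} → edge φ i ≡ edge φ j → i ≡ j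
edge-injective φ eq = trans (sym (edge-inverse φ _)) (trans (cong (edge (≅-sym φ)) eq) (edge-inverse φ _))

≅⇒e≡ : ∀ {G H} → G ≅ H → e G ≡ e H
≅⇒e≡ φ = ℕ.≤-antisym (Fin.injective⇒≤ (edge-injective φ)) (Fin.injective⇒≤ (edge-injective (≅-sym φ)))

connected⇒#circles≡1 : ∀ G σ x → (∀ y → Circle G σ x y) → #circles G σ ≡ 1
connected⇒#circles≡1 G σ x conn = Classes-unique (circles G σ) record
  { class     = λ _ → zero
  ; rep       = λ _ → x
  ; class-rep = λ { zero → refl }
  ; respects  = λ _ → refl
  ; reflects  = λ _ → Circle-sym G σ (conn _) ◅◅ conn _
  }

constant-B₁̄ : Constant B₁̄ 2
constant-B₁̄ β = by-value (β zero) refl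
  where
  o : Flag 1
  o = zero , false , false
  single-off : #circles B₁̄ off ≡ 1
  single-off = connected⇒#circles≡1 B₁̄ off o λ
    { (zero , false , false) → ε
    ; (zero , false , true)  → inj₂ refl ◅ ε
    ; (zero , true  , false) → inj₂ refl ◅ inj₁ refl ◅ ε
    ; (zero , true  , true)  → inj₁ refl ◅ ε }
  single-on : #circles B₁̄ on ≡ 1
  single-on = connected⇒#circles≡1 B₁̄ on o λ
    { (zero , false , false) → ε
    ; (zero , false , true)  → inj₂ refl ◅ inj₁ refl ◅ ε
    ; (zero , true  , false) → inj₂ refl ◅ ε
    ; (zero , true  , true)  → inj₁ refl ◅ ε }
  by-value : ∀ b → β zero ≡ b → #circles B₁̄ (ribbons β) ℕ.+ #circles B₁̄ (ribbons (not ∘ β)) ≡ 2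
  by-value false eq = cong₂ ℕ._+_
    (trans (#circles-cong B₁̄ λ { zero → cong (if_then sides else ends) eq }) single-off)
    (trans (#circles-cong B₁̄ λ { zero → cong (λ b → if not b then sides else ends) eq }) single-on)
  by-value true eq = cong₂ ℕ._+_
    (trans (#circles-cong B₁̄ λ { zero → cong (if_then sides else ends) eq }) single-on)
    (trans (#circles-cong B₁̄ λ { zero → cong (λ b → if not b then sides else ends) eq }) single-off)

#untwisted : List 𝓑 → ℕ
#untwisted []             = 0
#untwisted (twisted ∷ Fs) = #untwisted Fs
#untwisted (odd _   ∷ Fs) = suc (#untwisted Fs)

#untwisted-++ : ∀ Fs Gs → #untwisted (Fs List.++ Gs) ≡ #untwisted Fs ℕ.+ #untwisted Gs
#untwisted-++ []             Gs = refl
#untwisted-++ (twisted ∷ Fs) Gs = #untwisted-++ Fs Gs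
#untwisted-++ (odd _   ∷ Fs) Gs = cong suc (#untwisted-++ Fs Gs)

length-untwisted-twisted : ∀ Fs → length Fs ≡ #untwisted Fs ℕ.+ #twisted Fs
length-untwisted-twisted []             = refl
length-untwisted-twisted (twisted ∷ Fs) = trans (cong suc (length-untwisted-twisted Fs)) (sym (ℕ.+-suc _ _))
length-untwisted-twisted (odd _   ∷ Fs) = cong suc (length-untwisted-twisted Fs)

⋁⇒constant : ∀ {B Fs} → B ≅⋁ Fs → Constant B (2 ℕ.+ #untwisted Fs)
⋁⇒constant (factor twisted φ) = constant-≅ (≅-sym φ) constant-B₁̄
⋁⇒constant (factor (odd s) φ) = constant-≅ (≅-sym φ) (constant-odd s)
⋁⇒constant (joined {P = P} {Q} {Fs} {Gs} p q a b φ) = constant-≅ (≅-sym φ) λ β →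
  ℕ.+-cancelˡ-≡ 2 _ _ (trans (constant-join P Q a b (⋁⇒constant p) (⋁⇒constant q) β) regroup)
  where
  regroup : 2 ℕ.+ #untwisted Fs ℕ.+ (2 ℕ.+ #untwisted Gs) ≡ 2 ℕ.+ (2 ℕ.+ #untwisted (Fs List.++ Gs))
  regroup = trans (solved (#untwisted Fs) (#untwisted Gs)) (cong (4 ℕ.+_) (sym (#untwisted-++ Fs Gs)))
    where
    solved : ∀ m n → 2 ℕ.+ m ℕ.+ (2 ℕ.+ n) ≡ 4 ℕ.+ (m ℕ.+ n)
    solved = ℕ.solve-∀

⋁⇒e : ∀ {B Fs} → B ≅⋁ Fs → #untwisted Fs ≤ e B
⋁⇒e (factor twisted φ) = z≤n
⋁⇒e (factor (odd s) φ) = subst (1 ≤_) (sym (≅⇒e≡ φ)) (s≤s z≤n)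
⋁⇒e (joined {Fs = Fs} {Gs} p q a b φ) = subst₂ _≤_ (sym (#untwisted-++ Fs Gs)) (sym (≅⇒e≡ φ)) (ℕ.+-mono-≤ (⋁⇒e p) (⋁⇒e q))

⋁⇒nonempty : ∀ {B Fs} → B ≅⋁ Fs → 1 ≤ length Fs
⋁⇒nonempty (factor F _) = s≤s z≤n
⋁⇒nonempty (joined {Fs = Fs} {Gs} p q a b φ) = subst (1 ≤_) (sym (List.length-++ Fs)) (ℕ.≤-trans (⋁⇒nonempty p) (ℕ.m≤m+n _ _))

⋁⇒monomial : ∀ {B Fs} → B ≅⋁ Fs → ∃[ b ] ∂ε B ≗ 2 ^ e B · z^ (+ b)
⋁⇒monomial {B} {Fs} p = b , constant⇒monomial B b (cong (2 ℕ.+_) (ℕ.m+[n∸m]≡n (⋁⇒e p))) (⋁⇒constant p)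
  where
  b : ℕ
  b = e B ℕ.∸ #untwisted Fs

⋁-exponent : ∀ {B Fs} b → ∂ε B ≗ 2 ^ e B · z^ (+ b) → B ≅⋁ Fs → + b ≡ + e B - + length Fs + + #twisted Fs
⋁-exponent {B} {Fs} b mono p = from-constant (monomial⇒constant B b mono)
  where
  cancel : ∀ i j k → i + j - (i + k) + k ≡ j
  cancel = ℤ.solve-∀
  from-constant : ∃[ C ] C ℕ.+ b ≡ 2 ℕ.+ e B × Constant B C → + b ≡ + e B - + length Fs + + #twisted Fs
  from-constant (C , C+b≡2+e , const) = sym (trans
    (cong₂ (λ m n → + m - + n + + #twisted Fs) (sym u+b≡e) (length-untwisted-twisted Fs))
    (cancel (+ #untwisted Fs) (+ b) (+ #twisted Fs)))
    where
    u+b≡e : #untwisted Fs ℕ.+ b ≡ e B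
    u+b≡e = ℕ.+-cancelˡ-≡ 2 _ _
      (trans (cong (ℕ._+ b) (trans (sym (⋁⇒constant p (λ _ → false))) (const (λ _ → false)))) C+b≡2+e)

-- The word of a bouquet

least : ∀ {P : ℕ → Set} → (∀ k → Dec (P k)) → ∀ n → P n → ∃[ m ] m ≤ n × P m × (∀ k → k < m → ¬ P k)
least P? zero p = 0 , z≤n , p , λ _ ()
least P? (suc n) p with P? 0
... | yes p₀ = 0 , z≤n , p₀ , λ _ ()
... | no ¬p₀ with least (P? ∘ suc) n p
...   | m , m≤n , pm , min = suc m , s≤s m≤n , pm , λ { zero _ → ¬p₀ ; (suc k) (s≤s k<m) → min k k<m }

encode : ∀ {m} → Flag m → Fin (m ℕ.* (2 ℕ.* 2))
encode (i , s , t) = combine i (combine (Inverse.from Fin.2↔Bool s) (Inverse.from Fin.2↔Bool t))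

encode-injective : ∀ {m} {x y : Flag m} → encode x ≡ encode y → x ≡ y
encode-injective {x = i , s , t} {j , s′ , t′} eq with Fin.combine-injective i _ j _ eq
... | refl , eq′ with Fin.combine-injective (Inverse.from Fin.2↔Bool s) _ (Inverse.from Fin.2↔Bool s′) _ eq′
...   | p , q = cong (i ,_) (cong₂ _,_ (bit-injective p) (bit-injective q))
  where
  bit-injective : ∀ {r s} → Inverse.from Fin.2↔Bool r ≡ Inverse.from Fin.2↔Bool s → r ≡ s
  bit-injective {r} {s} eq = trans (sym (Inverse.strictlyInverseˡ Fin.2↔Bool r))
    (trans (cong (Inverse.to Fin.2↔Bool) eq) (Inverse.strictlyInverseˡ Fin.2↔Bool s))

across-involutive : ∀ {m} → Involutive (across {m})
across-involutive (i , s , t) = cong (λ u → i , s , u) (Bool.not-involutive t)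

across-fixfree : ∀ {m} → Fixfree (across {m})
across-fixfree (i , s , t) eq = Bool.not-¬ refl (sym (cong (proj₂ ∘ proj₂) eq))

edgeOf : ∀ {m} → Flag m → Fin m
edgeOf = proj₁

-- The half-edges of a bouquet in the order x 0 , x 1 , … in which they are met when going
-- around the vertex from x₀; the walk returns to x₀ after `period` steps.

module Walk (G : RibbonGraph) (bouquet : #circles G off ≡ 1) (x₀ : FlagOf G) where

  x : ℕ → FlagOf G
  x zero    = x₀
  x (suc k) = corner G (across (x k))

  corner-x : ∀ k → corner G (x (suc k)) ≡ across (x k)
  corner-x k = corner-involutive G (across (x k))

  x-suc-injective : ∀ {a b} → x (suc a) ≡ x (suc b) → x a ≡ x b
  x-suc-injective eq = Involutive-injective {f = across} across-involutive (Involutive-injective {f = corner G} (corner-involutive G) eq)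

  x-cancel : ∀ a {d} → x (a ℕ.+ d) ≡ x a → x d ≡ x₀
  x-cancel zero    eq = eq
  x-cancel (suc a) eq = x-cancel a (x-suc-injective {a ℕ.+ _} {a} eq)

  returns : ∃[ d ] x (suc d) ≡ x₀
  returns with Fin.pigeonhole (ℕ.n<1+n _) (encode ∘ x ∘ toℕ)
  ... | i , j , i<j , eq with ℕ.m≤n⇒∃[o]m+o≡n i<j
  ...   | d , i+d≡j = d , x-cancel (toℕ i) (trans (cong x (trans (ℕ.+-suc (toℕ i) d) i+d≡j)) (sym (encode-injective eq)))

  abstract
    first-return : ∃[ d ] d ≤ proj₁ returns × x (suc d) ≡ x₀ × (∀ k → k < d → ¬ x (suc k) ≡ x₀)
    first-return = least (λ k → x (suc k) ≟ᶠ x₀) (proj₁ returns) (proj₂ returns)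

  last period : ℕ
  last   = proj₁ first-return
  period = suc last

  x-period : x period ≡ x₀
  x-period = proj₁ (proj₂ (proj₂ first-return))

  x-distinct : ∀ {a b} → a < b → b < period → x a ≢ x b
  x-distinct {a} {b} a<b b<N eq with ℕ.m≤n⇒∃[o]m+o≡n a<b
  ... | d , refl = proj₂ (proj₂ (proj₂ first-return)) d
        (ℕ.≤-trans (s≤s (ℕ.m≤n+m d a)) (ℕ.s≤s⁻¹ b<N))
        (x-cancel a (trans (cong x (ℕ.+-suc a d)) (sym eq)))

  x-injective : ∀ {a b} → a < period → b < period → x a ≡ x b → a ≡ b
  x-injective {a} {b} a<N b<N eq with ℕ.<-cmp a b
  ... | tri< a<b _ _ = contradiction eq (x-distinct a<b b<N)
  ... | tri≈ _ a≡b _ = a≡b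
  ... | tri> _ _ b<a = contradiction (sym eq) (x-distinct b<a a<N)

  -- Applying the corner map shortens the distance by two, and distances 0 and 1 would give
  -- a fixed point of the map across resp. of the corner map.

  x≢across-+ : ∀ d a → x (a ℕ.+ d) ≢ across (x a)
  x≢across-+ zero          a eq = across-fixfree (x a) (sym (trans (cong x (sym (ℕ.+-identityʳ a))) eq))
  x≢across-+ (suc zero)    a eq = corner-fixfree G (across (x a)) (trans (cong x (ℕ.+-comm 1 a)) eq)
  x≢across-+ (suc (suc d)) a eq = x≢across-+ d (suc a) (sym (trans (cong across
      (trans (cong (corner G) (sym eq)) (trans (cong (corner G ∘ x) (trans (ℕ.+-suc a (suc d)) (cong suc (ℕ.+-suc a d))))
        (corner-x (suc (a ℕ.+ d))))))
      (across-involutive (x (suc a ℕ.+ d)))))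

  x≢across : ∀ a b → x a ≢ across (x b)
  x≢across a b eq with ℕ.≤-total b a
  ... | inj₁ b≤a with ℕ.m≤n⇒∃[o]m+o≡n b≤a
  ...   | d , refl = x≢across-+ d b eq
  x≢across a b eq | inj₂ a≤b with ℕ.m≤n⇒∃[o]m+o≡n a≤b
  ...   | d , refl = x≢across-+ d a (trans (sym (across-involutive (x (a ℕ.+ d)))) (cong across (sym eq)))

  infix 4 _at_

  _at_ : FlagOf G → ℕ → Set
  y at k = k < period × (y ≡ x k ⊎ y ≡ across (x k))

  x-at : ∀ {k} → k < period → x k at k
  x-at k<N = k<N , inj₁ refl

  at-across : ∀ {y k} → y at k → across y at k
  at-across (k<N , inj₁ refl) = k<N , inj₂ refl
  at-across (k<N , inj₂ refl) = k<N , inj₁ (across-involutive _)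

  at-corner : ∀ {y k} → y at k → ∃[ l ] corner G y at l
  at-corner {k = zero}  (_   , inj₁ refl) = last , ℕ.n<1+n last , inj₂
    (trans (cong (corner G) (sym x-period)) (corner-x last))
  at-corner {k = suc k} (k<N , inj₁ refl) = k , ℕ.<-trans (ℕ.n<1+n k) k<N , inj₂ (corner-x k)
  at-corner {k = k}     (k<N , inj₂ refl) with suc k ℕ.≟ period
  ... | yes eq = 0 , s≤s z≤n , inj₁ (trans (cong x eq) x-period)
  ... | no neq = suc k , ℕ.≤∧≢⇒< k<N neq , inj₁ refl

  at-unique : ∀ {y k l} → y at k → y at l → k ≡ l
  at-unique (k<N , inj₁ p) (l<N , inj₁ q) = x-injective k<N l<N (trans (sym p) q)
  at-unique (k<N , inj₂ p) (l<N , inj₂ q) = x-injective k<N l<N (Involutive-injective {f = across} across-involutive (trans (sym p) q))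
  at-unique {k = k} {l} (_ , inj₁ p) (_ , inj₂ q) = contradiction (trans (sym p) q) (x≢across k l)
  at-unique {k = k} {l} (_ , inj₂ p) (_ , inj₁ q) = contradiction (trans (sym q) p) (x≢across l k)

  one-circle : ∀ y z → Circle G off y z
  one-circle y z = reflects (circles G off) (all-equal bouquet _ _)
    where
    all-equal : ∀ {n} → n ≡ 1 → (i j : Fin n) → i ≡ j
    all-equal refl zero zero = refl

  abstract
    position : ∀ y → ∃[ k ] y at k
    position y = along-path (one-circle x₀ y) (0 , x-at (s≤s z≤n))
      where
      along-path : ∀ {y z} → Circle G off y z → ∃[ k ] y at k → ∃[ k ] z at k
      along-path ε p = p
      along-path (inj₁ refl ◅ path) (k , p) = along-path path (at-corner p)
      along-path (inj₂ refl ◅ path) (k , p) = along-path path (k , at-across p)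

  at-same-end : ∀ {y z k} → edgeOf y ≡ edgeOf z → proj₁ (proj₂ y) ≡ proj₁ (proj₂ z) → y at k → z at k
  at-same-end {i , s , t} {_ , _ , t′} refl refl p with t′ Bool.≟ t
  ... | yes refl = p
  ... | no t′≢t  = subst (_at _) (cong (λ u → i , s , u) (sym (Bool.¬-not t′≢t))) (at-across p)

  ends-differ : ∀ {k l} → k < period → l < period → k ≢ l → edgeOf (x k) ≡ edgeOf (x l) →
    proj₁ (proj₂ (x l)) ≢ proj₁ (proj₂ (x k))
  ends-differ k<N l<N k≢l same eq = k≢l (at-unique (at-same-end same (sym eq) (x-at k<N)) (x-at l<N))

  mate : ∀ {k} → k < period → ∃[ l ] l < period × l ≢ k × edgeOf (x l) ≡ edgeOf (x k)
  mate {k} k<N with position (along (x k))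
  ... | l , l<N , eq = l , l<N , (λ { refl → moved eq }) , same eq
    where
    moved : ¬ (along (x k) ≡ x k ⊎ along (x k) ≡ across (x k))
    moved (inj₁ eq) = Bool.not-¬ refl (sym (cong (proj₁ ∘ proj₂) eq))
    moved (inj₂ eq) = Bool.not-¬ refl (sym (cong (proj₁ ∘ proj₂) eq))
    same : along (x k) ≡ x l ⊎ along (x k) ≡ across (x l) → edgeOf (x l) ≡ edgeOf (x k)
    same (inj₁ eq) = sym (cong proj₁ eq)
    same (inj₂ eq) = sym (cong proj₁ eq)

  only-two : ∀ {j k l} → j < period → k < period → l < period → edgeOf (x j) ≡ edgeOf (x k) → edgeOf (x l) ≡ edgeOf (x k) →
    j ≢ k → l ≢ k → j ≡ l
  only-two j<N k<N l<N jk lk j≢k l≢k = at-unique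
    (at-same-end (trans jk (sym lk)) (trans (Bool.¬-not (ends-differ k<N j<N (j≢k ∘ sym) (sym jk)))
      (sym (Bool.¬-not (ends-differ k<N l<N (l≢k ∘ sym) (sym lk))))) (x-at j<N))
    (x-at l<N)

  arc-circle-+ : ∀ σ a d → (∀ k → a < k → k < suc (a ℕ.+ d) → σ (edgeOf (x k)) ≡ ends) →
    Circle G σ (across (x a)) (x (suc (a ℕ.+ d)))
  arc-circle-+ σ a zero    free = subst (λ k → Circle G σ (across (x a)) (x (suc k))) (sym (ℕ.+-identityʳ a)) (stepˡ _)
  arc-circle-+ σ a (suc d) free = subst (λ k → Circle G σ (across (x a)) (x (suc k))) (sym (ℕ.+-suc a d))
    (arc-circle-+ σ a d (λ k a<k k<b → free k a<k (ℕ.<-trans k<b (s≤s (subst (a ℕ.+ d <_) (sym (ℕ.+-suc a d)) (ℕ.n<1+n _)))))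
      ◅◅ subst (Circle G σ (x b)) (cong (λ p → edgeOf (x b) , act p (proj₂ (x b))) (free b (s≤s (ℕ.m≤m+n a d))
           (s≤s (subst (a ℕ.+ d <_) (sym (ℕ.+-suc a d)) (ℕ.n<1+n _))))) (stepʳ (x b))
      ◅◅ stepˡ (across (x b)))
    where
    b : ℕ
    b = suc (a ℕ.+ d)

  arc-circle : ∀ σ {a b} → a < b → (∀ k → a < k → k < b → σ (edgeOf (x k)) ≡ ends) → Circle G σ (across (x a)) (x b)
  arc-circle σ {a} a<b free with ℕ.m≤n⇒∃[o]m+o≡n a<b
  ... | d , refl = arc-circle-+ σ a d free

module Chords (G : RibbonGraph) (bouquet : #circles G off ≡ 1) (x₀ : FlagOf G) where

  open Walk G bouquet x₀

  chord : ℕ → Fin (e G)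
  chord k = edgeOf (x k)

  chord-elsewhere : ∀ {p q k} → p < period → q < period → k < period → p ≢ q → chord p ≡ chord q →
    k ≢ p → k ≢ q → chord k ≢ chord p
  chord-elsewhere p<N q<N k<N p≢q pq k≢p k≢q kp =
    k≢q (sym (only-two q<N p<N k<N (sym pq) kp (p≢q ∘ sym) k≢p))

  module _ (i : Fin (e G)) where

    highest≢ends : highest G off i ≢ ends
    highest≢ends eq = highest-separated G off i {ends} (sym eq) {false , false} {true , false} (λ ()) (λ ())
      (Circle-cong G (sym ∘ ≔-self refl) (one-circle _ _))

    highest-two : #circles G (off [ i ≔ highest G off i ]) ≡ 2
    highest-two = trans (highest-count G off i {ends} (highest≢ends ∘ sym))
      (cong suc (trans (#circles-cong G (≔-self refl)) bouquet))

  module _ {p q} (p<q : p < q) (q<N : q < period) (pq : chord p ≡ chord q) where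

    private
      i : Fin (e G)
      i = chord p

      π : Pairing
      π = highest G off i

      σ : Fin (e G) → Pairing
      σ = off [ i ≔ π ]

      p<N : p < period
      p<N = ℕ.<-trans p<q q<N

      at-i : ∀ {y w} → chord q ≡ i → edgeOf y ≡ chord q → Circle G σ w y → Circle G σ w (i , proj₂ y)
      at-i eq eq′ path = subst (λ j → Circle G σ _ (j , _)) (trans eq′ eq) path

    free : ∀ {k} → k < period → k ≢ p → k ≢ q → ∀ π → (off [ i ≔ π ]) (chord k) ≡ ends
    free k<N k≢p k≢q π = ≔-other off π (chord-elsewhere p<N q<N k<N (ℕ.<⇒≢ p<q) pq k≢p k≢q)

    other-end : proj₁ (proj₂ (x q)) ≢ proj₁ (proj₂ (x p))
    other-end = ends-differ p<N q<N (ℕ.<⇒≢ p<q) pq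

    highest-joins : proj₂ (x q) ≡ act π (proj₂ (across (x p)))
    highest-joins = by-cases (≡-dec Bool._≟_ Bool._≟_ (proj₂ (x q)) (act π (proj₂ (across (x p)))))
      where
      path : Circle G σ (across (x p)) (x q)
      path = arc-circle σ p<q λ k p<k k<q → free (ℕ.<-trans k<q q<N) (ℕ.<⇒≢ p<k ∘ sym) (ℕ.<⇒≢ k<q) π
      by-cases : Dec (proj₂ (x q) ≡ act π (proj₂ (across (x p)))) → proj₂ (x q) ≡ act π (proj₂ (across (x p)))
      by-cases (yes eq) = eq
      by-cases (no neq) = contradiction (at-i (sym pq) refl path)
        (highest-separated G off i refl (other-end ∘ cong proj₁) neq)

    arcs-separated : ¬ Circle G σ (across (x p)) (across (x q))
    arcs-separated path = highest-separated G off i refl (other-end ∘ cong proj₁)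
      (λ eq → across-fixfree (x q) (cong (chord q ,_) (trans eq (sym highest-joins)))) (at-i (sym pq) refl path)

  crossing-linked : ∀ {p r q s} → p < r → r < q → q < s → s < period → chord p ≡ chord q → chord r ≡ chord s →
    Linked (count₂ G off (chord p) (chord r)) (highest G off (chord p))
  crossing-linked {p} {r} {q} {s} p<r r<q q<s s<N pq rs = record
    { single = trans (count₂-first G i≢j ends) (trans (#circles-cong G (≔-self refl)) bouquet)
    ; split  = trans (count₂-first G i≢j π) (highest-two i)
    ; sides₁ = low (λ ())
    ; diags₁ = low (λ ())
    }
    where
    i j : Fin (e G)
    i = chord p
    j = chord r
    π : Pairing
    π = highest G off i
    σ : Fin (e G) → Pairing
    σ = off [ i ≔ π ]
    p<q : p < q
    p<q = ℕ.<-trans p<r r<q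
    q<N : q < period
    q<N = ℕ.<-trans q<s s<N
    i≢j : i ≢ j
    i≢j eq = chord-elsewhere (ℕ.<-trans p<q q<N) q<N (ℕ.<-trans r<q q<N) (ℕ.<⇒≢ p<q) pq (ℕ.<⇒≢ p<r ∘ sym) (ℕ.<⇒≢ r<q) (sym eq)
    separated : ¬ Circle G σ (x r) (x s)
    separated path = arcs-separated p<q q<N pq
      (arc-circle σ p<r (λ k p<k k<r → free p<q q<N pq (ℕ.<-trans k<r (ℕ.<-trans r<q q<N)) (ℕ.<⇒≢ p<k ∘ sym)
          (ℕ.<⇒≢ (ℕ.<-trans k<r r<q)) π)
        ◅◅ path
        ◅◅ Circle-sym G σ (arc-circle σ q<s (λ k q<k k<s → free p<q q<N pq (ℕ.<-trans k<s s<N)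
          (ℕ.<⇒≢ (ℕ.<-trans p<q q<k) ∘ sym) (ℕ.<⇒≢ q<k ∘ sym) π)))
    σ-at-j : σ [ j ≔ ends ] ≗ σ
    σ-at-j = ≔-self (≔-other off π (i≢j ∘ sym))
    ends-highest : ends ≡ highest G σ j
    ends-highest = separated⇒highest G σ j λ path → separated
      (subst (λ l → Circle G σ (x r) (l , proj₂ (x s))) rs (Circle-cong G σ-at-j path))
    low : ∀ {h} → h ≢ ends → count₂ G off i j π h ≡ 1
    low {h} h≢ends = ℕ.suc-injective (trans (sym (highest-count G σ j (λ eq → h≢ends (trans eq (sym ends-highest)))))
      (trans (cong (λ h → #circles G (σ [ j ≔ h ])) (sym ends-highest))
        (trans (#circles-cong G σ-at-j) (highest-two i))))

  unlinked : ∀ {i r s} → r < s → s < period → chord r ≡ chord s → (∀ k → r < k → k < s → chord k ≢ i) → i ≢ chord r →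
    ∀ {π} → ¬ Linked (count₂ G off i (chord r)) π
  unlinked {i} {r} {s} r<s s<N rs avoids i≢j {π} L = by-highest (highest G σ j) refl
    where
    j : Fin (e G)
    j = chord r
    σ : Fin (e G) → Pairing
    σ = off [ i ≔ π ]
    path : Circle G σ (across (x r)) (x s)
    path = arc-circle σ r<s λ k r<k k<s → ≔-other off π (avoids k r<k k<s)
    differ : proj₁ (proj₂ (x s)) ≢ proj₁ (proj₂ (x r))
    differ = ends-differ (ℕ.<-trans r<s s<N) s<N (ℕ.<⇒≢ r<s) rs
    three≢one : ∀ {m n l} → m ≡ suc n → n ≡ 2 → m ≡ l → l ≢ 1
    three≢one refl refl refl ()
    by-highest : ∀ h → highest G σ j ≡ h → ⊥
    by-highest ends eq = highest-separated G σ j {ends} (sym eq) {proj₂ (across (x r))} {proj₂ (x s)}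
      (differ ∘ cong proj₁) (differ ∘ cong proj₁)
      (Circle-cong G (sym ∘ ≔-self (≔-other off π (i≢j ∘ sym)))
        (subst (λ l → Circle G σ (across (x r)) (l , proj₂ (x s))) (sym rs) path))
    by-highest sides eq = three≢one (highest-count G σ j {ends} (λ r → contradiction (trans r eq) λ ()))
      (Linked.split L) (cong (count₂ G off i j π) eq) (Linked.sides₁ L)
    by-highest diags eq = three≢one (highest-count G σ j {ends} (λ r → contradiction (trans r eq) λ ()))
      (Linked.split L) (cong (count₂ G off i j π) eq) (Linked.diags₁ L)

-- Decomposing bouquets

record Partition {m} (D : Fin m → Bool) : Set where
  field
    m₁ m₂     : ℕ
    to        : Fin m → Fin m₁ ⊎ Fin m₂
    from      : Fin m₁ ⊎ Fin m₂ → Fin m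
    to-from   : ∀ z → to (from z) ≡ z
    from-to   : ∀ i → from (to i) ≡ i
    D-from    : ∀ z → D (from z) ≡ [ (λ _ → true) , (λ _ → false) ]′ z

partition : ∀ {m} (D : Fin m → Bool) → Partition D
partition {zero} D = record
  { m₁ = 0 ; m₂ = 0 ; to = λ () ; from = λ { (inj₁ ()) ; (inj₂ ()) }
  ; to-from = λ { (inj₁ ()) ; (inj₂ ()) } ; from-to = λ () ; D-from = λ { (inj₁ ()) ; (inj₂ ()) } }
partition {suc m} D = extend (partition (D ∘ suc)) (D zero) refl
  where
  extend : Partition (D ∘ suc) → ∀ b → D zero ≡ b → Partition D
  extend R true eq = record
    { m₁ = suc m₁ ; m₂ = m₂ ; to = to′ ; from = from′
    ; to-from = λ { (inj₁ zero) → refl ; (inj₁ (suc j)) → cong (Sum.map₁ suc) (to-from (inj₁ j))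
                  ; (inj₂ k) → cong (Sum.map₁ suc) (to-from (inj₂ k)) }
    ; from-to = λ { zero → refl ; (suc i) → trans (from′-suc (to i)) (cong suc (from-to i)) }
    ; D-from  = λ { (inj₁ zero) → eq ; (inj₁ (suc j)) → D-from (inj₁ j) ; (inj₂ k) → D-from (inj₂ k) }
    }
    where
    open Partition R
    to′ : Fin (suc m) → Fin (suc m₁) ⊎ Fin m₂
    to′ zero    = inj₁ zero
    to′ (suc i) = Sum.map₁ suc (to i)
    from′ : Fin (suc m₁) ⊎ Fin m₂ → Fin (suc m)
    from′ (inj₁ zero)    = zero
    from′ (inj₁ (suc j)) = suc (from (inj₁ j))
    from′ (inj₂ k)       = suc (from (inj₂ k))
    from′-suc : ∀ z → from′ (Sum.map₁ suc z) ≡ suc (from z)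
    from′-suc (inj₁ j) = refl
    from′-suc (inj₂ k) = refl
  extend R false eq = record
    { m₁ = m₁ ; m₂ = suc m₂ ; to = to′ ; from = from′
    ; to-from = λ { (inj₂ zero) → refl ; (inj₂ (suc k)) → cong (Sum.map₂ suc) (to-from (inj₂ k))
                  ; (inj₁ j) → cong (Sum.map₂ suc) (to-from (inj₁ j)) }
    ; from-to = λ { zero → refl ; (suc i) → trans (from′-suc (to i)) (cong suc (from-to i)) }
    ; D-from  = λ { (inj₂ zero) → eq ; (inj₂ (suc k)) → D-from (inj₂ k) ; (inj₁ j) → D-from (inj₁ j) }
    }
    where
    open Partition R
    to′ : Fin (suc m) → Fin m₁ ⊎ Fin (suc m₂)
    to′ zero    = inj₂ zero
    to′ (suc i) = Sum.map₂ suc (to i)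
    from′ : Fin m₁ ⊎ Fin (suc m₂) → Fin (suc m)
    from′ (inj₂ zero)    = zero
    from′ (inj₂ (suc k)) = suc (from (inj₂ k))
    from′ (inj₁ j)       = suc (from (inj₁ j))
    from′-suc : ∀ z → from′ (Sum.map₂ suc z) ≡ suc (from z)
    from′-suc (inj₁ j) = refl
    from′-suc (inj₂ k) = refl

IsJoin : RibbonGraph → Set
IsJoin B = ∃[ P ] ∃[ Q ] Σ[ a ∈ FlagOf P ] Σ[ b ∈ FlagOf Q ] B ≅ ribbonJoin P Q a b

-- If only two arcs of the vertex boundaries lead from the ribbons in D to the other ones,
-- then cutting these arcs and closing up both sides shows a ribbon-join.

module _ (B : RibbonGraph) (D : Fin (e B) → Bool) (a a′ : FlagOf B) (a≢a′ : a ≢ a′)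
  (Da : D (edgeOf a) ≡ true) (Da′ : D (edgeOf a′) ≡ true)
  (Db : D (edgeOf (corner B a)) ≡ false) (Db′ : D (edgeOf (corner B a′)) ≡ false)
  (D-closed : ∀ y → y ≢ a → y ≢ a′ → D (edgeOf y) ≡ true → D (edgeOf (corner B y)) ≡ true)
  where

  private
    open Partition (partition D)

    c : FlagOf B → FlagOf B
    c = corner B

    c-inv : Involutive c
    c-inv = corner-involutive B

    c-fix : Fixfree c
    c-fix = corner-fixfree B

    b b′ : FlagOf B
    b  = c a
    b′ = c a′

    true≢false : ∀ {d} → d ≡ true → d ≡ false → ⊥
    true≢false refl ()

    b≢a′ : b ≢ a′
    b≢a′ eq = true≢false Da′ (trans (cong (D ∘ edgeOf) (sym eq)) Db)

    open Switch _≟ᶠ_ c a a′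

    switch-D : ∀ y → D (edgeOf (switch y)) ≡ D (edgeOf y)
    switch-D y with place y
    ... | atA  = trans (cong (D ∘ edgeOf) switch-a) (trans Da′ (sym Da))
    ... | atB  = trans (cong (D ∘ edgeOf) (switch-b c-inv c-fix a≢a′ b≢a′)) (trans Da (sym Da′))
    ... | atCA = trans (cong (D ∘ edgeOf) (switch-ca c-inv c-fix a≢a′ b≢a′)) (trans Db′ (sym Db))
    ... | atCB = trans (cong (D ∘ edgeOf) (switch-cb c-inv c-fix a≢a′ b≢a′)) (trans Db (sym Db′))
    ... | other p q r s = trans (cong (D ∘ edgeOf) (switch-other p q r s)) (same (D (edgeOf y)) refl (D (edgeOf (c y))) refl)
      where
      same : ∀ d → D (edgeOf y) ≡ d → ∀ d′ → D (edgeOf (c y)) ≡ d′ → d′ ≡ d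
      same true  eq d′    eq′ = trans (sym eq′) (D-closed y p q eq)
      same false eq false eq′ = refl
      same false eq true  eq′ = ⊥-elim (true≢false
        (trans (sym (cong (D ∘ edgeOf) (c-inv y))) (D-closed (c y) (λ z → r (trans (sym (c-inv y)) (cong c z)))
          (λ z → s (trans (sym (c-inv y)) (cong c z))) eq′)) eq)

    embed₁ : Flag m₁ → FlagOf B
    embed₁ (j , z) = from (inj₁ j) , z

    embed₂ : Flag m₂ → FlagOf B
    embed₂ (k , z) = from (inj₂ k) , z

    from-injective : ∀ {z z′} → from z ≡ from z′ → z ≡ z′
    from-injective eq = trans (sym (to-from _)) (trans (cong to eq) (to-from _))

    embed₁-injective : ∀ {x y} → embed₁ x ≡ embed₁ y → x ≡ y
    embed₁-injective eq = cong₂ _,_ (Sum.inj₁-injective (from-injective (cong proj₁ eq))) (cong proj₂ eq)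

    embed₂-injective : ∀ {x y} → embed₂ x ≡ embed₂ y → x ≡ y
    embed₂-injective eq = cong₂ _,_ (Sum.inj₂-injective (from-injective (cong proj₁ eq))) (cong proj₂ eq)

    lift₁ : ∀ y → D (edgeOf y) ≡ true → ∃[ x ] embed₁ x ≡ y
    lift₁ (i , z) eq = by-side (to i) refl
      where
      by-side : ∀ w → to i ≡ w → ∃[ x ] embed₁ x ≡ (i , z)
      by-side (inj₁ j) eq′ = (j , z) , cong (_, z) (trans (cong from (sym eq′)) (from-to i))
      by-side (inj₂ k) eq′ = ⊥-elim (true≢false eq
        (trans (cong D (trans (sym (from-to i)) (cong from eq′))) (D-from (inj₂ k))))

    lift₂ : ∀ y → D (edgeOf y) ≡ false → ∃[ x ] embed₂ x ≡ y
    lift₂ (i , z) eq = by-side (to i) refl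
      where
      by-side : ∀ w → to i ≡ w → ∃[ x ] embed₂ x ≡ (i , z)
      by-side (inj₂ k) eq′ = (k , z) , cong (_, z) (trans (cong from (sym eq′)) (from-to i))
      by-side (inj₁ j) eq′ = ⊥-elim (true≢false
        (trans (cong D (trans (sym (from-to i)) (cong from eq′))) (D-from (inj₁ j))) eq)

    corner₁ : Flag m₁ → Flag m₁
    corner₁ y = proj₁ (lift₁ (switch (embed₁ y)) (trans (switch-D (embed₁ y)) (D-from (inj₁ (proj₁ y)))))

    corner₂ : Flag m₂ → Flag m₂
    corner₂ y = proj₁ (lift₂ (switch (embed₂ y)) (trans (switch-D (embed₂ y)) (D-from (inj₂ (proj₁ y)))))

    embed-corner₁ : ∀ y → embed₁ (corner₁ y) ≡ switch (embed₁ y)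
    embed-corner₁ y = proj₂ (lift₁ (switch (embed₁ y)) (trans (switch-D (embed₁ y)) (D-from (inj₁ (proj₁ y)))))

    embed-corner₂ : ∀ y → embed₂ (corner₂ y) ≡ switch (embed₂ y)
    embed-corner₂ y = proj₂ (lift₂ (switch (embed₂ y)) (trans (switch-D (embed₂ y)) (D-from (inj₂ (proj₁ y)))))

    sw-inv : Involutive switch
    sw-inv = switch-involutive c-inv c-fix a≢a′ b≢a′

    sw-fix : Fixfree switch
    sw-fix = switch-fixfree c-inv c-fix a≢a′ b≢a′

    P Q : RibbonGraph
    P = record
      { e = m₁ ; corner = corner₁
      ; corner-involutive = λ y → embed₁-injective (trans (embed-corner₁ (corner₁ y))
          (trans (cong switch (embed-corner₁ y)) (sw-inv (embed₁ y))))
      ; corner-fixfree = λ y eq → sw-fix (embed₁ y) (trans (sym (embed-corner₁ y)) (cong embed₁ eq)) }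
    Q = record
      { e = m₂ ; corner = corner₂
      ; corner-involutive = λ y → embed₂-injective (trans (embed-corner₂ (corner₂ y))
          (trans (cong switch (embed-corner₂ y)) (sw-inv (embed₂ y))))
      ; corner-fixfree = λ y eq → sw-fix (embed₂ y) (trans (sym (embed-corner₂ y)) (cong embed₂ eq)) }

    aP : Flag m₁
    aP = proj₁ (lift₁ a Da)

    bQ : Flag m₂
    bQ = proj₁ (lift₂ b Db)

    embed-a : embed₁ aP ≡ a
    embed-a = proj₂ (lift₁ a Da)

    embed-b : embed₂ bQ ≡ b
    embed-b = proj₂ (lift₂ b Db)

    embed-a′ : embed₁ (corner₁ aP) ≡ a′
    embed-a′ = trans (embed-corner₁ aP) (trans (cong switch embed-a) switch-a)

    embed-b′ : embed₂ (corner₂ bQ) ≡ b′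
    embed-b′ = trans (embed-corner₂ bQ) (trans (cong switch embed-b) (switch-ca c-inv c-fix a≢a′ b≢a′))

    embed : FlagOf P ⊎ FlagOf Q → FlagOf B
    embed = [ embed₁ , embed₂ ]′

    embed-pasted : ∀ z → embed (pasted P Q aP bQ z) ≡ c (embed z)
    embed-pasted (inj₁ y) = by-place (y ≟ᶠ aP) (y ≟ᶠ corner₁ aP)
      where
      by-place : Dec (y ≡ aP) → Dec (y ≡ corner₁ aP) → embed (pasted P Q aP bQ (inj₁ y)) ≡ c (embed₁ y)
      by-place (yes refl) _ = trans (cong embed (pasted-a P Q aP bQ)) (trans embed-b (cong c (sym embed-a)))
      by-place (no _) (yes refl) = trans (cong embed (pasted-a′ P Q aP bQ)) (trans embed-b′ (cong c (sym embed-a′)))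
      by-place (no p) (no q) = trans (cong embed (pasted-outerˡ P Q aP bQ y p q)) (trans (embed-corner₁ y)
        (switch-other (λ r → p (embed₁-injective (trans r (sym embed-a)))) (λ r → q (embed₁-injective (trans r (sym embed-a′))))
          (λ r → true≢false (D-from (inj₁ (proj₁ y))) (trans (cong (D ∘ edgeOf) r) Db))
          (λ r → true≢false (D-from (inj₁ (proj₁ y))) (trans (cong (D ∘ edgeOf) r) Db′))))
    embed-pasted (inj₂ y) = by-place (y ≟ᶠ bQ) (y ≟ᶠ corner₂ bQ)
      where
      by-place : Dec (y ≡ bQ) → Dec (y ≡ corner₂ bQ) → embed (pasted P Q aP bQ (inj₂ y)) ≡ c (embed₂ y)
      by-place (yes refl) _ = trans (cong embed (pasted-b P Q aP bQ)) (trans embed-a (trans (sym (c-inv a)) (cong c (sym embed-b))))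
      by-place (no _) (yes refl) = trans (cong embed (pasted-b′ P Q aP bQ)) (trans embed-a′ (trans (sym (c-inv a′)) (cong c (sym embed-b′))))
      by-place (no p) (no q) = trans (cong embed (pasted-outerʳ P Q aP bQ y p q)) (trans (embed-corner₂ y)
        (switch-other (λ r → true≢false Da (trans (cong (D ∘ edgeOf) (sym r)) (D-from (inj₂ (proj₁ y)))))
          (λ r → true≢false Da′ (trans (cong (D ∘ edgeOf) (sym r)) (D-from (inj₂ (proj₁ y)))))
          (λ r → p (embed₂-injective (trans r (sym embed-b)))) (λ r → q (embed₂-injective (trans r (sym embed-b′))))))

    S : RibbonGraph
    S = ribbonJoin P Q aP bQ

    forget : FlagOf S → FlagOf B
    forget (k , z) = from (splitAt m₁ k) , z

    forget-join : ∀ z → forget (joinFlag P Q aP bQ z) ≡ embed z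
    forget-join (inj₁ (j , z)) = cong (λ w → from w , z) (Fin.splitAt-join m₁ m₂ (inj₁ j))
    forget-join (inj₂ (k , z)) = cong (λ w → from w , z) (Fin.splitAt-join m₁ m₂ (inj₂ k))

    embed-split : ∀ x → embed (splitFlag P Q aP bQ x) ≡ forget x
    embed-split (k , z) with splitAt m₁ k
    ... | inj₁ j = refl
    ... | inj₂ l = refl

    S≅B : S ≅ B
    S≅B = record
      { flags = mk↔ₛ′ forget (λ { (i , z) → join m₁ m₂ (to i) , z })
          (λ { (i , z) → cong (_, z) (trans (cong from (Fin.splitAt-join m₁ m₂ (to i))) (from-to i)) })
          (λ { (k , z) → cong (_, z) (trans (cong (join m₁ m₂) (to-from (splitAt m₁ k))) (Fin.join-splitAt m₁ m₂ k)) })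
      ; corner-commutes = λ x → trans (forget-join (pasted P Q aP bQ (splitFlag P Q aP bQ x)))
          (trans (embed-pasted (splitFlag P Q aP bQ x)) (cong c (embed-split x)))
      ; along-commutes  = λ _ → refl
      ; across-commutes = λ _ → refl
      }

  splits : IsJoin B
  splits = P , Q , aP , bQ , ≅-sym S≅B

-- The ribbon of x 0 and those crossing it form a set K. The half-edges met
-- between x 0 and the first return to K are closed under taking the other end of the
-- ribbon: a ribbon leaving this interval would cross a member of K.

module Gap (G : RibbonGraph) (bouquet : #circles G off ≡ 1) {C} (const : Constant G C) (x₀ : FlagOf G) where

  open Walk G bouquet x₀
  open Chords G bouquet x₀

  K : ℕ → Set
  K k = chord k ≡ chord 0 ⊎ Crossing G (chord 0) (chord k)

  K? : ∀ k → Dec (K k)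
  K? k with chord k Fin.≟ chord 0 | Crossing? G (chord 0) (chord k)
  ... | yes p | _     = yes (inj₁ p)
  ... | no _  | yes q = yes (inj₂ q)
  ... | no p  | no q  = no [ p , q ]′

  linked⇒K : ∀ k {π} → Linked (count₂ G off (chord 0) (chord k)) π → ¬ chord k ≡ chord 0 → K k
  linked⇒K k L k≢0 = inj₂ (linked⇒crossing const (k≢0 ∘ sym) L)

  module _ (¬K1 : ¬ K 1) where

    private
      0<N : 0 < period
      0<N = s≤s z≤n

      mate₀ : ∃[ p ] p < period × p ≢ 0 × chord p ≡ chord 0
      mate₀ = mate 0<N

      abstract
        first : ∀ p → p < period → p ≢ 0 → chord p ≡ chord 0 →
          ∃[ l ] suc l ≤ p × K (suc l) × (∀ k → k < l → ¬ K (suc k))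
        first zero    _   p≢0 _  = contradiction refl p≢0
        first (suc p) p<N _   eq with least (K? ∘ suc) p (inj₁ eq)
        ... | l , l≤p , Kl , min = l , s≤s l≤p , Kl , min

      p : ℕ
      p = proj₁ mate₀
      p<N : p < period
      p<N = proj₁ (proj₂ mate₀)
      p≢0 : p ≢ 0
      p≢0 = proj₁ (proj₂ (proj₂ mate₀))
      p0 : chord p ≡ chord 0
      p0 = proj₂ (proj₂ (proj₂ mate₀))

      first′ : ∃[ l ] suc l ≤ p × K (suc l) × (∀ k → k < l → ¬ K (suc k))
      first′ = first p p<N p≢0 p0

      l k : ℕ
      l = proj₁ first′
      k = suc l

      k≤p : k ≤ p
      k≤p = proj₁ (proj₂ first′)
      Kk : K k
      Kk = proj₁ (proj₂ (proj₂ first′))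

      k<N : k < period
      k<N = ℕ.≤-<-trans k≤p p<N

      outside-K : ∀ j → 0 < j → j < k → ¬ K j
      outside-K (suc j) _ (s≤s j<l) = proj₂ (proj₂ (proj₂ first′)) j j<l

      1<k : 1 < k
      1<k with l | Kk
      ... | zero  | K1 = contradiction K1 ¬K1
      ... | suc _ | _  = s≤s (s≤s z≤n)

      K-resp : ∀ i j → chord i ≡ chord j → K i → K j
      K-resp i j eq (inj₁ p) = inj₁ (trans (sym eq) p)
      K-resp i j eq (inj₂ q) = inj₂ (subst (Crossing G (chord 0)) eq q)

      no-escape : ∀ {j j′} → 0 < j → j < k → k < j′ → j′ < period → chord j ≡ chord j′ → ⊥
      no-escape {j} {j′} 0<j j<k k<j′ j′<N jj′ = by-first (chord k Fin.≟ chord 0) Kk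
        where
        ¬Kj : ¬ K j
        ¬Kj = outside-K j 0<j j<k
        j≢0 : chord j ≢ chord 0
        j≢0 eq = ¬Kj (inj₁ eq)
        by-first : Dec (chord k ≡ chord 0) → K k → ⊥
        by-first (yes k0) _ = ¬Kj (linked⇒K j (crossing-linked 0<j j<k k<j′ j′<N (sym k0) jj′) j≢0)
        by-first (no k≢0) (inj₁ k0) = k≢0 k0
        by-first (no k≢0) (inj₂ cross) = by-order (ℕ.<-cmp p q)
          where
          k<p : k < p
          k<p = ℕ.≤∧≢⇒< k≤p (λ eq → k≢0 (trans (cong chord eq) p0))
          mateₖ : ∃[ q ] q < period × q ≢ k × chord q ≡ chord k
          mateₖ = mate k<N
          q : ℕ
          q = proj₁ mateₖ
          q<N : q < period
          q<N = proj₁ (proj₂ mateₖ)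
          qk : chord q ≡ chord k
          qk = proj₂ (proj₂ (proj₂ mateₖ))
          k<q : k < q
          k<q with ℕ.<-cmp k q
          ... | tri< lt _ _ = lt
          ... | tri≈ _ eq _ = contradiction (sym eq) (proj₁ (proj₂ (proj₂ mateₖ)))
          ... | tri> _ _ gt = contradiction (K-resp k q (sym qk) Kk) (outside-K q (0<q q refl) gt)
            where
            0<q : ∀ n → q ≡ n → 0 < q
            0<q zero    eq = contradiction (trans (sym qk) (cong chord eq)) k≢0
            0<q (suc _) eq = subst (0 <_) (sym eq) (s≤s z≤n)
          by-order : _ → ⊥
          by-order (tri> _ _ q<p) = unlinked k<q q<N (sym qk)
            (λ i k<i i<q → chord-elsewhere 0<N p<N (ℕ.<-trans i<q q<N) (p≢0 ∘ sym) (sym p0)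
              (λ { refl → ℕ.n≮0 k<i }) (ℕ.<⇒≢ (ℕ.<-trans i<q q<p)))
            (k≢0 ∘ sym) cross
          by-order (tri≈ _ p≡q _) = k≢0 (trans (sym qk) (trans (cong chord (sym p≡q)) p0))
          by-order (tri< p<q _ _) with ℕ.<-cmp j′ p
          ... | tri≈ _ eq _ = j≢0 (trans jj′ (trans (cong chord eq) p0))
          ... | tri> _ _ p<j′ = ¬Kj (linked⇒K j (crossing-linked 0<j (ℕ.<-trans j<k k<p) p<j′ j′<N (sym p0) jj′) j≢0)
          ... | tri< j′<p _ _ = ¬Kj (inj₂ (crossing-transitive const (k≢0 ∘ sym) k≢j (j≢0 ∘ sym) cross
                  (crossing-sym const (k≢j ∘ sym) (linked⇒crossing const (k≢j ∘ sym)
                    (crossing-linked j<k k<j′ (ℕ.<-trans j′<p p<q) q<N jj′ (sym qk))))))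
            where
            k≢j : chord k ≢ chord j
            k≢j eq = ¬Kj (K-resp k j eq Kk)

      Interval : ℕ → Set
      Interval j = 0 < j × j < k

      interval? : ∀ j → Dec (Interval j)
      interval? j with 0 ℕ.<? j | j ℕ.<? k
      ... | yes p | yes q = yes (p , q)
      ... | no p  | _     = no (p ∘ proj₁)
      ... | yes _ | no q  = no (q ∘ proj₂)

      interval-mate : ∀ {i j} → Interval i → j < period → chord i ≡ chord j → Interval j
      interval-mate {i} {j} (0<i , i<k) j<N eq = positive j refl , below (ℕ.<-cmp j k)
        where
        positive : ∀ n → j ≡ n → 0 < j
        positive zero    j≡0 = contradiction (inj₁ (trans eq (cong chord j≡0))) (outside-K i 0<i i<k)
        positive (suc _) j≡s = subst (0 <_) (sym j≡s) (s≤s z≤n)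
        below : _ → j < k
        below (tri< lt _ _)   = lt
        below (tri≈ _ j≡k _) = contradiction (K-resp k i (trans (cong chord (sym j≡k)) (sym eq)) Kk) (outside-K i 0<i i<k)
        below (tri> _ _ k<j) = contradiction eq (no-escape {i} {j} 0<i i<k k<j j<N)

      D : Fin (e G) → Bool
      D i = does (interval? (proj₁ (position (i , false , false))))

      edge-at : ∀ {y j} → y at j → edgeOf y ≡ chord j
      edge-at (_ , inj₁ refl) = refl
      edge-at (_ , inj₂ refl) = refl

      module _ {y j} (y-at : y at j) where

        private
          o : ∃[ n ] (edgeOf y , false , false) at n
          o = position (edgeOf y , false , false)

          same : chord (proj₁ o) ≡ chord j
          same = trans (sym (edge-at (proj₂ o))) (edge-at y-at)

        D-inside : Interval j → D (edgeOf y) ≡ true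
        D-inside j∈ = dec-true (interval? (proj₁ o)) (interval-mate {j} {proj₁ o} j∈ (proj₁ (proj₂ o)) (sym same))

        D-outside : ¬ Interval j → D (edgeOf y) ≡ false
        D-outside j∉ = dec-false (interval? (proj₁ o)) λ n∈ → j∉ (interval-mate {proj₁ o} {j} n∈ (proj₁ y-at) same)

        D⇒inside : D (edgeOf y) ≡ true → Interval j
        D⇒inside eq with interval? j
        ... | yes j∈ = j∈
        ... | no j∉  = contradiction (trans (sym eq) (D-outside j∉)) λ ()

      l<N : l < period
      l<N = ℕ.<-trans (ℕ.n<1+n l) k<N

    gap-splits : IsJoin G
    gap-splits = splits G D (x 1) (across (x l)) (x≢across 1 l)
      (D-inside (x-at {1} (ℕ.<-trans 1<k k<N)) (s≤s z≤n , 1<k))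
      (D-inside (at-across {k = l} (x-at l<N)) (ℕ.s≤s⁻¹ 1<k , ℕ.n<1+n l))
      (subst (λ y → D (edgeOf y) ≡ false) (sym (corner-x 0)) (D-outside (at-across {k = 0} (x-at 0<N)) (λ { (() , _) })))
      (D-outside (x-at {k} k<N) (ℕ.<-irrefl refl ∘ proj₂))
      closed
      where
      closed : ∀ y → y ≢ x 1 → y ≢ across (x l) → D (edgeOf y) ≡ true → D (edgeOf (corner G y)) ≡ true
      closed y y≢a y≢a′ eq = next-in (proj₂ (position y)) (D⇒inside (proj₂ (position y)) eq)
        where
        next-in : ∀ {j} → y at j → Interval j → D (edgeOf (corner G y)) ≡ true
        next-in {suc zero} (_ , inj₁ y≡) _ = contradiction y≡ y≢a
        next-in {suc (suc j)} (j<N , inj₁ refl) (_ , j<k) = subst (λ y → D (edgeOf y) ≡ true) (sym (corner-x (suc j)))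
          (D-inside (at-across {k = suc j} (x-at (ℕ.<-trans (ℕ.n<1+n _) j<N))) (s≤s z≤n , ℕ.<-trans (ℕ.n<1+n _) j<k))
        next-in {j} (_ , inj₂ refl) (_ , j<k) = D-inside (x-at {suc j} (ℕ.≤-<-trans j+1<k k<N)) (s≤s z≤n , ℕ.≤∧≢⇒< j+1<k j+1≢k)
          where
          j+1<k : suc j ≤ k
          j+1<k = j<k
          j+1≢k : suc j ≢ k
          j+1≢k eq = y≢a′ (cong (across ∘ x) (ℕ.suc-injective eq))

opposite : ∀ {m} → Flag m → Flag m
opposite y = along (across y)

opposite-involutive : ∀ {m} → Involutive (opposite {m})
opposite-involutive (i , s , t) = cong₂ (λ s t → i , s , t) (Bool.not-involutive s) (Bool.not-involutive t)

-- If all ribbons are untwisted and cross each other, the two ends of a ribbon are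
-- followed by the two ends of one ribbon, so the word is a word repeated twice.

module Clique (G : RibbonGraph) (bouquet : #circles G off ≡ 1)
  (all-cross : ∀ {i j} → i ≢ j → Crossing G i j) (untwisted : ∀ i → highest G off i ≡ sides) where

  module _ (x₀ : FlagOf G) where

    open Walk G bouquet x₀
    open Chords G bouquet x₀

    opposite-end : ∀ {p q} → p < q → q < period → chord p ≡ chord q → x q ≡ opposite (x p)
    opposite-end {p} p<q q<N pq = cong₂ _,_ (sym pq)
      (trans (highest-joins p<q q<N pq) (cong (λ π → act π (proj₂ (across (x p)))) (untwisted (chord p))))

    uncrossed : ∀ {i r s} → r < s → s < period → chord r ≡ chord s → (∀ k → r < k → k < s → chord k ≢ i) → i ≢ chord r → ⊥
    uncrossed r<s s<N rs avoids i≢j = unlinked r<s s<N rs avoids i≢j (all-cross i≢j)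

    0<N : 0 < period
    0<N = s≤s z≤n

    mate₀ : ∃[ p ] 0 < p × p < period × chord p ≡ chord 0
    mate₀ with mate 0<N
    ... | zero  , _   , p≢0 , _  = contradiction refl p≢0
    ... | suc p , p<N , _   , p0 = suc p , s≤s z≤n , p<N , p0

    module _ {p} (0<p : 0 < p) (p<N : p < period) (p0 : chord p ≡ chord 0) where

      private
        elsewhere : ∀ {k} → k < period → k ≢ 0 → k ≢ p → chord k ≢ chord 0
        elsewhere k<N = chord-elsewhere 0<N p<N k<N (ℕ.<⇒≢ 0<p) (sym p0)

        mate₁ : 1 < p → ∃[ q ] 1 < q × q ≢ p × q < period × chord 1 ≡ chord q
        mate₁ 1<p with mate (ℕ.<-trans 1<p p<N)
        ... | zero , _ , _ , q1 = contradiction (sym q1) (elsewhere (ℕ.<-trans 1<p p<N) (λ ()) (ℕ.<⇒≢ 1<p))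
        ... | suc zero , _ , q≢1 , _ = contradiction refl q≢1
        ... | suc (suc q) , q<N , _ , q1 = suc (suc q) , s≤s (s≤s z≤n)
            , (λ { refl → elsewhere (ℕ.<-trans 1<p p<N) (λ ()) (ℕ.<⇒≢ 1<p) (trans (sym q1) p0) }) , q<N , sym q1

        mate₁-beyond : (1<p : 1 < p) → p < proj₁ (mate₁ 1<p)
        mate₁-beyond 1<p with mate₁ 1<p
        ... | q , 1<q , q≢p , q<N , 1q with ℕ.<-cmp p q
        ...   | tri< lt _ _ = lt
        ...   | tri≈ _ eq _ = contradiction (sym eq) q≢p
        ...   | tri> _ _ q<p = ⊥-elim (uncrossed 1<q q<N 1q
                (λ k 1<k k<q → elsewhere (ℕ.<-trans k<q q<N) (λ { refl → ℕ.n≮0 1<k }) (ℕ.<⇒≢ (ℕ.<-trans k<q q<p)))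
                (elsewhere (ℕ.<-trans 1<p p<N) (λ ()) (ℕ.<⇒≢ 1<p) ∘ sym))

      next-opposite : x (suc p) ≡ opposite (x 1)
      next-opposite with suc p ℕ.≟ period
      ... | yes sp≡N = trans (trans (cong x sp≡N) x-period) (trans (sym (opposite-involutive x₀))
              (cong opposite (trans (sym (opposite-end 0<p p<N (sym p0))) (cong x p≡1))))
        where
        p≡1 : p ≡ 1
        p≡1 with ℕ.<-cmp 1 p
        ... | tri≈ _ eq _ = sym eq
        ... | tri> _ _ p<1 = contradiction 0<p (ℕ.<⇒≱ p<1)
        ... | tri< 1<p _ _ = contradiction
                (ℕ.s≤s⁻¹ (subst (proj₁ (mate₁ 1<p) <_) (sym sp≡N) (proj₁ (proj₂ (proj₂ (proj₂ (mate₁ 1<p)))))))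
                (ℕ.<⇒≱ (mate₁-beyond 1<p))
      ... | no sp≢N = by-mate (mate sp<N)
        where
        sp<N : suc p < period
        sp<N = ℕ.≤∧≢⇒< p<N sp≢N
        sp≢a : chord (suc p) ≢ chord 0
        sp≢a = elsewhere sp<N (λ ()) (ℕ.<⇒≢ (ℕ.n<1+n p) ∘ sym)
        by-mate : ∃[ r ] r < period × r ≢ suc p × chord r ≡ chord (suc p) → x (suc p) ≡ opposite (x 1)
        by-mate (zero , _ , _ , eq) = contradiction (sym eq) sp≢a
        by-mate (suc zero , _ , _ , eq) = opposite-end (s≤s 0<p) sp<N eq
        by-mate (r@(suc (suc _)) , r<N , r≢sp , eq) = ⊥-elim (by-order (ℕ.<-cmp r p))
          where
          1<r : 1 < r
          1<r = s≤s (s≤s z≤n)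
          by-order : _ → ⊥
          by-order (tri≈ _ r≡p _) = sp≢a (trans (sym eq) (trans (cong chord r≡p) p0))
          by-order (tri> _ _ p<r) = uncrossed (ℕ.≤∧≢⇒< p<r (r≢sp ∘ sym)) r<N (sym eq)
            (λ k sp<k k<r → elsewhere (ℕ.<-trans k<r r<N) (λ { refl → ℕ.n≮0 sp<k })
              (λ { refl → ℕ.<-asym sp<k (ℕ.n<1+n p) })) (sp≢a ∘ sym)
          by-order (tri< r<p _ _) = uncrossed (ℕ.<-trans r<p (ℕ.n<1+n p)) sp<N eq
            (λ k r<k k<sp → chord-elsewhere 1<N q<N (ℕ.<-trans k<sp sp<N) (ℕ.<⇒≢ 1<q) 1q
              (ℕ.<⇒≢ (ℕ.<-trans 1<r r<k) ∘ sym) (ℕ.<⇒≢ (ℕ.<-≤-trans k<sp p<q)))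
            (1≢sp ∘ (λ e → trans e eq))
            where
            1<p : 1 < p
            1<p = ℕ.<-trans 1<r r<p
            1<N : 1 < period
            1<N = ℕ.<-trans 1<p p<N
            q : ℕ
            q = proj₁ (mate₁ 1<p)
            1<q : 1 < q
            1<q = proj₁ (proj₂ (mate₁ 1<p))
            q<N : q < period
            q<N = proj₁ (proj₂ (proj₂ (proj₂ (mate₁ 1<p))))
            1q : chord 1 ≡ chord q
            1q = proj₂ (proj₂ (proj₂ (proj₂ (mate₁ 1<p))))
            p<q : p < q
            p<q = mate₁-beyond 1<p
            1≢sp : chord 1 ≢ chord (suc p)
            1≢sp = chord-elsewhere sp<N r<N 1<N (r≢sp ∘ sym) (sym eq) (ℕ.<⇒≢ (s≤s 0<p)) (ℕ.<⇒≢ 1<r)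

  opposite-commutes : ∀ y → corner G (across (opposite y)) ≡ opposite (corner G (across y))
  opposite-commutes y with mate₀ y
  ... | p , 0<p , p<N , p0 = trans
        (cong (corner G ∘ across) (sym (opposite-end y 0<p p<N (sym p0))))
        (next-opposite y 0<p p<N p0)

xor-cancelˡ : ∀ s {t t′} → s xor t ≡ s xor t′ → t ≡ t′
xor-cancelˡ false eq = eq
xor-cancelˡ true  eq = Bool.not-injective eq

xor-not : ∀ s t → s xor not t ≡ not (s xor t)
xor-not false t = refl
xor-not true  t = refl

shift : ∀ {m} → Bool × Bool → Flag m → Flag m
shift (s , t) (i , s₀ , t₀) = i , s₀ xor s , t₀ xor t

shift-injective : ∀ {m} (y : Flag m) {z z′} → shift z y ≡ shift z′ y → z ≡ z′
shift-injective (i , s₀ , t₀) eq = cong₂ _,_ (xor-cancelˡ s₀ (cong (proj₁ ∘ proj₂) eq)) (xor-cancelˡ t₀ (cong (proj₂ ∘ proj₂) eq))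

shift-ff : ∀ {m} (y : Flag m) → shift (false , false) y ≡ y
shift-ff (i , s , t) = cong₂ (λ s t → i , s , t) (Bool.xor-identityʳ s) (Bool.xor-identityʳ t)

shift-sides : ∀ {m} (y : Flag m) s t → shift (not s , t) y ≡ along (shift (s , t) y)
shift-sides (i , s₀ , t₀) s t = cong (λ r → i , r , t₀ xor t) (xor-not s₀ s)

shift-ends : ∀ {m} (y : Flag m) s t → shift (s , not t) y ≡ across (shift (s , t) y)
shift-ends (i , s₀ , t₀) s t = cong (λ r → i , s₀ xor s , r) (xor-not t₀ t)

shift-ft : ∀ {m} (y : Flag m) → shift (false , true) y ≡ across y
shift-ft y = trans (shift-ends y false false) (cong across (shift-ff y))

shift-tt : ∀ {m} (y : Flag m) → shift (true , true) y ≡ opposite y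
shift-tt y = trans (shift-sides y false true) (cong along (shift-ft y))

shift-tf : ∀ {m} (y : Flag m) → shift (true , false) y ≡ along y
shift-tf y = trans (shift-sides y false false) (cong along (shift-ff y))

along-opposite : ∀ {m} (y : Flag m) → along y ≡ across (opposite y)
along-opposite (i , s , t) = cong (λ u → i , not s , u) (sym (Bool.not-involutive t))

module Doubled (G : RibbonGraph) (bouquet : #circles G off ≡ 1)
  (all-cross : ∀ {i j} → i ≢ j → Crossing G i j) (untwisted : ∀ i → highest G off i ≡ sides)
  (x₀ : FlagOf G) where

  open Walk G bouquet x₀
  open Chords G bouquet x₀
  open Clique G bouquet all-cross untwisted

  private
    p n : ℕ
    p = proj₁ (mate₀ x₀)
    n = ℕ.pred p

    0<p : 0 < p
    0<p = proj₁ (proj₂ (mate₀ x₀))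

    p<N : p < period
    p<N = proj₁ (proj₂ (proj₂ (mate₀ x₀)))

    p0 : chord p ≡ chord 0
    p0 = proj₂ (proj₂ (proj₂ (mate₀ x₀)))

    sn≡p : suc n ≡ p
    sn≡p = ℕ.suc-pred p {{ℕ.>-nonZero 0<p}}

    x-p : x p ≡ opposite x₀
    x-p = opposite-end x₀ 0<p p<N (sym p0)

    x-shift : ∀ k → x (k ℕ.+ p) ≡ opposite (x k)
    x-shift zero    = x-p
    x-shift (suc k) = trans (cong (corner G ∘ across) (x-shift k)) (opposite-commutes (x k))

    x-p+p : ∀ k → x (k ℕ.+ p ℕ.+ p) ≡ x k
    x-p+p k = trans (x-shift (k ℕ.+ p)) (trans (cong opposite (x-shift k)) (opposite-involutive (x k)))

    x-cancel₂ : ∀ k {a b} → x (k ℕ.+ a) ≡ x (k ℕ.+ b) → x a ≡ x b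
    x-cancel₂ zero    eq = eq
    x-cancel₂ (suc k) {a} {b} eq = x-cancel₂ k (x-suc-injective {k ℕ.+ a} {k ℕ.+ b} eq)

    distinct-chords : ∀ {k l} → k < l → l < p → chord k ≢ chord l
    distinct-chords {k} {l} k<l l<p kl with ℕ.m≤n⇒∃[o]m+o≡n (ℕ.<⇒≤ k<l)
    ... | d , refl = x-distinct (ℕ.≤-<-trans (ℕ.m≤n+m d k) l<p) p<N
          (x-cancel₂ k (trans (opposite-end x₀ k<l (ℕ.<-trans l<p p<N) kl) (sym (x-shift k))))

    first-half : ∀ {j} → j < period → ∃[ d ] d < p × (x j ≡ x d ⊎ x j ≡ opposite (x d))
    first-half {j} j<N with ℕ.<-cmp j p
    ... | tri< j<p _ _ = j , j<p , inj₁ refl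
    ... | tri≈ _ refl _ = 0 , 0<p , inj₂ x-p
    ... | tri> _ _ p<j with ℕ.m≤n⇒∃[o]m+o≡n (ℕ.<⇒≤ p<j)
    ...   | d , refl = d , small (ℕ.<-cmp d p) , inj₂ (trans (cong x (ℕ.+-comm p d)) (x-shift d))
      where
      wrapped : p ≤ d → ⊥
      wrapped p≤d with ℕ.m≤n⇒∃[o]m+o≡n p≤d
      ... | c , refl = x-distinct {c} {p ℕ.+ (p ℕ.+ c)}
              (ℕ.<-≤-trans (ℕ.m<n+m c 0<p) (ℕ.m≤n+m (p ℕ.+ c) p)) j<N
              (sym (trans (cong x (trans (ℕ.+-comm p (p ℕ.+ c)) (cong (ℕ._+ p) (ℕ.+-comm p c)))) (x-p+p c)))
      small : _ → d < p
      small (tri< lt _ _)   = lt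
      small (tri≈ _ eq _) = ⊥-elim (wrapped (ℕ.≤-reflexive (sym eq)))
      small (tri> _ _ gt) = ⊥-elim (wrapped (ℕ.<⇒≤ gt))

    g : Flag (suc n) → FlagOf G
    g (k , z) = shift z (x (toℕ k))

    bound : ∀ (k : Fin (suc n)) → toℕ k < p
    bound k = subst (toℕ k <_) sn≡p (Fin.toℕ<n k)

    g-injective : ∀ {y y′} → g y ≡ g y′ → y ≡ y′
    g-injective {k , z} {k′ , z′} eq with ℕ.<-cmp (toℕ k) (toℕ k′)
    ... | tri< lt _ _ = contradiction (cong edgeOf eq) (distinct-chords lt (bound k′))
    ... | tri> _ _ gt = contradiction (sym (cong edgeOf eq)) (distinct-chords gt (bound k))
    ... | tri≈ _ k≡k′ _ with Fin.toℕ-injective k≡k′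
    ...   | refl = cong (k ,_) (shift-injective (x (toℕ k)) eq)

    g-surjective : ∀ y → ∃[ y′ ] g y′ ≡ y
    g-surjective y = by-position (position y)
      where
      by-half : ∀ {j} → y ≡ x j ⊎ y ≡ across (x j) → ∃[ d ] d < p × (x j ≡ x d ⊎ x j ≡ opposite (x d)) → ∃[ y′ ] g y′ ≡ y
      by-half {j} side (d , d<p , half) = choose side half
        where
        d<sn : d < suc n
        d<sn = subst (d <_) (sym sn≡p) d<p
        k : Fin (suc n)
        k = fromℕ< d<sn
        x-k : x (toℕ k) ≡ x d
        x-k = cong x (Fin.toℕ-fromℕ< d<sn)
        choose : y ≡ x j ⊎ y ≡ across (x j) → x j ≡ x d ⊎ x j ≡ opposite (x d) → ∃[ y′ ] g y′ ≡ y
        choose (inj₁ r) (inj₁ q) = (k , false , false) , trans (shift-ff _) (trans x-k (trans (sym q) (sym r)))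
        choose (inj₂ r) (inj₁ q) = (k , false , true) , trans (shift-ft _) (trans (cong across (trans x-k (sym q))) (sym r))
        choose (inj₁ r) (inj₂ q) = (k , true , true) , trans (shift-tt _) (trans (cong opposite x-k) (trans (sym q) (sym r)))
        choose (inj₂ r) (inj₂ q) = (k , true , false) , trans (shift-tf _) (trans (cong along x-k)
                                     (trans (along-opposite (x d)) (trans (cong across (sym q)) (sym r))))
      by-position : ∃[ j ] y at j → ∃[ y′ ] g y′ ≡ y
      by-position (j , j<N , side) = by-half {j} side (first-half j<N)

    H : RibbonGraph
    H = B[ suc n ]

    Commutes : Flag (suc n) → Set
    Commutes y = g (corner H y) ≡ corner G (g y)

    inject₁-exit : ∀ s j → Commutes (inject₁ j , s , not s)
    inject₁-exit s j = trans (cong g (corner-inject₁ n s j)) (by-copy s)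
      where
      x-j : x (toℕ (inject₁ j)) ≡ x (toℕ j)
      x-j = cong x (Fin.toℕ-inject₁ j)
      by-copy : ∀ s → g (suc j , s , s) ≡ corner G (g (inject₁ j , s , not s))
      by-copy false = trans (shift-ff _) (cong (corner G) (sym (trans (shift-ft _) (cong across x-j))))
      by-copy true  = trans (shift-tt _) (trans (sym (opposite-commutes (x (toℕ j))))
        (cong (corner G) (sym (trans (shift-tf _) (trans (cong along x-j) (along-opposite (x (toℕ j))))))))

    fromℕ-exit : ∀ s → Commutes (fromℕ n , s , not s)
    fromℕ-exit s = trans (cong g (corner-fromℕ n s)) (by-copy s)
      where
      x-n : x (toℕ (fromℕ n)) ≡ x n
      x-n = cong x (Fin.toℕ-fromℕ n)
      x-sn : x (suc n) ≡ opposite x₀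
      x-sn = trans (cong x sn≡p) x-p
      by-copy : ∀ s → g (zero , not s , not s) ≡ corner G (g (fromℕ n , s , not s))
      by-copy false = trans (shift-tt x₀) (trans (sym x-sn) (cong (corner G) (sym (trans (shift-ft _) (cong across x-n)))))
      by-copy true  = trans (shift-ff x₀) (trans (sym (opposite-involutive x₀)) (trans (cong opposite (sym x-sn))
        (trans (sym (opposite-commutes (x n)))
          (cong (corner G) (sym (trans (shift-tf _) (trans (cong along x-n) (along-opposite (x n)))))))))

    exit-commutes : ∀ s k → Commutes (k , s , not s)
    exit-commutes s k = by-view (view k)
      where
      by-view : ∀ {k} → Data.Fin.Relation.Unary.Top.View k → Commutes (k , s , not s)
      by-view ‵fromℕ       = fromℕ-exit s
      by-view (‵inject₁ j) = inject₁-exit s j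

    commutes-corner : ∀ y → Commutes y → Commutes (corner H y)
    commutes-corner y eq = trans (cong g (corner-involutive H y))
      (trans (sym (corner-involutive G (g y))) (cong (corner G) (sym eq)))

    commutes : ∀ y → Commutes y
    commutes (k , s , t) = by-side (t Bool.≟ s)
      where
      q : HalfEdge (suc n)
      q = predʰ (rotation (suc n)) (s , k)
      by-side : Dec (t ≡ s) → Commutes (k , s , t)
      by-side (no t≢s) = subst (λ u → Commutes (k , s , u)) (sym (Bool.¬-not t≢s)) (exit-commutes s k)
      by-side (yes refl) = subst Commutes
        (trans (corner-exit (rotation (suc n)) q) (cong (entry (rotation (suc n))) (succ-pred (rotation (suc n)) (s , k))))
        (commutes-corner (exit (rotation (suc n)) q) (exit-commutes (proj₁ q) (proj₂ q)))

    H≅G : H ≅ G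
    H≅G = record
      { flags           = ⤖⇒↔ (mk⤖ (g-injective , strictlySurjective⇒surjective g-surjective))
      ; corner-commutes = commutes
      ; along-commutes  = λ { (k , s , t) → shift-sides (x (toℕ k)) s t }
      ; across-commutes = λ { (k , s , t) → shift-ends (x (toℕ k)) s t }
      }

  doubled-word : ∃[ n ] G ≅ B[ suc n ]
  doubled-word = n , ≅-sym H≅G

module Twisted (G : RibbonGraph) (bouquet : #circles G off ≡ 1) (i : Fin (e G)) (only : ∀ j → j ≡ i)
  (twisted-i : highest G off i ≡ diags) where

  private
    x₀ : FlagOf G
    x₀ = i , false , false

    open Walk G bouquet x₀
    open Chords G bouquet x₀

    0<N : 0 < period
    0<N = s≤s z≤n

    chords≡ : ∀ k l → chord k ≡ chord l
    chords≡ k l = trans (only (chord k)) (sym (only (chord l)))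

    at-most-two : ∀ {k l} → k < period → l < period → k ≢ 0 → l ≢ 0 → k ≡ l
    at-most-two {k} {l} k<N l<N = only-two k<N 0<N l<N (chords≡ k 0) (chords≡ l 0)

    1<N : 1 < period
    1<N with mate 0<N
    ... | zero  , _    , 0≢0 , _ = contradiction refl 0≢0
    ... | suc l , sl<N , _   , _ = ℕ.≤-<-trans (s≤s z≤n) sl<N

    period≡2 : period ≡ 2
    period≡2 with ℕ.<-cmp 2 period
    ... | tri< 2<N _ _ = contradiction (at-most-two 1<N 2<N (λ ()) (λ ())) λ ()
    ... | tri≈ _ eq _  = sym eq
    ... | tri> _ _ N<2 = contradiction 1<N (ℕ.<⇒≱ N<2)

    x-1 : x 1 ≡ (i , true , false)
    x-1 = cong₂ _,_ (only (chord 1)) (trans (highest-joins (s≤s z≤n) 1<N (chords≡ 0 1)) (cong (λ π → act π (false , true)) twisted-i))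

    x-2 : x 2 ≡ x₀
    x-2 = trans (cong x (sym period≡2)) x-period

    corner-ft : corner G (i , false , true) ≡ (i , true , false)
    corner-ft = x-1

    corner-tt : corner G (i , true , true) ≡ (i , false , false)
    corner-tt = trans (cong (corner G ∘ across) (sym x-1)) x-2

    g : Flag 1 → FlagOf G
    g (_ , z) = i , z

    commutes : ∀ y → g (corner B₁̄ y) ≡ corner G (g y)
    commutes (zero , false , true)  = sym corner-ft
    commutes (zero , true  , true)  = sym corner-tt
    commutes (zero , true  , false) = trans (sym (corner-involutive G _)) (cong (corner G) corner-ft)
    commutes (zero , false , false) = trans (sym (corner-involutive G _)) (cong (corner G) corner-tt)

    B₁̄≅G : B₁̄ ≅ G
    B₁̄≅G = record
      { flags           = mk↔ₛ′ g (λ { (_ , z) → zero , z }) (λ { (j , z) → cong (_, z) (sym (only j)) }) (λ { (zero , z) → refl })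
      ; corner-commutes = commutes
      ; along-commutes  = λ _ → refl
      ; across-commutes = λ _ → refl
      }

  twisted-loop : G ≅ B₁̄
  twisted-loop = ≅-sym B₁̄≅G

module _ (G : RibbonGraph) (bouquet : #circles G off ≡ 1) {C} (const : Constant G C) where

  Near : FlagOf G → Set
  Near y = edgeOf (corner G (across y)) ≡ edgeOf y ⊎ Crossing G (edgeOf y) (edgeOf (corner G (across y)))

  all-crossing : (∀ y → Near y) → ∀ {i j} → i ≢ j → Crossing G i j
  all-crossing near {i} {j} i≢j = at-j (position (j , false , false))
    where
    open Walk G bouquet (i , false , false)
    open Gap G bouquet const (i , false , false)
    open Chords G bouquet (i , false , false) using (chord)
    K-all : ∀ k → K k
    K-all zero    = inj₁ refl
    K-all (suc k) = by-cases (chord (suc k) Fin.≟ chord 0) (chord k Fin.≟ chord 0) (chord (suc k) Fin.≟ chord k) (near (x k)) (K-all k)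
      where
      by-cases : Dec (chord (suc k) ≡ chord 0) → Dec (chord k ≡ chord 0) → Dec (chord (suc k) ≡ chord k) →
        Near (x k) → K k → K (suc k)
      by-cases (yes p) _ _ _ _ = inj₁ p
      by-cases (no p) (yes q) _ (inj₁ r) _ = contradiction (trans r q) p
      by-cases (no p) (yes q) _ (inj₂ r) _ = inj₂ (subst (λ i → Crossing G i (chord (suc k))) q r)
      by-cases (no p) (no q) _ _ (inj₁ r) = contradiction r q
      by-cases (no p) (no q) (yes r) _ (inj₂ s) = inj₂ (subst (Crossing G (chord 0)) (sym r) s)
      by-cases (no p) (no q) (no r) (inj₁ r′) _ = contradiction r′ r
      by-cases (no p) (no q) (no r) (inj₂ s) (inj₂ t) =
        inj₂ (crossing-transitive const (q ∘ sym) (r ∘ sym) (p ∘ sym) t s)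
    edge-at : ∀ {k} → (j , false , false) at k → j ≡ chord k
    edge-at (_ , inj₁ p) = cong edgeOf p
    edge-at (_ , inj₂ p) = cong edgeOf p
    at-j : ∃[ k ] (j , false , false) at k → Crossing G i j
    at-j (k , p) = finish (K-all k)
      where
      finish : K k → Crossing G i j
      finish (inj₁ q) = contradiction (sym (trans (edge-at p) q)) i≢j
      finish (inj₂ q) = subst (Crossing G i) (sym (edge-at p)) q

  crossing⇒highest : ∀ {i j} → i ≢ j → Crossing G i j → highest G off i ≡ sides
  crossing⇒highest {i} i≢j L with highest G off i ≟ᵖ sides
  ... | yes eq = eq
  ... | no neq = contradiction
        (trans (sym (Chords.highest-two G bouquet (i , false , false) i))
          (trans (highest-count G off i {sides} (neq ∘ sym)) (cong suc (crossing⇒untwisted const i≢j L)))) λ ()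

  prime : Fin (e G) → (∀ y → Near y) → ∃[ F ] G ≅ ⟦ F ⟧
  prime i near with Fin.all? (λ i → highest G off i ≟ᵖ sides)
  ... | yes untw with Doubled.doubled-word G bouquet (all-crossing near) untw (i , false , false)
  ...   | n , φ with parity-odd (suc n) (constant⇒odd n (constant-≅ φ const))
  ...     | s , eq = odd s , subst (λ m → G ≅ B[ m ]) eq φ
  prime i near | no ¬untw with Fin.¬∀⟶∃¬ (e G) _ (λ i → highest G off i ≟ᵖ sides) ¬untw
  ... | j , j-twisted = twisted , Twisted.twisted-loop G bouquet j only diagonal
    where
    only : ∀ k → k ≡ j
    only k with k Fin.≟ j
    ... | yes eq = eq
    ... | no neq = contradiction (crossing⇒highest (neq ∘ sym) (all-crossing near (neq ∘ sym))) j-twisted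
    diagonal : highest G off j ≡ diags
    diagonal = by-value (highest G off j) refl
      where
      by-value : ∀ p → highest G off j ≡ p → highest G off j ≡ diags
      by-value diags eq = eq
      by-value sides eq = contradiction eq j-twisted
      by-value ends  eq = contradiction eq (Chords.highest≢ends G bouquet (j , false , false) j)

  near? : ∀ y → Dec (Near y)
  near? y = (edgeOf (corner G (across y)) Fin.≟ edgeOf y) ⊎-dec Crossing? G (edgeOf y) (edgeOf (corner G (across y)))

  prime-or-join : Fin (e G) → (∃[ F ] G ≅ ⟦ F ⟧) ⊎ IsJoin G
  prime-or-join i = by-cases (All.all? near? (allFlags (e G)))
    where
    by-cases : Dec (All Near (allFlags (e G))) → (∃[ F ] G ≅ ⟦ F ⟧) ⊎ IsJoin G
    by-cases (yes near) = inj₁ (prime i (λ y → All.lookup near (∈-allFlags y)))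
    by-cases (no ¬near) = inj₂ (let y , far = Any.satisfied (¬All⇒Any¬ near? (allFlags (e G)) ¬near) in
      Gap.gap-splits G bouquet const y far)

decompose : ∀ n B {C} → e B ≤ n → Fin (e B) → #circles B off ≡ 1 → Constant B C → ∃[ Fs ] B ≅⋁ Fs
decompose zero    B e≤0 i _ _ = contradiction (ℕ.≤-trans (Fin.toℕ<n i) e≤0) (ℕ.n≮0 {toℕ i})
decompose (suc n) B e≤n i bouquet const = by-cases (prime-or-join B bouquet const i)
  where
  by-cases : (∃[ F ] B ≅ ⟦ F ⟧) ⊎ IsJoin B → ∃[ Fs ] B ≅⋁ Fs
  by-cases (inj₁ (F , φ)) = _ , factor F φ
  by-cases (inj₂ (P , Q , a , b , φ)) = _ , joined (proj₂ P-factors) (proj₂ Q-factors) a b φ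
    where
    P∨Q : RibbonGraph
    P∨Q = ribbonJoin P Q a b
    sizes : e P ℕ.+ e Q ≤ suc n
    sizes = subst (_≤ suc n) (≅⇒e≡ φ) e≤n
    positive : ∀ {m} → Fin m → 1 ≤ m
    positive zero    = s≤s z≤n
    positive (suc _) = s≤s z≤n
    eP≤n : e P ≤ n
    eP≤n = ℕ.s≤s⁻¹ (ℕ.≤-trans (subst (_≤ e P ℕ.+ e Q) (ℕ.+-comm (e P) 1) (ℕ.+-monoʳ-≤ (e P) (positive (edgeOf b)))) sizes)
    eQ≤n : e Q ≤ n
    eQ≤n = ℕ.s≤s⁻¹ (ℕ.≤-trans (ℕ.+-monoˡ-≤ (e Q) (positive (edgeOf a))) sizes)
    circles-sum : #circles P off ℕ.+ #circles Q off ≡ 2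
    circles-sum = trans (sym (#circles-join P Q off off a b)) (cong suc (trans
      (#circles-cong P∨Q off-off) (trans (sym (#circles-≅ φ off)) bouquet)))
      where
      off-off : _⊔_ P Q off off ≗ off
      off-off k with splitAt (e P) k
      ... | inj₁ _ = refl
      ... | inj₂ _ = refl
    both-one : ∀ {k l} → 1 ≤ k → 1 ≤ l → k ℕ.+ l ≡ 2 → k ≡ 1 × l ≡ 1
    both-one {suc zero} {suc zero} _ _ _ = refl , refl
    both-one {suc zero} {suc (suc l)} _ _ ()
    both-one {suc (suc zero)} {suc l} _ _ ()
    both-one {suc (suc (suc k))} _ _ ()
    ones : #circles P off ≡ 1 × #circles Q off ≡ 1
    ones = both-one (#circles≥1 P (edgeOf a) off) (#circles≥1 Q (edgeOf b) off) circles-sum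
    P-factors : ∃[ Fs ] P ≅⋁ Fs
    P-factors = decompose n P eP≤n (edgeOf a) (proj₁ ones) (proj₂ (constant-joinˡ P Q a b (constant-≅ φ const)))
    Q-factors : ∃[ Fs ] Q ≅⋁ Fs
    Q-factors = decompose n Q eQ≤n (edgeOf b) (proj₂ ones) (proj₂ (constant-joinʳ P Q a b (constant-≅ φ const)))

bouquet⇒one-circle : ∀ B → IsBouquet B → #circles B off ≡ 1
bouquet⇒one-circle B bouquet = Classes-unique (circles B off)
  (Classes-cong (Orbit-cong (λ _ → refl) (λ _ → refl)) (Orbit-cong (λ _ → refl) (λ _ → refl))
    (subst (Classes (Orbit (corner B) across)) bouquet (#orbits-classes (corner-involutive B) across-involutive)))

theorem22 : (B : RibbonGraph) → IsBouquet B → 1 ≤ e B →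
    ((∃[ b ] ∂ε B ≗ 2 ^ e B · z^ (+ b)) ⇔ (∃[ Fs ] (1 ≤ length Fs × B ≅⋁ Fs)))
    × ((b : ℕ) (Fs : List 𝓑) → ∂ε B ≗ 2 ^ e B · z^ (+ b) → B ≅⋁ Fs →
    + b ≡ + e B - + length Fs + + #twisted Fs)
theorem22 B bouquet 1≤e = mk⇔ forth (λ { (Fs , _ , p) → ⋁⇒monomial p }) , λ b Fs → ⋁-exponent b
  where
  forth : ∃[ b ] ∂ε B ≗ 2 ^ e B · z^ (+ b) → ∃[ Fs ] (1 ≤ length Fs × B ≅⋁ Fs)
  forth (b , mono) = Fs , ⋁⇒nonempty B≅⋁Fs , B≅⋁Fs
    where
    factors : ∃[ Fs ] B ≅⋁ Fs
    factors = decompose (e B) B ℕ.≤-refl (fromℕ< 1≤e) (bouquet⇒one-circle B bouquet)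
      (proj₂ (proj₂ (monomial⇒constant B b mono)))
    Fs : List 𝓑
    Fs = proj₁ factors
    B≅⋁Fs : B ≅⋁ Fs
    B≅⋁Fs = proj₂ factors
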